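{- Let $G$ be a graph. Then $G$ is both a circular-arc graph and a minimal forbidden induced subgraph for the class of Helly circular-arc graphs if and only if $G$ is an essential obstacle.
   Context: All graphs are finite, undirected, without loops or multiple edges. A circular-arc graph is the intersection graph of a finite set of arcs on a circle (such a set is a circular-arc model of the graph). A Helly circular-arc graph is a graph having a circular-arc model with the Helly property (every nonempty subfamily of pairwise intersecting arcs has a common point). A minimal forbidden induced subgraph for a hereditary class is a graph not in the class all of whose proper induced subgraphs are in the class. $\overline N_G(v)$ denotes the set of vertices of $G$ different from $v$ and nonadjacent to $v$. An obstacle enumeration in a graph $G$ is a circular enumeration $\mathcal Q=v_1,\ldots,v_k$ of $k\ge 3$ pairwise different vertices such that $Q=\{v_1,\ldots,v_k\}$ is a clique of $G$, together with, for each $i\in\{1,\ldots,k\}$, a linear enumeration $\mathcal W_i$ (the witness enumeration of $v_iv_{i+1}$) of one or two vertices of $G$ such that (indices modulo $k$) either $(\mathcal O_1)$ $\mathcal W_i=w_i$ where $\overline N_G(w_i)\cap Q=\{v_i,v_{i+1}\}$; or $(\mathcal O_2)$ $\mathcal W_i=u_i,z_i$ where $\overline N_G(u_i)\cap Q=\{v_i\}$, $\overline N_G(z_i)\cap Q=\{v_{i+1}\}$, and $u_iz_i\in E(G)$. Witness enumerations of different edges may share vertices. The vertices occurring in $\mathcal W_1,\ldots,\mathcal W_k$ are the witnesses of $\mathcal Q$. $\mathcal Q$ is an obstacle enumeration of $G$ if every vertex of $G$ belongs to $Q$ or is a witness of $\mathcal Q$. An obstacle is a graph having an obstacle enumeration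 of it. An edge $y_1y_2$ of $G$ joining two witnesses is valid if either one of $\overline N_G(y_1)\cap Q$ and $\overline N_G(y_2)\cap Q$ is a subset of the other, or $y_1$ and $y_2$ occur together in some witness enumeration of $\mathcal Q$. An obstacle enumeration is essential if every edge joining two of its witnesses is valid. An obstacle is essential if there is an essential obstacle enumeration of it. -}

module Defs where

open import Data.Fin.Base using (Fin; toℕ)
open import Data.Fin.Subset as Subset using (Subset; Nonempty)
open import Data.Nat.Base as ℕ using (ℕ; suc)
open import Data.Nat.DivMod using (_mod_)
open import Data.Product using (Σ; ∃-syntax; _×_; proj₁)
open import Data.Rational.Base using (ℚ; 0ℚ; 1ℚ; _≤_; _<_)
open import Data.Sum using (_⊎_)
open import Function.Base using (_on_)
open import Function.Bundles using (_⇔_; _↣_; module Injection)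
open import Relation.Binary.Core using (Rel)
open import Relation.Binary.Definitions using (Decidable; Irreflexive; Symmetric)
open import Relation.Binary.PropositionalEquality using (_≡_; _≢_)
open import Relation.Nullary using (¬_)
open import Relation.Unary using (Pred; _∈_; _∩_; _∪_; _⊆_; _≐_; _≬_; ｛_｝)
open import Level using (0ℓ)

record Graph (n : ℕ) : Set₁ where
  field
    Adj    : Rel (Fin n) 0ℓ
    adj?   : Decidable Adj
    symm   : Symmetric Adj
    irrefl : Irreflexive _≡_ Adj

open Graph public

-- Every induced subgraph of G is, up to relabelling its vertices by an initial
-- segment of ℕ, of the form  induced G f.
induced : ∀ {m n} → Graph n → Fin m ↣ Fin n → Graph m
induced G f = record
  { Adj    = Adj G on to
  ; adj?   = λ u v → adj? G (to u) (to v)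
  ; symm   = symm G
  ; irrefl = λ u≡v → irrefl G (cong u≡v)
  }
  where open Injection f using (to; cong)

Proper : ∀ {m n} → Fin m ↣ Fin n → Set
Proper f = ∃[ v ] (∀ u → Injection.to f u ≢ v)

MinimalForbiddenInducedSubgraph : (∀ {n} → Graph n → Set) → ∀ {n} → Graph n → Set
MinimalForbiddenInducedSubgraph 𝒞 {n} G =
  ¬ 𝒞 G × (∀ {m} (f : Fin m ↣ Fin n) → Proper f → 𝒞 (induced G f))

-- The circle is ℚ/ℤ, each point being given by its representative in [0,1).
-- Rational points suffice: finitely many arcs can always be moved to rational
-- endpoints without changing which subfamilies have a common point.
record Point : Set where
  field
    pos   : ℚ
    0≤pos : 0ℚ ≤ pos
    pos<1 : pos < 1ℚ

open Point public

-- The closed arc traversed in the positive direction from start to end.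
-- It wraps around the point 0 when end < start.
record Arc : Set where
  field
    start end : Point
    start≢end : pos start ≢ pos end

open Arc public

⟦_⟧ : Arc → Pred Point 0ℓ
⟦ a ⟧ x =
    (pos (start a) ≤ pos (end a) × (pos (start a) ≤ pos x × pos x ≤ pos (end a)))
  ⊎ (pos (end a) < pos (start a) × (pos (start a) ≤ pos x ⊎ pos x ≤ pos (end a)))

record CircularArcModel {n} (G : Graph n) : Set where
  field
    arc       : Fin n → Arc
    adj⇔meets : ∀ {u v} → u ≢ v → Adj G u v ⇔ (⟦ arc u ⟧ ≬ ⟦ arc v ⟧)

open CircularArcModel public

Helly : ∀ {n} → (Fin n → Arc) → Set
Helly {n} arcs = (S : Subset n) → Nonempty S →
  (∀ {u v} → u Subset.∈ S → v Subset.∈ S → ⟦ arcs u ⟧ ≬ ⟦ arcs v ⟧) →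
  ∃[ x ] (∀ {u} → u Subset.∈ S → x ∈ ⟦ arcs u ⟧)

CircularArc : ∀ {n} → Graph n → Set
CircularArc G = CircularArcModel G

HellyCircularArc : ∀ {n} → Graph n → Set
HellyCircularArc G = Σ (CircularArcModel G) λ M → Helly (arc M)

NonNeighbours : ∀ {n} → Graph n → Fin n → Pred (Fin n) 0ℓ
NonNeighbours G v u = u ≢ v × ¬ Adj G v u

next : ∀ {k} → Fin k → Fin k
next {suc k} i = suc (toℕ i) mod suc k

data Witnesses {n} (G : Graph n) (Q : Pred (Fin n) 0ℓ) (a b : Fin n) : Set where
  𝒪₁ : (w : Fin n) →
       NonNeighbours G w ∩ Q ≐ ｛ a ｝ ∪ ｛ b ｝ →
       Witnesses G Q a b
  𝒪₂ : (u z : Fin n) →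
       NonNeighbours G u ∩ Q ≐ ｛ a ｝ →
       NonNeighbours G z ∩ Q ≐ ｛ b ｝ →
       Adj G u z →
       Witnesses G Q a b

members : ∀ {n} {G : Graph n} {Q a b} → Witnesses G Q a b → Pred (Fin n) 0ℓ
members (𝒪₁ w _)       = ｛ w ｝
members (𝒪₂ u z _ _ _) = ｛ u ｝ ∪ ｛ z ｝

record ObstacleEnumerationIn {n} (G : Graph n) : Set where
  field
    k    : ℕ
    3≤k  : 3 ℕ.≤ k
    enum : Fin k ↣ Fin n

  v : Fin k → Fin n
  v = Injection.to enum

  Q : Pred (Fin n) 0ℓ
  Q x = ∃[ i ] v i ≡ x

  field
    clique : ∀ {x y} → x ∈ Q → y ∈ Q → x ≢ y → Adj G x y
    W      : ∀ i → Witnesses G Q (v i) (v (next i))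

  Witness : Pred (Fin n) 0ℓ
  Witness x = ∃[ i ] x ∈ members (W i)

  Valid : Rel (Fin n) 0ℓ
  Valid y₁ y₂ =
      (NonNeighbours G y₁ ∩ Q ⊆ NonNeighbours G y₂ ∩ Q)
    ⊎ (NonNeighbours G y₂ ∩ Q ⊆ NonNeighbours G y₁ ∩ Q)
    ⊎ (∃[ i ] (y₁ ∈ members (W i) × y₂ ∈ members (W i)))

  Covering : Set
  Covering = ∀ x → x ∈ Q ⊎ x ∈ Witness

  Essential : Set
  Essential = ∀ {y₁ y₂} → y₁ ∈ Witness → y₂ ∈ Witness → Adj G y₁ y₂ → Valid y₁ y₂

ObstacleEnumerationOf : ∀ {n} → Graph n → Set
ObstacleEnumerationOf G = Σ (ObstacleEnumerationIn G) ObstacleEnumerationIn.Covering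

EssentialObstacle : ∀ {n} → Graph n → Set
EssentialObstacle G =
  Σ (ObstacleEnumerationOf G) λ 𝒬 → ObstacleEnumerationIn.Essential (proj₁ 𝒬)

{-# OPTIONS --safe #-}
-- If a family of arcs has no common point, a minimal non-Helly subfamily Q is
-- circularly ordered by the points pᵢ that lie on all its arcs but that of vᵢ.
-- Between pᵢ and pᵢ₊₁ either the arcs of vᵢ and vᵢ₊₁ can be prolonged until
-- they cover the circle together, or the obstructing arcs are witnesses of
-- vᵢvᵢ₊₁. As the number of pairs of arcs covering the circle only grows, every
-- circular-arc graph is Helly or contains an obstacle; in a minimal graph the
-- obstacle is spanning, and an invalid edge y₁y₂ would be a better choice of
-- witnesses, making some other vertex superfluous.
--
-- Conversely, an obstacle is not Helly, and an essential obstacle has an explicit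
-- model in which the witnesses of vᵢvᵢ₊₁ live near the common part of the
-- complements of the arcs of vᵢ and vᵢ₊₁. Without one of its witnesses the two
-- arcs can be prolonged to meet there; without a vertex of Q the model is Helly
-- as it stands, except for the octahedron, where Q and the witnesses can be
-- exchanged.
module Submission where

open import Defs
open import Data.Bool.Base using (T)
open import Data.Empty using (⊥; ⊥-elim)
open import Data.Fin.Base as Fin using (Fin; zero; suc; toℕ; fromℕ; inject₁)
import Data.Fin.Properties as Finₚ
open import Data.Fin.Subset as Subset using (Subset; Nonempty; ⁅_⁆; ∁; ∣_∣) renaming (_-_ to _∖_; _∪_ to _∪ˢ_)
import Data.Fin.Subset.Properties as Subsetₚ
import Data.Integer.Base as ℤ
import Data.Integer.Properties as ℤₚ
open import Data.List.Base using (List; lookup; filter; allFin; length)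
import Data.List.Membership.Propositional as List
import Data.List.Membership.Propositional.Properties as ∈ₚ
open import Data.List.Relation.Binary.Permutation.Propositional using (↭-sym; ↭⇒↭ₛ)
open import Data.List.Relation.Binary.Permutation.Propositional.Properties using (∈-resp-↭)
import Data.List.Relation.Binary.Permutation.Setoid.Properties as ↭ₛ
import Data.List.Relation.Unary.All as All
open import Data.List.Relation.Unary.AllPairs using (AllPairs; _∷_)
import Data.List.Relation.Unary.Any as Any
import Data.List.Relation.Unary.Any.Properties as Anyₚ
import Data.List.Relation.Unary.Sorted.TotalOrder.Properties as Sorted
import Data.List.Relation.Unary.Unique.Propositional.Properties as Unique
import Data.List.Sort as Sort
open import Data.Nat.Base as ℕ using (ℕ; zero; suc; s≤s; z≤n)
open import Data.Nat.Coprimality using (Coprime)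
import Data.Nat.Divisibility as ℕ
import Data.Nat.DivMod as ℕ
open import Data.Nat.Induction using (<-wellFounded)
import Data.Nat.Properties as ℕₚ
open import Data.Product using (Σ; ∃; ∃-syntax; _×_; _,_; proj₁; proj₂)
open import Data.Rational.Base as ℚ using (ℚ; 0ℚ; 1ℚ; _≤_; _<_)
import Data.Rational.Properties as ℚₚ
open import Data.Sum using (_⊎_; inj₁; inj₂; [_,_]′; map₂)
open import Data.Unit.Base using (⊤; tt)
open import Data.Vec.Base using (tabulate)
import Data.Vec.Properties as Vecₚ
open import Function.Base using (_∘_; flip)
open import Function.Bundles using (_⇔_; _↣_; module Injection; module Equivalence; mk⇔; mk↣)
open import Induction.WellFounded using (Acc; acc)
open import Level using (0ℓ)
open import Relation.Binary.Bundles using (DecTotalOrder)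
import Relation.Binary.Construct.On as On
open import Relation.Binary.Core using (Rel)
open import Relation.Binary.Definitions using (tri<; tri≈; tri>)
open import Relation.Binary.PropositionalEquality using (_≡_; _≢_; refl; sym; trans; cong; cong₂; subst; subst₂; setoid; ≢-sym)
open import Relation.Nullary using (¬_; Dec; yes; no; does; ¬?; _×-dec_; _⊎-dec_; _→-dec_)
open import Relation.Nullary.Decidable using (dec-true; decidable-stable)
open import Relation.Unary using (Pred; Decidable; _∈_; _∉_; _≬_; _⊆_; _∩_; _∪_; _≐_; ｛_｝)


-- Cyclic indices

-- In an arbitrary model an edge could a priori join witnesses that miss distant parts of `Q`. What
-- excludes this is that every point of the circle lies in the closed stretch between some pᵢ and
-- pᵢ₊₁, hence on all arcs of the clique but possibly those of vᵢ and vᵢ₊₁: a common point of two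
-- witness arcs confines both missed sets to one such pair. An invalid edge can then only join a
-- vertex missing just vᵢ to one missing just vᵢ₊₁, which is a ready-made enumeration of type `𝒪₂`.
-- In the explicit model a witness, or two adjacent witnesses, always share a point with all their
-- common neighbours in `Q`. So a clique can lack a common point only if it contains no witness or
-- at least three. A deletion has to repair the first kind. The second kind arises only when three
-- enumerations of type `𝒪₂` close up cyclically, and deleting any witness then destroys the
-- triangle.

toℕ-next : ∀ {k} (i : Fin (suc k)) → toℕ (next i) ≡ suc (toℕ i) ℕ.% suc k
toℕ-next {k} i = Finₚ.toℕ-fromℕ< (ℕ.m%n<n (suc (toℕ i)) (suc k))

data NextView {k} (i : Fin k) : Set where
  step : toℕ (next i) ≡ suc (toℕ i) → NextView i
  wrap : suc (toℕ i) ≡ k → toℕ (next i) ≡ 0 → NextView i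

nextView : ∀ {k} (i : Fin k) → NextView i
nextView {suc k} i with suc (toℕ i) ℕₚ.<? suc k
... | yes i+1<k = step (trans (toℕ-next i) (ℕ.m<n⇒m%n≡m i+1<k))
... | no  i+1≮k = wrap i+1≡k
  (trans (toℕ-next i) (trans (cong (ℕ._% suc k) i+1≡k) (ℕ.n%n≡0 (suc k))))
  where
  i+1≡k : suc (toℕ i) ≡ suc k
  i+1≡k = ℕₚ.≤-antisym (Finₚ.toℕ<n i) (ℕₚ.≮⇒≥ i+1≮k)

prev : ∀ {k} → Fin k → Fin k
prev {suc k} zero    = fromℕ k
prev {suc k} (suc i) = inject₁ i

next-prev : ∀ {k} (i : Fin k) → next (prev i) ≡ i
next-prev {suc k} zero with nextView (fromℕ k)
... | step eq   = ⊥-elim (ℕₚ.<⇒≢ (Finₚ.toℕ<n (next (fromℕ k)))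
                    (trans eq (cong suc (Finₚ.toℕ-fromℕ k))))
... | wrap _ eq = Finₚ.toℕ-injective eq
next-prev {suc k} (suc i) with nextView (inject₁ i)
... | step eq   = Finₚ.toℕ-injective (trans eq (cong suc (Finₚ.toℕ-inject₁ i)))
... | wrap eq _ = ⊥-elim (ℕₚ.<⇒≢ (Finₚ.toℕ<n (suc i))
                    (trans (cong suc (sym (Finₚ.toℕ-inject₁ i))) eq))

next-injective : ∀ {k} {i j : Fin k} → next i ≡ next j → i ≡ j
next-injective {i = i} {j} eq with nextView i | nextView j | cong toℕ eq
... | step p   | step q   | e = Finₚ.toℕ-injective (ℕₚ.suc-injective (trans (sym p) (trans e q)))
... | step p   | wrap _ q | e with () ← trans (sym p) (trans e q)
... | wrap _ p | step q   | e with () ← trans (sym p) (trans e q)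
... | wrap p _ | wrap q _ | e = Finₚ.toℕ-injective (ℕₚ.suc-injective (trans p (sym q)))

prev-next : ∀ {k} (i : Fin k) → prev (next i) ≡ i
prev-next i = next-injective (next-prev (next i))

next≢ : ∀ {k} → 2 ℕ.≤ k → (i : Fin k) → next i ≢ i
next≢ 2≤k i eq with nextView i | cong toℕ eq
... | step p   | e = ℕₚ.1+n≢n (trans (sym p) e)
... | wrap p q | e = ℕₚ.<⇒≢ 2≤k (trans (cong suc (trans (sym q) e)) p)

next²≢ : ∀ {k} → 3 ℕ.≤ k → (i : Fin k) → next (next i) ≢ i
next²≢ {k} 3≤k i eq with nextView i | nextView (next i) | cong toℕ eq
... | step p   | step q   | e = ℕₚ.<⇒≢ (ℕₚ.m≤n⇒m≤1+n (ℕₚ.n<1+n _)) (trans (sym e) (trans q (cong suc p)))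
... | step p   | wrap q r | e = ℕₚ.<⇒≢ 3≤k (trans (cong suc (cong suc (trans (sym r) e))) (trans (cong suc (sym p)) q))
... | wrap p q | step r   | e = ℕₚ.<⇒≢ 3≤k (trans (cong suc (trans (cong suc (sym q)) (trans (sym r) e))) p)
... | wrap p q | wrap r s | e = ℕₚ.<⇒≢ (ℕₚ.≤-trans (s≤s (s≤s z≤n)) 3≤k) (trans (cong suc (trans (sym s) e)) p)

-- Climbing by `next` without wrapping reaches every larger index. So `P` passes from `i` to the
-- last index, wraps to `zero`, and climbs from there to `j`.
next-induction : ∀ {k} (P : Fin k → Set) (i : Fin k) →
  P i → (∀ j → P j → P (next j)) → ∀ j → P j
next-induction {suc k} P i Pi closed j = climb (toℕ j) zero j refl P0
  where
  climb : ∀ d a b → toℕ a ℕ.+ d ≡ toℕ b → P a → P b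
  climb zero    a b eq Pa = subst P (Finₚ.toℕ-injective (trans (sym (ℕₚ.+-identityʳ _)) eq)) Pa
  climb (suc d) a b eq Pa with nextView a
  ... | step p   = climb d (next a) b
                     (trans (cong (ℕ._+ d) p) (trans (sym (ℕₚ.+-suc (toℕ a) d)) eq))
                     (closed a Pa)
  ... | wrap p _ = ⊥-elim (ℕₚ.<⇒≱ (Finₚ.toℕ<n b)
                     (subst (ℕ._≤ toℕ b) p
                       (subst (suc (toℕ a) ℕ.≤_) (trans (sym (ℕₚ.+-suc (toℕ a) d)) eq)
                         (s≤s (ℕₚ.m≤m+n (toℕ a) d)))))
  P0 : P zero
  P0 = subst P (next-prev zero) (closed (fromℕ k)
         (climb (k ℕ.∸ toℕ i) i (fromℕ k)
           (trans (ℕₚ.m+[n∸m]≡n (ℕₚ.≤-pred (Finₚ.toℕ<n i))) (sym (Finₚ.toℕ-fromℕ k))) Pi))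

-- The cyclic order of the circle and its arcs

<⇒≱ : ∀ {x y} → x < y → ¬ y ≤ x
<⇒≱ x<y y≤x = ℚₚ.<-irrefl refl (ℚₚ.<-≤-trans x<y y≤x)

≤∧≢⇒< : ∀ {x y} → x ≤ y → x ≢ y → x < y
≤∧≢⇒< {x} {y} x≤y x≢y with ℚₚ.<-cmp x y
... | tri< x<y _ _ = x<y
... | tri≈ _ x≡y _ = ⊥-elim (x≢y x≡y)
... | tri> _ _ y<x = ⊥-elim (<⇒≱ y<x x≤y)

-- The three rotations of a linear order: going round in the positive direction from `x`, one meets
-- `y` strictly before `z`.
Cyc : ℚ → ℚ → ℚ → Set
Cyc x y z = (x < y × y < z) ⊎ (y < z × z < x) ⊎ (z < x × x < y)

rotate : ∀ {x y z} → Cyc x y z → Cyc y z x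
rotate (inj₁ p)        = inj₂ (inj₂ p)
rotate (inj₂ (inj₁ p)) = inj₁ p
rotate (inj₂ (inj₂ p)) = inj₂ (inj₁ p)

private
  asym₁ : ∀ {x y z} → x < y → y < z → ¬ Cyc x z y
  asym₁ x<y y<z (inj₁ (_ , z<y))        = ℚₚ.<-asym y<z z<y
  asym₁ x<y y<z (inj₂ (inj₁ (z<y , _))) = ℚₚ.<-asym y<z z<y
  asym₁ x<y y<z (inj₂ (inj₂ (y<x , _))) = ℚₚ.<-asym x<y y<x

cyc-asym : ∀ {x y z} → Cyc x y z → ¬ Cyc x z y
cyc-asym (inj₁ (p , q))        c = asym₁ p q c
cyc-asym (inj₂ (inj₁ (p , q))) c = asym₁ p q (rotate (rotate c))
cyc-asym (inj₂ (inj₂ (p , q))) c = asym₁ p q (rotate c)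

cyc-total : ∀ {x y z} → x ≢ y → y ≢ z → x ≢ z → Cyc x y z ⊎ Cyc x z y
cyc-total {x} {y} {z} x≢y y≢z x≢z with ℚₚ.<-cmp x y | ℚₚ.<-cmp y z | ℚₚ.<-cmp x z
... | tri≈ _ e _ | _          | _          = ⊥-elim (x≢y e)
... | _          | tri≈ _ e _ | _          = ⊥-elim (y≢z e)
... | _          | _          | tri≈ _ e _ = ⊥-elim (x≢z e)
... | tri< a _ _ | tri< b _ _ | _          = inj₁ (inj₁ (a , b))
... | tri< a _ _ | tri> _ _ b | tri< c _ _ = inj₂ (inj₁ (c , b))
... | tri< a _ _ | tri> _ _ b | tri> _ _ c = inj₁ (inj₂ (inj₂ (c , a)))
... | tri> _ _ a | tri< b _ _ | tri< c _ _ = inj₂ (inj₂ (inj₂ (a , c)))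
... | tri> _ _ a | tri< b _ _ | tri> _ _ c = inj₁ (inj₂ (inj₁ (b , c)))
... | tri> _ _ a | tri> _ _ b | _          = inj₂ (inj₂ (inj₁ (b , a)))

cyc-irrefl₁₂ : ∀ {x y z} → Cyc x y z → x ≢ y
cyc-irrefl₁₂ (inj₁ (p , q))        refl = ℚₚ.<-irrefl refl p
cyc-irrefl₁₂ (inj₂ (inj₁ (p , q))) refl = ℚₚ.<-asym p q
cyc-irrefl₁₂ (inj₂ (inj₂ (p , q))) refl = ℚₚ.<-irrefl refl q

-- Arc membership relative to any coordinate. For `pos` it unfolds to `⟦_⟧`, so that one set of
-- lemmas serves both `pos` and the coordinates `key c` of the cut circle.
InArc : (Point → ℚ) → Arc → Point → Set
InArc f a x =
    (f (start a) ≤ f (end a) × (f (start a) ≤ f x × f x ≤ f (end a)))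
  ⊎ (f (end a) < f (start a) × (f (start a) ≤ f x ⊎ f x ≤ f (end a)))

module _ (f : Point → ℚ) (a : Arc) where

  inArc? : ∀ x → Dec (InArc f a x)
  inArc? x =
    (f (start a) ℚₚ.≤? f (end a) ×-dec (f (start a) ℚₚ.≤? f x ×-dec f x ℚₚ.≤? f (end a)))
    ⊎-dec
    (f (end a) ℚₚ.<? f (start a) ×-dec (f (start a) ℚₚ.≤? f x ⊎-dec f x ℚₚ.≤? f (end a)))

  -- The complement of a closed arc is the open stretch from its end to its start. Non-membership is
  -- therefore one cyclic triple, which, unlike membership, does not depend on whether the arc
  -- wraps.
  cyc⇒∉ : ∀ x → Cyc (f (end a)) (f x) (f (start a)) → ¬ InArc f a x
  cyc⇒∉ x (inj₁ (t<x , x<s))        (inj₁ (s≤t , _))        = <⇒≱ (ℚₚ.<-trans t<x x<s) s≤t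
  cyc⇒∉ x (inj₁ (t<x , x<s))        (inj₂ (_ , inj₁ s≤x))   = <⇒≱ x<s s≤x
  cyc⇒∉ x (inj₁ (t<x , x<s))        (inj₂ (_ , inj₂ x≤t))   = <⇒≱ t<x x≤t
  cyc⇒∉ x (inj₂ (inj₁ (x<s , s<t))) (inj₁ (_ , s≤x , _))    = <⇒≱ x<s s≤x
  cyc⇒∉ x (inj₂ (inj₁ (x<s , s<t))) (inj₂ (t<s , _))        = ℚₚ.<-asym t<s s<t
  cyc⇒∉ x (inj₂ (inj₂ (s<t , t<x))) (inj₁ (_ , _ , x≤t))    = <⇒≱ t<x x≤t
  cyc⇒∉ x (inj₂ (inj₂ (s<t , t<x))) (inj₂ (t<s , _))        = ℚₚ.<-asym t<s s<t

  ∉⇒cyc : f (start a) ≢ f (end a) → ∀ x → ¬ InArc f a x →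
          Cyc (f (end a)) (f x) (f (start a))
  ∉⇒cyc s≢t x x∉a with ℚₚ.<-cmp (f (start a)) (f (end a))
  ... | tri≈ _ s≡t _ = ⊥-elim (s≢t s≡t)
  ... | tri> _ _ t<s = inj₁ (ℚₚ.≰⇒> (λ x≤t → x∉a (inj₂ (t<s , inj₂ x≤t)))
                           , ℚₚ.≰⇒> (λ s≤x → x∉a (inj₂ (t<s , inj₁ s≤x))))
  ... | tri< s<t _ _ with f (start a) ℚₚ.≤? f x
  ...   | no  s≰x = inj₂ (inj₁ (ℚₚ.≰⇒> s≰x , s<t))
  ...   | yes s≤x = inj₂ (inj₂ (s<t , ℚₚ.≰⇒> (λ x≤t → x∉a (inj₁ (ℚₚ.<⇒≤ s<t , s≤x , x≤t)))))

infix 4 _∈?_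
_∈?_ : ∀ x a → Dec (x ∈ ⟦ a ⟧)
x ∈? a = inArc? pos a x

-- Coordinates after cutting the circle at c: c becomes the least point.
module _ (c : Point) where

  key : Point → ℚ
  key x with pos c ℚₚ.≤? pos x
  ... | yes _ = pos x
  ... | no  _ = pos x ℚ.+ 1ℚ

  data KeyView (x : Point) : Set where
    above : pos c ≤ pos x → key x ≡ pos x → KeyView x
    below : pos x < pos c → key x ≡ pos x ℚ.+ 1ℚ → KeyView x

  keyView : ∀ x → KeyView x
  keyView x with pos c ℚₚ.≤? pos x in eq
  ... | yes c≤x = above c≤x (lem eq)
    where
    lem : ∀ {p} → (pos c ℚₚ.≤? pos x) ≡ yes p → key x ≡ pos x
    lem eq rewrite eq = refl
  ... | no  c≰x = below (ℚₚ.≰⇒> c≰x) (lem eq)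
    where
    lem : ∀ {p} → (pos c ℚₚ.≤? pos x) ≡ no p → key x ≡ pos x ℚ.+ 1ℚ
    lem eq rewrite eq = refl

  1≤+1 : ∀ x → 1ℚ ≤ pos x ℚ.+ 1ℚ
  1≤+1 x = subst (_≤ pos x ℚ.+ 1ℚ) (ℚₚ.+-identityˡ 1ℚ) (ℚₚ.+-monoˡ-≤ 1ℚ (0≤pos x))

  above<below : ∀ x y → pos x < pos y ℚ.+ 1ℚ
  above<below x y = ℚₚ.<-≤-trans (pos<1 x) (1≤+1 y)

  key-cong : ∀ {x y} → pos x ≡ pos y → key x ≡ key y
  key-cong {x} {y} eq with keyView x | keyView y
  ... | above _ p   | above _ q   = trans p (trans eq (sym q))
  ... | above c≤x _ | below y<c _ = ⊥-elim (<⇒≱ y<c (subst (pos c ≤_) eq c≤x))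
  ... | below x<c _ | above c≤y _ = ⊥-elim (<⇒≱ x<c (subst (pos c ≤_) (sym eq) c≤y))
  ... | below _ p   | below _ q   = trans p (trans (cong (ℚ._+ 1ℚ) eq) (sym q))

  key-injective : ∀ {x y} → key x ≡ key y → pos x ≡ pos y
  key-injective {x} {y} eq with keyView x | keyView y
  ... | above _ p | above _ q = trans (sym p) (trans eq q)
  ... | above _ p | below _ q = ⊥-elim (ℚₚ.<-irrefl (trans (sym p) (trans eq q)) (above<below x y))
  ... | below _ p | above _ q = ⊥-elim (ℚₚ.<-irrefl (sym (trans (sym p) (trans eq q))) (above<below y x))
  ... | below _ p | below _ q = ℚₚ.≤-antisym (le p q eq) (le q p (sym eq))
    where
    le : ∀ {x y} → key x ≡ pos x ℚ.+ 1ℚ → key y ≡ pos y ℚ.+ 1ℚ → key x ≡ key y → pos x ≤ pos y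
    le {x} {y} p q eq = ℚₚ.≮⇒≥ λ y<x → ℚₚ.<-irrefl (trans (sym q) (trans (sym eq) p)) (ℚₚ.+-monoˡ-< 1ℚ y<x)

  key-min : ∀ x → key c ≤ key x
  key-min x with keyView c | keyView x
  ... | below c<c _ | _           = ⊥-elim (ℚₚ.<-irrefl refl c<c)
  ... | above _ p   | above c≤x q = subst₂ _≤_ (sym p) (sym q) c≤x
  ... | above _ p   | below _ q   = subst₂ _≤_ (sym p) (sym q) (ℚₚ.<⇒≤ (above<below c x))

  private
    cyc-key₁ : ∀ {x y z} → pos x < pos y → pos y < pos z → Cyc (key x) (key y) (key z)
    cyc-key₁ {x} {y} {z} x<y y<z with keyView x | keyView y | keyView z
    ... | above _ p | above _ q | above _ r =
      inj₁ (subst₂ _<_ (sym p) (sym q) x<y , subst₂ _<_ (sym q) (sym r) y<z)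
    ... | below _ p | above _ q | above _ r =
      inj₂ (inj₁ (subst₂ _<_ (sym q) (sym r) y<z , subst₂ _<_ (sym r) (sym p) (above<below z x)))
    ... | below _ p | below _ q | above _ r =
      inj₂ (inj₂ (subst₂ _<_ (sym r) (sym p) (above<below z x)
                 , subst₂ _<_ (sym p) (sym q) (ℚₚ.+-monoˡ-< 1ℚ x<y)))
    ... | below _ p | below _ q | below _ r =
      inj₁ (subst₂ _<_ (sym p) (sym q) (ℚₚ.+-monoˡ-< 1ℚ x<y)
           , subst₂ _<_ (sym q) (sym r) (ℚₚ.+-monoˡ-< 1ℚ y<z))
    ... | above c≤x _ | below y<c _ | _       = ⊥-elim (<⇒≱ (ℚₚ.<-trans x<y y<c) c≤x)
    ... | _ | above c≤y _ | below z<c _       = ⊥-elim (<⇒≱ (ℚₚ.<-trans y<z z<c) c≤y)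

  -- Adding a full turn to the points below the cut only rotates the linear order.
  cyc-key : ∀ x y z → Cyc (pos x) (pos y) (pos z) → Cyc (key x) (key y) (key z)
  cyc-key x y z (inj₁ (p , q))        = cyc-key₁ p q
  cyc-key x y z (inj₂ (inj₁ (p , q))) = rotate (rotate (cyc-key₁ p q))
  cyc-key x y z (inj₂ (inj₂ (p , q))) = rotate (cyc-key₁ p q)

  key-cyc : ∀ x y z → Cyc (key x) (key y) (key z) → Cyc (pos x) (pos y) (pos z)
  key-cyc x y z cyc
    with cyc-total (λ e → cyc-irrefl₁₂ cyc (key-cong e))
                   (λ e → cyc-irrefl₁₂ (rotate cyc) (key-cong e))
                   (λ e → cyc-irrefl₁₂ (rotate (rotate cyc)) (key-cong (sym e)))
  ... | inj₁ p = p
  ... | inj₂ p = ⊥-elim (cyc-asym cyc (cyc-key x z y p))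

  ∈⇒inArc : ∀ a {x} → x ∈ ⟦ a ⟧ → InArc key a x
  ∈⇒inArc a {x} x∈a with inArc? key a x
  ... | yes p = p
  ... | no  p = ⊥-elim (cyc⇒∉ pos a x
          (key-cyc (end a) x (start a) (∉⇒cyc key a (λ e → start≢end a (key-injective e)) x p)) x∈a)

  inArc⇒∈ : ∀ a {x} → InArc key a x → x ∈ ⟦ a ⟧
  inArc⇒∈ a {x} p with x ∈? a
  ... | yes x∈a = x∈a
  ... | no  x∉a = ⊥-elim (cyc⇒∉ key a x (cyc-key (end a) x (start a) (∉⇒cyc pos a (start≢end a) x x∉a)) p)

  ∌⇒start<end : ∀ a → c ∉ ⟦ a ⟧ → key (start a) < key (end a)
  ∌⇒start<end a c∉a with ℚₚ.<-cmp (key (start a)) (key (end a))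
  ... | tri< s<t _ _ = s<t
  ... | tri≈ _ s≡t _ = ⊥-elim (start≢end a (key-injective s≡t))
  ... | tri> _ _ t<s = ⊥-elim (c∉a (inArc⇒∈ a (inj₂ (t<s , inj₂ (key-min (end a))))))

  -- The complement of an arc through the cut point does not pass the cut, so it is an interval of
  -- the cut coordinates.
  coconvex : ∀ a {x y z} → c ∈ ⟦ a ⟧ → key x ≤ key y → key y ≤ key z →
             x ∉ ⟦ a ⟧ → z ∉ ⟦ a ⟧ → y ∉ ⟦ a ⟧
  coconvex a {x} {y} {z} c∈a x≤y y≤z x∉a z∉a y∈a with ∈⇒inArc a y∈a | ∈⇒inArc a c∈a
  ... | inj₂ (t<s , inj₁ s≤y) | _ = z∉a (inArc⇒∈ a (inj₂ (t<s , inj₁ (ℚₚ.≤-trans s≤y y≤z))))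
  ... | inj₂ (t<s , inj₂ y≤t) | _ = x∉a (inArc⇒∈ a (inj₂ (t<s , inj₂ (ℚₚ.≤-trans x≤y y≤t))))
  ... | inj₁ (s≤t , s≤y , y≤t) | inj₁ (_ , s≤c , _) =
        x∉a (inArc⇒∈ a (inj₁ (s≤t , ℚₚ.≤-trans s≤c (key-min x) , ℚₚ.≤-trans x≤y y≤t)))
  ... | inj₁ (s≤t , _) | inj₂ (t<s , _) = <⇒≱ t<s s≤t

  -- The coordinates range over one turn from `pos c`. Values from 1 on belong to points below the
  -- cut, hence the subtraction of 1.
  pointAt : ∀ {x y r} → key x < r → r < key y → Σ Point λ p → key p ≡ r
  pointAt {x} {y} {r} x<r r<y = go (r ℚₚ.<? 1ℚ)
    where
    c<r : pos c < r
    c<r with keyView c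
    ... | above _ e   = subst (_< r) e (ℚₚ.≤-<-trans (key-min x) x<r)
    ... | below c<c _ = ⊥-elim (ℚₚ.<-irrefl refl c<c)
    r<c+1 : r < pos c ℚ.+ 1ℚ
    r<c+1 with keyView y
    ... | above _ e   = ℚₚ.<-trans (subst (r <_) e r<y) (above<below y c)
    ... | below y<c e = ℚₚ.<-trans (subst (r <_) e r<y) (ℚₚ.+-monoˡ-< 1ℚ y<c)
    r-1 : ℚ
    r-1 = r ℚ.+ (ℚ.- 1ℚ)
    r-1+1 : r-1 ℚ.+ 1ℚ ≡ r
    r-1+1 = trans (ℚₚ.+-assoc r (ℚ.- 1ℚ) 1ℚ) (ℚₚ.+-identityʳ r)
    r-1<c : r-1 < pos c
    r-1<c = subst (r-1 <_) (trans (ℚₚ.+-assoc (pos c) 1ℚ (ℚ.- 1ℚ)) (ℚₚ.+-identityʳ (pos c)))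
              (ℚₚ.+-monoˡ-< (ℚ.- 1ℚ) r<c+1)
    go : Dec (r < 1ℚ) → Σ Point λ p → key p ≡ r
    go (yes r<1) = p , eq
      where
      p : Point
      p = record { pos = r ; 0≤pos = ℚₚ.≤-trans (0≤pos c) (ℚₚ.<⇒≤ c<r) ; pos<1 = r<1 }
      eq : key p ≡ r
      eq with keyView p
      ... | above _ e   = e
      ... | below r<c _ = ⊥-elim (ℚₚ.<-asym r<c c<r)
    go (no r≮1) = p , eq
      where
      p : Point
      p = record { pos = r-1
                 ; 0≤pos = ℚₚ.+-monoˡ-≤ (ℚ.- 1ℚ) (ℚₚ.≮⇒≥ r≮1)
                 ; pos<1 = ℚₚ.<-trans r-1<c (pos<1 c) }
      eq : key p ≡ r
      eq with keyView p
      ... | above c≤p _ = ⊥-elim (<⇒≱ r-1<c c≤p)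
      ... | below _ e   = trans e r-1+1

start∈ : ∀ a → start a ∈ ⟦ a ⟧
start∈ a with pos (start a) ℚₚ.≤? pos (end a)
... | yes s≤t = inj₁ (s≤t , ℚₚ.≤-refl , s≤t)
... | no  s≰t = inj₂ (ℚₚ.≰⇒> s≰t , inj₁ ℚₚ.≤-refl)

end∈ : ∀ a → end a ∈ ⟦ a ⟧
end∈ a with pos (start a) ℚₚ.≤? pos (end a)
... | yes s≤t = inj₁ (s≤t , s≤t , ℚₚ.≤-refl)
... | no  s≰t = inj₂ (ℚₚ.≰⇒> s≰t , inj₂ ℚₚ.≤-refl)

∈-resp-pos : ∀ a {x y} → pos x ≡ pos y → x ∈ ⟦ a ⟧ → y ∈ ⟦ a ⟧
∈-resp-pos a {x} {y} eq x∈a with y ∈? a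
... | yes y∈a = y∈a
... | no  y∉a = ⊥-elim (cyc⇒∉ pos a x (subst (λ z → Cyc _ z _) (sym eq) (∉⇒cyc pos a (start≢end a) y y∉a)) x∈a)

-- Cut at a common point. An arc that does not wrap there starts at the cut; if both wrap, the later
-- of the two starts lies on the other arc.
meets⇒start : ∀ a b → ⟦ a ⟧ ≬ ⟦ b ⟧ → start a ∈ ⟦ b ⟧ ⊎ start b ∈ ⟦ a ⟧
meets⇒start a b (c , c∈a , c∈b) with ∈⇒inArc c a c∈a | ∈⇒inArc c b c∈b
... | inj₁ (_ , s≤c , _) | _ = inj₁ (∈-resp-pos b {c} {start a} (key-injective c {c} {start a} (ℚₚ.≤-antisym (key-min c (start a)) s≤c)) c∈b)
... | inj₂ _ | inj₁ (_ , s≤c , _) = inj₂ (∈-resp-pos a {c} {start b} (key-injective c {c} {start b} (ℚₚ.≤-antisym (key-min c (start b)) s≤c)) c∈a)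
... | inj₂ (p , _) | inj₂ (q , _) with ℚₚ.≤-total (key c (start a)) (key c (start b))
...   | inj₁ a≤b = inj₂ (inArc⇒∈ c a (inj₂ (p , inj₁ a≤b)))
...   | inj₂ b≤a = inj₁ (inArc⇒∈ c b (inj₂ (q , inj₁ b≤a)))

-- Cut at `w`, off the arc: the arc becomes an interval in which `p` precedes `q`, and the second
-- hypothesis puts `x` in the closed stretch from `p` to `q`.
convex : ∀ a {p q w x} → Cyc (pos p) (pos q) (pos w) → ¬ Cyc (pos p) (pos q) (pos x) →
         w ∉ ⟦ a ⟧ → p ∈ ⟦ a ⟧ → q ∈ ⟦ a ⟧ → x ∈ ⟦ a ⟧
convex a {p} {q} {w} {x} pqw ¬pqx w∉a p∈a q∈a
  with ∌⇒start<end w a w∉a | ∈⇒inArc w a p∈a | ∈⇒inArc w a q∈a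
... | s<t | inj₂ (t<s , _) | _ = ⊥-elim (ℚₚ.<-asym s<t t<s)
... | s<t | _ | inj₂ (t<s , _) = ⊥-elim (ℚₚ.<-asym s<t t<s)
... | s<t | inj₁ (_ , s≤p , p≤t) | inj₁ (_ , s≤q , q≤t) =
  inArc⇒∈ w a (inj₁ (ℚₚ.<⇒≤ s<t , ℚₚ.≤-trans s≤p p≤x , ℚₚ.≤-trans x≤q q≤t))
  where
  p<q : key w p < key w q
  p<q with cyc-key w p q w pqw
  ... | inj₁ (_ , q<w)        = ⊥-elim (<⇒≱ q<w (key-min w q))
  ... | inj₂ (inj₁ (q<w , _)) = ⊥-elim (<⇒≱ q<w (key-min w q))
  ... | inj₂ (inj₂ (_ , lt))  = lt
  p≤x : key w p ≤ key w x
  p≤x = ℚₚ.≮⇒≥ λ x<p → ¬pqx (key-cyc w p q x (inj₂ (inj₂ (x<p , p<q))))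
  x≤q : key w x ≤ key w q
  x≤q = ℚₚ.≮⇒≥ λ q<x → ¬pqx (key-cyc w p q x (inj₁ (p<q , q<x)))

-- Graphs with an obstacle enumeration are not Helly circular-arc graphs

module _ {m} {P : Pred (Fin m) 0ℓ} (P? : Decidable P) where

  subset : Subset m
  subset = tabulate (λ x → does (P? x))

  ∈-subset⁺ : ∀ {x} → P x → x Subset.∈ subset
  ∈-subset⁺ {x} Px = Vecₚ.lookup⇒[]= x subset
    (trans (Vecₚ.lookup∘tabulate (λ y → does (P? y)) x) (dec-true (P? x) Px))

  ∈-subset⁻ : ∀ {x} → x Subset.∈ subset → P x
  ∈-subset⁻ {x} x∈ with P? x | trans (sym (Vecₚ.lookup∘tabulate (λ y → does (P? y)) x)) (Vecₚ.[]=⇒lookup x∈)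
  ... | yes Px | _ = Px
  ... | no  _  | ()

  helly-common : ∀ arcs → Helly arcs → ∃ P →
    (∀ {x y} → P x → P y → ⟦ arcs x ⟧ ≬ ⟦ arcs y ⟧) →
    ∃[ c ] (∀ {x} → P x → c ∈ ⟦ arcs x ⟧)
  helly-common arcs helly (x , Px) meets with helly subset (x , ∈-subset⁺ Px)
    (λ a b → meets (∈-subset⁻ a) (∈-subset⁻ b))
  ... | c , h = c , λ Px → h (∈-subset⁺ Px)

argmin : ∀ {k} (g : Fin (suc k) → ℚ) → ∃[ i ] (∀ j → g i ≤ g j)
argmin {zero} g = zero , λ { zero → ℚₚ.≤-refl }
argmin {suc k} g with argmin (λ i → g (suc i))
... | i , min with ℚₚ.≤-total (g zero) (g (suc i))
...   | inj₁ 0≤i = zero , λ { zero → ℚₚ.≤-refl ; (suc j) → ℚₚ.≤-trans 0≤i (min j) }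
...   | inj₂ i≤0 = suc i , λ { zero → i≤0 ; (suc j) → min j }

module Obstacle {n} {G : Graph n} (𝒬 : ObstacleEnumerationIn G) where
  open ObstacleEnumerationIn 𝒬 public

  2≤k : 2 ℕ.≤ k
  2≤k = ℕₚ.<⇒≤ 3≤k

  v-injective : ∀ {i j} → v i ≡ v j → i ≡ j
  v-injective = Injection.injective enum

  Miss : Fin n → Fin k → Set
  Miss x j = NonNeighbours G x (v j)

  miss? : ∀ x j → Dec (Miss x j)
  miss? x j = ¬? (v j Finₚ.≟ x) ×-dec ¬? (adj? G x (v j))

  ¬miss⇒adj : ∀ {x j} → v j ≢ x → ¬ Miss x j → Adj G x (v j)
  ¬miss⇒adj {x} {j} v≢x ¬miss with adj? G x (v j)
  ... | yes a = a
  ... | no ¬a = ⊥-elim (¬miss (v≢x , ¬a))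

  Only : Fin n → Fin k → Set
  Only x i = (∀ {j} → Miss x j → j ≡ i) × Miss x i

  Pair : Fin n → Fin k → Set
  Pair x i = (∀ {j} → Miss x j → j ≡ i ⊎ j ≡ next i) × Miss x i × Miss x (next i)

  -- Forgets the proofs in a witness enumeration, so that enumerations can be compared by plain
  -- equality. From here on `W` is inspected through `kind`.
  shape : ∀ {a b} → Witnesses G Q a b → Fin n ⊎ (Fin n × Fin n)
  shape (𝒪₁ w _)       = inj₁ w
  shape (𝒪₂ u z _ _ _) = inj₂ (u , z)

  kind : Fin k → Fin n ⊎ (Fin n × Fin n)
  kind i = shape (W i)

  data At (i : Fin k) (x : Fin n) : Set where
    isW : kind i ≡ inj₁ x → At i x
    isU : ∀ {z} → kind i ≡ inj₂ (x , z) → At i x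
    isZ : ∀ {u} → kind i ≡ inj₂ (u , x) → At i x

  inj₁≢inj₂ : ∀ {s : Fin n ⊎ (Fin n × Fin n)} {a b} → s ≡ inj₁ a → s ≢ inj₂ b
  inj₁≢inj₂ refl ()

  same₁ : ∀ {s} {a b : Fin n} → s ≡ inj₁ {B = Fin n × Fin n} a → s ≡ inj₁ b → a ≡ b
  same₁ refl refl = refl

  sameᵘ : ∀ {s} {a b c d : Fin n} → s ≡ inj₂ {A = Fin n} (a , b) → s ≡ inj₂ (c , d) → a ≡ c
  sameᵘ refl refl = refl

  sameᶻ : ∀ {s} {a b c d : Fin n} → s ≡ inj₂ {A = Fin n} (a , b) → s ≡ inj₂ (c , d) → b ≡ d
  sameᶻ refl refl = refl

  private
    shape₁ : ∀ {i i′ w} (V : Witnesses G Q (v i) (v i′)) → shape V ≡ inj₁ w →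
      (∀ {j} → Miss w j → j ≡ i ⊎ j ≡ i′) × Miss w i × Miss w i′
    shape₁ (𝒪₁ w (⇒ , ⇐)) refl =
        (λ miss → [ (λ e → inj₁ (sym (v-injective e))) , (λ e → inj₂ (sym (v-injective e))) ]′ (⇒ (miss , _ , refl)))
      , proj₁ (⇐ (inj₁ refl)) , proj₁ (⇐ (inj₂ refl))

    shape₂ : ∀ {i i′ u z} (V : Witnesses G Q (v i) (v i′)) → shape V ≡ inj₂ (u , z) →
      Only u i × Only z i′ × Adj G u z
    shape₂ (𝒪₂ u z (⇒ , ⇐) (⇒′ , ⇐′) uz) refl =
        ((λ miss → sym (v-injective (⇒ (miss , _ , refl)))) , proj₁ (⇐ refl))
      , ((λ miss → sym (v-injective (⇒′ (miss , _ , refl)))) , proj₁ (⇐′ refl))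
      , uz

    members-view : ∀ {a b x} (V : Witnesses G Q a b) → x ∈ members V →
      shape V ≡ inj₁ x ⊎ (∃[ z ] shape V ≡ inj₂ (x , z)) ⊎ (∃[ u ] shape V ≡ inj₂ (u , x))
    members-view (𝒪₁ w _)       refl        = inj₁ refl
    members-view (𝒪₂ u z _ _ _) (inj₁ refl) = inj₂ (inj₁ (z , refl))
    members-view (𝒪₂ u z _ _ _) (inj₂ refl) = inj₂ (inj₂ (u , refl))

    shape-members : ∀ {a b} (V : Witnesses G Q a b) →
      (∀ {x} → shape V ≡ inj₁ x → x ∈ members V) ×
      (∀ {u z} → shape V ≡ inj₂ (u , z) → u ∈ members V × z ∈ members V)
    shape-members (𝒪₁ w _)       = (λ { refl → refl }) , (λ ())
    shape-members (𝒪₂ u z _ _ _) = (λ ()) , (λ { refl → inj₁ refl , inj₂ refl })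

  kind₁ : ∀ {i w} → kind i ≡ inj₁ w → Pair w i
  kind₁ {i} = shape₁ (W i)

  kind₂ : ∀ {i u z} → kind i ≡ inj₂ (u , z) → Only u i × Only z (next i) × Adj G u z
  kind₂ {i} = shape₂ (W i)

  members⇒at : ∀ {i x} → x ∈ members (W i) → At i x
  members⇒at {i} x∈ with members-view (W i) x∈
  ... | inj₁ eq              = isW eq
  ... | inj₂ (inj₁ (_ , eq)) = isU eq
  ... | inj₂ (inj₂ (_ , eq)) = isZ eq

  at⇒members : ∀ {i x} → At i x → x ∈ members (W i)
  at⇒members {i} (isW eq) = proj₁ (shape-members (W i)) eq
  at⇒members {i} (isU eq) = proj₁ (proj₂ (shape-members (W i)) eq)
  at⇒members {i} (isZ eq) = proj₂ (proj₂ (shape-members (W i)) eq)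

  at? : ∀ i x → Dec (At i x)
  at? i x = go (kind i) refl
    where
    go : ∀ s → kind i ≡ s → Dec (At i x)
    go (inj₁ w) eq with w Finₚ.≟ x
    ... | yes refl = yes (isW eq)
    ... | no w≢x   = no λ { (isW e) → w≢x (same₁ eq e)
                          ; (isU e) → inj₁≢inj₂ eq e
                          ; (isZ e) → inj₁≢inj₂ eq e }
    go (inj₂ (u , z)) eq with u Finₚ.≟ x | z Finₚ.≟ x
    ... | yes refl | _        = yes (isU eq)
    ... | no _     | yes refl = yes (isZ eq)
    ... | no u≢x   | no z≢x   = no λ { (isW e) → inj₁≢inj₂ e eq
                                     ; (isU e) → u≢x (sameᵘ eq e)
                                     ; (isZ e) → z≢x (sameᶻ eq e) }

  only-unique : ∀ {x i j} → Only x i → Only x j → i ≡ j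
  only-unique (_ , p) (only , _) = only p

  only-not-pair : ∀ {x i j} → Only x i → ¬ Pair x j
  only-not-pair (only , _) (_ , p , q) = next≢ 2≤k _ (trans (only q) (sym (only p)))

  -- The crossed case would make `next (next j)` equal to `j`, which three or more indices exclude.
  pair-⊆ : ∀ {i j} → (i ≡ j ⊎ i ≡ next j) → (next i ≡ j ⊎ next i ≡ next j) → i ≡ j
  pair-⊆ (inj₁ e) _         = e
  pair-⊆ (inj₂ e) (inj₂ e′) = next-injective e′
  pair-⊆ (inj₂ e) (inj₁ e′) = ⊥-elim (next²≢ 3≤k _ (trans (cong next (sym e)) e′))

  pair-unique : ∀ {x i j} → Pair x i → Pair x j → i ≡ j
  pair-unique (_ , p , q) (sub , _) = pair-⊆ (sub p) (sub q)

  at-misses : ∀ {i x} → At i x → (∀ {j} → Miss x j → j ≡ i ⊎ j ≡ next i) × ∃ (Miss x)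
  at-misses (isW eq) with kind₁ eq
  ... | only , miss , _ = only , _ , miss
  at-misses (isU eq) with kind₂ eq
  ... | (only , miss) , _ = (λ p → inj₁ (only p)) , _ , miss
  at-misses (isZ eq) with kind₂ eq
  ... | _ , (only , miss) , _ = (λ p → inj₂ (only p)) , _ , miss

  miss⇒∉Q : ∀ {x i} → Miss x i → x ∉ Q
  miss⇒∉Q (v≢x , ¬adj) x∈Q = ¬adj (clique x∈Q (_ , refl) (λ e → v≢x (sym e)))

  at⇒∉Q : ∀ {i x} → At i x → x ∉ Q
  at⇒∉Q at = miss⇒∉Q (proj₂ (proj₂ (at-misses at)))

  at-adj : ∀ {i j x} → At i x → j ≢ i → j ≢ next i → Adj G x (v j)
  at-adj at j≢i j≢i′ = ¬miss⇒adj (λ e → at⇒∉Q at (_ , e))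
    (λ miss → [ j≢i , j≢i′ ]′ (proj₁ (at-misses at) miss))

  at-at-adj : ∀ {i x y} → At i x → At i y → x ≢ y → Adj G x y
  at-at-adj (isW p) (isW q) x≢y with refl ← trans (sym p) q = ⊥-elim (x≢y refl)
  at-at-adj (isW p) (isU q) x≢y with () ← trans (sym p) q
  at-at-adj (isW p) (isZ q) x≢y with () ← trans (sym p) q
  at-at-adj (isU p) (isW q) x≢y with () ← trans (sym p) q
  at-at-adj (isU p) (isU q) x≢y with refl ← trans (sym p) q = ⊥-elim (x≢y refl)
  at-at-adj (isU p) (isZ q) x≢y with refl ← trans (sym p) q = proj₂ (proj₂ (kind₂ p))
  at-at-adj (isZ p) (isW q) x≢y with () ← trans (sym p) q
  at-at-adj (isZ p) (isU q) x≢y with refl ← trans (sym p) q = symm G (proj₂ (proj₂ (kind₂ p)))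
  at-at-adj (isZ p) (isZ q) x≢y with refl ← trans (sym p) q = ⊥-elim (x≢y refl)

  at-missing : ∀ i → (∃[ x ] At i x × Miss x i) × (∃[ x ] At i x × Miss x (next i))
  at-missing i = go (kind i) refl
    where
    go : ∀ s → kind i ≡ s → (∃[ x ] At i x × Miss x i) × (∃[ x ] At i x × Miss x (next i))
    go (inj₁ w)       eq = let _ , p , q = kind₁ eq in (w , isW eq , p) , (w , isW eq , q)
    go (inj₂ (u , z)) eq = let (_ , p) , (_ , q) , _ = kind₂ eq in (u , isU eq , p) , (z , isZ eq , q)

  distinct⇒adj : ∀ {i j} → i ≢ j → Adj G (v i) (v j)
  distinct⇒adj i≢j = clique (_ , refl) (_ , refl) (λ e → i≢j (v-injective e))

  -- For each i the witnesses of vᵢvᵢ₊₁ together with Q ∖ {vᵢ, vᵢ₊₁} form a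
  -- clique; its common point qᵢ lies in the arcs of all of Q except vᵢ and vᵢ₊₁.
  -- Cutting the circle at a common point of Q, the arc of a vertex omits the
  -- stretch between its two q's but no other q, which fails around the least q.
  not-helly : ∀ {m} (f : Fin m ↣ Fin n) →
    (∀ x → x ∈ Q ⊎ x ∈ Witness → ∃[ y ] Injection.to f y ≡ x) →
    ¬ HellyCircularArc (induced G f)
  not-helly {m} f covers (M , helly) = contradiction
    where
    open Injection f using (to)
    arc′ = arc M

    e : Fin k → Fin m
    e i = proj₁ (covers (v i) (inj₁ (i , refl)))
    to-e : ∀ i → to (e i) ≡ v i
    to-e i = proj₂ (covers (v i) (inj₁ (i , refl)))

    at : ∀ {i x} → At i x → ∃[ y ] to y ≡ x
    at {i} p = covers _ (inj₂ (i , at⇒members p))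

    meets : ∀ x y → (to x ≢ to y → Adj G (to x) (to y)) → ⟦ arc′ x ⟧ ≬ ⟦ arc′ y ⟧
    meets x y adj with x Finₚ.≟ y
    ... | yes refl = start (arc′ x) , start∈ (arc′ x) , start∈ (arc′ x)
    ... | no x≢y   = Equivalence.to (adj⇔meets M x≢y) (adj (λ eq → x≢y (Injection.injective f eq)))

    disjoint : ∀ x y p → to x ≢ to y → ¬ Adj G (to x) (to y) → p ∈ ⟦ arc′ x ⟧ → p ∉ ⟦ arc′ y ⟧
    disjoint x y p tx≢ty ¬adj p∈x p∈y =
      ¬adj (Equivalence.from (adj⇔meets M (λ { refl → tx≢ty refl })) (p , p∈x , p∈y))

    InQ : Pred (Fin m) 0ℓ
    InQ x = ∃[ j ] v j ≡ to x

    Other : Fin k → Pred (Fin m) 0ℓ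
    Other i x = At i (to x) ⊎ (∃[ j ] (j ≢ i × j ≢ next i × v j ≡ to x))

    InQ? : Decidable InQ
    InQ? x = Finₚ.any? λ j → v j Finₚ.≟ to x

    Other? : ∀ i → Decidable (Other i)
    Other? i x = at? i (to x) ⊎-dec
      Finₚ.any? λ j → ¬? (j Finₚ.≟ i) ×-dec (¬? (j Finₚ.≟ next i) ×-dec (v j Finₚ.≟ to x))

    0′ : Fin k
    0′ = Fin.fromℕ< 2≤k

    common : ∃[ c ] (∀ {x} → InQ x → c ∈ ⟦ arc′ x ⟧)
    common = helly-common InQ? arc′ helly (e 0′ , 0′ , sym (to-e 0′))
      λ {x} {y} p q → meets x y λ ne → clique p q ne

    q-common : ∀ i → ∃[ c ] (∀ {x} → Other i x → c ∈ ⟦ arc′ x ⟧)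
    q-common i with at-missing i
    ... | (x , at-x , _) , _ with at at-x
    ... | y , refl = helly-common (Other? i) arc′ helly (y , inj₁ at-x) λ {x} {y} p q → meets x y (adj p q)
      where
      adj : ∀ {x y} → Other i x → Other i y → to x ≢ to y → Adj G (to x) (to y)
      adj (inj₁ p) (inj₁ q) ne = at-at-adj p q ne
      adj (inj₁ p) (inj₂ (j , a , b , eq)) ne = subst (Adj G _) eq (at-adj p a b)
      adj (inj₂ (j , a , b , eq)) (inj₁ p) ne = symm G (subst (Adj G _) eq (at-adj p a b))
      adj (inj₂ (_ , _ , _ , p)) (inj₂ (_ , _ , _ , q)) ne = clique (_ , p) (_ , q) ne

    c : Point
    c = proj₁ common
    c∈ : ∀ i → c ∈ ⟦ arc′ (e i) ⟧
    c∈ i = proj₂ common (i , sym (to-e i))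

    q : Fin k → Point
    q i = proj₁ (q-common i)

    q∈ : ∀ {i j} → j ≢ i → j ≢ next i → q i ∈ ⟦ arc′ (e j) ⟧
    q∈ {i} {j} a b = proj₂ (q-common i) (inj₂ (j , a , b , sym (to-e j)))

    q∉-missing : ∀ {i j x} → At i x → Miss x j → q i ∉ ⟦ arc′ (e j) ⟧
    q∉-missing {i} {j} at-x (v≢x , ¬adj) with at at-x
    ... | y , refl = disjoint y (e j) (q i) (λ eq → v≢x (trans (sym (to-e j)) (sym eq)))
                       (λ a → ¬adj (subst (Adj G (to y)) (to-e j) a))
                       (proj₂ (q-common i) (inj₁ at-x))

    q∉₁ : ∀ i → q i ∉ ⟦ arc′ (e i) ⟧
    q∉₁ i = let _ , p , miss = proj₁ (at-missing i) in q∉-missing p miss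
    q∉₂ : ∀ i → q i ∉ ⟦ arc′ (e (next i)) ⟧
    q∉₂ i = let _ , p , miss = proj₂ (at-missing i) in q∉-missing p miss

    κ : Fin k → ℚ
    κ i = key c (q i)

    least : ∃[ i ] (∀ j → κ i ≤ κ j)
    least = go k κ 0′
      where
      go : ∀ k (g : Fin k → ℚ) → Fin k → ∃[ i ] (∀ j → g i ≤ g j)
      go (suc k) g _ = argmin g

    contradiction : ⊥
    contradiction with least
    -- The nearer of `q (prev i)` and `q (next i)` lies between `q i` and the farther one. The
    -- vertex at `next i` (nearer: `q (prev i)`) or at `i` (nearer: `q (next i)`) has an arc
    -- omitting the outer two of these points but containing the middle one.
    ... | i , min with ℚₚ.≤-total (κ (prev i)) (κ (next i))
    ...   | inj₁ l≤r = coconvex c (arc′ (e (next i))) (c∈ (next i)) (min (prev i)) l≤r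
              (q∉₂ i) (q∉₁ (next i))
              (q∈ (λ eq → next²≢ 3≤k (prev i) (trans (cong next (next-prev i)) eq))
                  (λ eq → next≢ 2≤k i (trans eq (next-prev i))))
    ...   | inj₂ r≤l = coconvex c (arc′ (e i)) (c∈ i) (min (next i)) r≤l
              (q∉₁ i) (subst (λ j → q (prev i) ∉ ⟦ arc′ (e j) ⟧) (next-prev i) (q∉₂ (prev i)))
              (q∈ (λ eq → next≢ 2≤k i (sym eq)) (λ eq → next²≢ 3≤k i (sym eq)))

-- From a circular-arc model to a Helly model or an obstacle

AllPairs-lookup : ∀ {A : Set} {R : Rel A 0ℓ} {xs : List A} → AllPairs R xs →
  ∀ i j → toℕ i ℕ.< toℕ j → R (lookup xs i) (lookup xs j)
AllPairs-lookup (x∼xs ∷ _)  zero    (suc j) _         = All.lookup x∼xs (∈ₚ.∈-lookup j)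
AllPairs-lookup (_ ∷ pairs) (suc i) (suc j) (s≤s i<j) = AllPairs-lookup pairs i j i<j

module _ {n} {P : Pred (Fin n) 0ℓ} (P? : Decidable P) (g : Fin n → ℚ)
         (g-inj : ∀ {x y} → P x → P y → g x ≡ g y → x ≡ y) where

  enumerate-increasing : ∃[ k ] Σ (Fin k → Fin n) λ e →
    (∀ i → P (e i)) × (∀ {x} → P x → ∃[ i ] e i ≡ x) ×
    (∀ {i j} → toℕ i ℕ.< toℕ j → g (e i) < g (e j))
  enumerate-increasing = length ys , lookup ys , P-lookup , index , increasing
    where
    O : DecTotalOrder 0ℓ 0ℓ 0ℓ
    O = On.decTotalOrder ℚₚ.≤-decTotalOrder g
    open Sort O
    xs ys : List (Fin n)
    xs = filter P? (allFin n)
    ys = sort xs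
    P-lookup : ∀ i → P (lookup ys i)
    P-lookup i = proj₂ (∈ₚ.∈-filter⁻ P? {xs = allFin n} (∈-resp-↭ (sort-↭ xs) (∈ₚ.∈-lookup i)))
    index : ∀ {x} → P x → ∃[ i ] lookup ys i ≡ x
    index {x} Px = Any.index x∈ys , sym (Anyₚ.lookup-index x∈ys)
      where
      x∈ys : x List.∈ ys
      x∈ys = ∈-resp-↭ (↭-sym (sort-↭ xs)) (∈ₚ.∈-filter⁺ P? (∈ₚ.∈-allFin x) Px)
    unique : AllPairs _≢_ ys
    unique = ↭ₛ.AllPairs-resp-↭ (setoid (Fin n)) ≢-sym
      ((λ { refl ne → ne }) , (λ { refl ne → ne }))
      (↭⇒↭ₛ (↭-sym (sort-↭ xs))) (Unique.filter⁺ P? (Unique.allFin⁺ n))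
    increasing : ∀ {i j} → toℕ i ℕ.< toℕ j → g (lookup ys i) < g (lookup ys j)
    increasing {i} {j} i<j = ≤∧≢⇒<
      (AllPairs-lookup (Sorted.Sorted⇒AllPairs (DecTotalOrder.totalOrder O) (sort-↗ xs)) i j i<j)
      (λ eq → AllPairs-lookup unique i j i<j (g-inj (P-lookup i) (P-lookup j) eq))

module _ {_≼_ : Rel ℚ 0ℓ} (≼-refl : ∀ {x} → x ≼ x) (≼-trans : ∀ {x y z} → x ≼ y → y ≼ z → x ≼ z)
         (≼-total : ∀ x y → x ≼ y ⊎ y ≼ x) where

  -- The order is a parameter so that its reversal gives minima. The bound `a` takes part in the
  -- comparison and also serves an empty `P`.
  greatest : ∀ {n} {P : Pred (Fin n) 0ℓ} → Decidable P → (g : Fin n → ℚ) (a : ℚ) →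
    ∃[ m ] (a ≼ m × (∀ {x} → P x → g x ≼ m) × (m ≡ a ⊎ ∃[ x ] (P x × m ≡ g x)))
  greatest {zero} P? g a = a , ≼-refl , (λ { {()} }) , inj₁ refl
  greatest {suc n} {P} P? g a with greatest {P = P ∘ suc} (P? ∘ suc) (g ∘ suc) a | P? zero
  ... | m , a≼m , ≼m , sel | no ¬P0 =
    m , a≼m , (λ { {zero} P0 → ⊥-elim (¬P0 P0) ; {suc x} → ≼m }) , map₂ (λ (x , r) → suc x , r) sel
  ... | m , a≼m , ≼m , sel | yes P0 with ≼-total (g zero) m
  ...   | inj₁ g0≼m = m , a≼m , (λ { {zero} _ → g0≼m ; {suc x} → ≼m }) , map₂ (λ (x , r) → suc x , r) sel
  ...   | inj₂ m≼g0 = g zero , ≼-trans a≼m m≼g0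
      , (λ { {zero} _ → ≼-refl ; {suc x} Px → ≼-trans (≼m Px) m≼g0 }) , inj₂ (zero , P0 , refl)

-- Compare the maximum of `a` and the `l x` with the minimum of `b` and the `u y`. If the former is
-- smaller, density gives the point; if not, the hypotheses exclude that `a` or `b` is the extreme
-- value, so both are attained by vertices.
separate : ∀ {n} {L U : Pred (Fin n) 0ℓ} → Decidable L → Decidable U → (l u : Fin n → ℚ) →
  ∀ {a b} → a < b → (∀ {x} → L x → l x < b) → (∀ {y} → U y → a < u y) →
  (∃[ r ] (a < r × r < b × (∀ {x} → L x → l x < r) × (∀ {y} → U y → r < u y)))
  ⊎ (∃[ x ] ∃[ y ] (L x × U y × u y ≤ l x))
separate L? U? l u {a} {b} a<b l<b a<u
  with greatest {_≼_ = _≤_} ℚₚ.≤-refl ℚₚ.≤-trans ℚₚ.≤-total L? l a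
     | greatest {_≼_ = flip _≤_} ℚₚ.≤-refl (flip ℚₚ.≤-trans) (λ x y → ℚₚ.≤-total y x) U? u b
... | m , a≤m , l≤m , m-sel | M , M≤b , M≤u , M-sel with m ℚₚ.<? M
...   | yes m<M with r , m<r , r<M ← ℚₚ.<-dense m<M = inj₁
        ( r , ℚₚ.≤-<-trans a≤m m<r , ℚₚ.<-≤-trans r<M M≤b
        , (λ Lx → ℚₚ.≤-<-trans (l≤m Lx) m<r) , (λ Uy → ℚₚ.<-≤-trans r<M (M≤u Uy)))
...   | no m≮M with m-sel | M-sel
...     | inj₁ refl | inj₁ refl = ⊥-elim (m≮M a<b)
...     | inj₁ refl | inj₂ (_ , Uy , refl) = ⊥-elim (m≮M (a<u Uy))
...     | inj₂ (_ , Lx , refl) | inj₁ refl = ⊥-elim (m≮M (l<b Lx))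
...     | inj₂ (x , Lx , refl) | inj₂ (y , Uy , refl) = inj₂ (x , y , Lx , Uy , ℚₚ.≮⇒≥ m≮M)

last-true : ∀ {k} {R : Pred (Fin k) 0ℓ} → Decidable R →
  (∀ j → ¬ R j) ⊎ (∃[ i ] (R i × (∀ j → toℕ i ℕ.< toℕ j → ¬ R j)))
last-true {zero} R? = inj₁ λ ()
last-true {suc k} {R} R? with last-true {R = R ∘ suc} (R? ∘ suc) | R? zero
... | inj₂ (i , Ri , later) | _ = inj₂ (suc i , Ri , λ { (suc j) (s≤s lt) → later j lt })
... | inj₁ none | yes R0 = inj₂ (zero , R0 , λ { (suc j) _ → none j })
... | inj₁ none | no ¬R0 = inj₁ λ { zero → ¬R0 ; (suc j) → none j }

all-or : ∀ {k} {A : Fin k → Set} {B : Set₁} → (∀ i → A i ⊎ B) → (∀ i → A i) ⊎ B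
all-or {zero}  f = inj₁ λ ()
all-or {suc k} f with f zero | all-or (λ i → f (suc i))
... | inj₂ b | _       = inj₂ b
... | inj₁ _ | inj₂ b  = inj₂ b
... | inj₁ a | inj₁ as = inj₁ λ { zero → a ; (suc i) → as i }

-- The vertices vᵢ of an inclusion-minimal clique whose arcs have no common
-- point, in the circular order of the points pᵢ common to all of them but vᵢ.
record Frame {n} (G : Graph n) (M : CircularArcModel G) : Set where
  field
    k       : ℕ
    3≤k     : 3 ℕ.≤ k
    v       : Fin k → Fin n
    v-inj   : ∀ {i j} → v i ≡ v j → i ≡ j
    v-adj   : ∀ {i j} → i ≢ j → Adj G (v i) (v j)
    p       : Fin k → Point
    p∈      : ∀ {i j} → j ≢ i → p i ∈ ⟦ arc M (v j) ⟧
    p∉      : ∀ i → p i ∉ ⟦ arc M (v i) ⟧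
    start∉  : ∀ i → ¬ (∀ j → start (arc M (v i)) ∈ ⟦ arc M (v j) ⟧)
    p-mono  : ∀ {i j} → toℕ i ℕ.< toℕ j → pos (p i) < pos (p j)

helly-or-frame : ∀ {n} (G : Graph n) (M : CircularArcModel G) → Helly (arc M) ⊎ Frame G M
helly-or-frame {n} G M = result
  where
  A = arc M

  -- A common point of arcs, moved backwards to the nearest of their starts, stays common. Asking
  -- only for starts thus loses nothing and makes `Bad` decidable.
  Clique StartCommon Bad : Subset n → Set
  Clique S      = ∀ u → u Subset.∈ S → ∀ v → v Subset.∈ S → u ≢ v → Adj G u v
  StartCommon S = ∃[ w ] (w Subset.∈ S × (∀ u → u Subset.∈ S → start (A w) ∈ ⟦ A u ⟧))
  Bad S         = Nonempty S × Clique S × ¬ StartCommon S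

  clique? : ∀ S → Dec (Clique S)
  clique? S = Finₚ.all? λ u → u Subsetₚ.∈? S →-dec
    Finₚ.all? λ v → v Subsetₚ.∈? S →-dec (¬? (u Finₚ.≟ v) →-dec adj? G u v)

  startCommon? : ∀ S → Dec (StartCommon S)
  startCommon? S = Finₚ.any? λ w → w Subsetₚ.∈? S ×-dec
    Finₚ.all? λ u → u Subsetₚ.∈? S →-dec start (A w) ∈? A u

  bad? : ∀ S → Dec (Bad S)
  bad? S = Subsetₚ.nonempty? S ×-dec (clique? S ×-dec ¬? (startCommon? S))

  minimal : ∀ S → Bad S → Acc ℕ._<_ ∣ S ∣ → ∃[ T ] (Bad T × (∀ {x} → x Subset.∈ T → ¬ Bad (T ∖ x)))
  minimal S bad (acc rs) with Finₚ.any? (λ x → x Subsetₚ.∈? S ×-dec bad? (S ∖ x))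
  ... | yes (x , x∈S , bad′) = minimal (S ∖ x) bad′ (rs (Subsetₚ.x∈p⇒∣p-x∣<∣p∣ x∈S))
  ... | no none              = S , bad , λ x∈S bad′ → none (_ , x∈S , bad′)

  meets⇒adj : ∀ {u v} → u ≢ v → ⟦ A u ⟧ ≬ ⟦ A v ⟧ → Adj G u v
  meets⇒adj u≢v = Equivalence.from (adj⇔meets M u≢v)

  module _ (T : Subset n) (nonempty : Nonempty T) (cl : Clique T) (¬common : ¬ StartCommon T)
           (min : ∀ {x} → x Subset.∈ T → ¬ Bad (T ∖ x)) where

    -- This is minimality of `T`, except when `T` is `x` alone; then the start of the arc of `x`
    -- would be common to `T`.
    others-common : ∀ {x} → x Subset.∈ T → StartCommon (T ∖ x)
    others-common {x} x∈T with startCommon? (T ∖ x)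
    ... | yes p = p
    ... | no ¬p = ⊥-elim (min x∈T (T∖x-nonempty , T∖x-clique , ¬p))
      where
      T∖x⊆T : ∀ {y} → y Subset.∈ T ∖ x → y Subset.∈ T
      T∖x⊆T = Subsetₚ.p─q⊆p T ⁅ x ⁆
      T∖x-clique : Clique (T ∖ x)
      T∖x-clique u u∈ v v∈ = cl u (T∖x⊆T u∈) v (T∖x⊆T v∈)
      T∖x-nonempty : Nonempty (T ∖ x)
      T∖x-nonempty with Finₚ.any? (λ y → y Subsetₚ.∈? T ×-dec ¬? (y Finₚ.≟ x))
      ... | yes (y , y∈T , y≢x) = y , Subsetₚ.x∈p∧x≢y⇒x∈p-y y∈T y≢x
      ... | no none = ⊥-elim (¬common (x , x∈T , only))
        where
        only : ∀ u → u Subset.∈ T → start (A x) ∈ ⟦ A u ⟧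
        only u u∈T with u Finₚ.≟ x
        ... | yes refl = start∈ (A x)
        ... | no u≢x   = ⊥-elim (none (u , u∈T , u≢x))

    point : Fin n → Point
    point x with x Subsetₚ.∈? T
    ... | yes x∈T = start (A (proj₁ (others-common x∈T)))
    -- Any point does outside `T`; `point` is total in order to serve as a sorting key.
    ... | no  _   = start (A x)

    point∈ : ∀ {x y} → x Subset.∈ T → y Subset.∈ T → y ≢ x → point x ∈ ⟦ A y ⟧
    point∈ {x} x∈T y∈T y≢x with x Subsetₚ.∈? T
    ... | yes x∈T′ = proj₂ (proj₂ (others-common x∈T′)) _ (Subsetₚ.x∈p∧x≢y⇒x∈p-y y∈T y≢x)
    ... | no x∉T   = ⊥-elim (x∉T x∈T)

    point∉ : ∀ {x} → x Subset.∈ T → point x ∉ ⟦ A x ⟧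
    point∉ {x} x∈T p∈x with x Subsetₚ.∈? T
    ... | no x∉T   = x∉T x∈T
    ... | yes x∈T′ with others-common x∈T′
    ...   | w , w∈ , h = ¬common (w , Subsetₚ.p─q⊆p T ⁅ x ⁆ w∈ , all)
      where
      all : ∀ u → u Subset.∈ T → start (A w) ∈ ⟦ A u ⟧
      all u u∈T with u Finₚ.≟ x
      ... | yes refl = p∈x
      ... | no u≢x   = h u (Subsetₚ.x∈p∧x≢y⇒x∈p-y u∈T u≢x)

    point-injective : ∀ {x y} → x Subset.∈ T → y Subset.∈ T → pos (point x) ≡ pos (point y) → x ≡ y
    point-injective {x} {y} x∈T y∈T eq with x Finₚ.≟ y
    ... | yes x≡y = x≡y
    ... | no x≢y  = ⊥-elim (point∉ x∈T
            (∈-resp-pos (A x) {point y} {point x} (sym eq) (point∈ y∈T x∈T x≢y)))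

    frame : Frame G M
    frame with enumerate-increasing (λ x → x Subsetₚ.∈? T) (λ x → pos (point x)) point-injective
    ... | k , e , e∈T , index , increasing = record
      { k = k
      ; 3≤k = 3≤ k e e∈T index
      ; v = e
      ; v-inj = e-inj
      ; v-adj = λ i≢j → cl _ (e∈T _) _ (e∈T _) (λ eq → i≢j (e-inj eq))
      ; p = λ i → point (e i)
      ; p∈ = λ {i} {j} j≢i → point∈ (e∈T i) (e∈T j) (λ eq → j≢i (e-inj eq))
      ; p∉ = λ i → point∉ (e∈T i)
      ; start∉ = λ i all → ¬common (e i , e∈T i , λ u u∈T →
          subst (λ u → start (A (e i)) ∈ ⟦ A u ⟧) (proj₂ (index u∈T)) (all (proj₁ (index u∈T))))
      ; p-mono = increasing
      }
      where
      e-inj : ∀ {i j} → e i ≡ e j → i ≡ j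
      e-inj {i} {j} eq with ℕₚ.<-cmp (toℕ i) (toℕ j)
      ... | tri< lt _ _ = ⊥-elim (ℚₚ.<-irrefl (cong (pos ∘ point) eq) (increasing lt))
      ... | tri≈ _ eq′ _ = Finₚ.toℕ-injective eq′
      ... | tri> _ _ gt = ⊥-elim (ℚₚ.<-irrefl (cong (pos ∘ point) (sym eq)) (increasing gt))

      -- A single arc contains its own start, and of two intersecting arcs one contains the start of
      -- the other (`meets⇒start`). A family without a common start has at least three members.
      3≤ : ∀ k (e : Fin k → Fin n) → (∀ i → e i Subset.∈ T) →
           (∀ {x} → x Subset.∈ T → ∃[ i ] e i ≡ x) → 3 ℕ.≤ k
      3≤ zero e e∈T index with () ← proj₁ (index (proj₂ nonempty))
      3≤ (suc zero) e e∈T index = ⊥-elim (¬common (e zero , e∈T zero , h))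
        where
        h : ∀ u → u Subset.∈ T → start (A (e zero)) ∈ ⟦ A u ⟧
        h u u∈T with index u∈T
        ... | zero , refl = start∈ (A u)
      3≤ (suc (suc zero)) e e∈T index with e zero Finₚ.≟ e (suc zero)
      ... | yes eq = ⊥-elim (¬common (e zero , e∈T zero , h))
        where
        h : ∀ u → u Subset.∈ T → start (A (e zero)) ∈ ⟦ A u ⟧
        h u u∈T with index u∈T
        ... | zero     , refl = start∈ (A u)
        ... | suc zero , refl = subst (λ x → start (A x) ∈ ⟦ A (e (suc zero)) ⟧) (sym eq) (start∈ (A (e (suc zero))))
      ... | no ne with meets⇒start (A (e zero)) (A (e (suc zero)))
                         (Equivalence.to (adj⇔meets M ne) (cl _ (e∈T zero) _ (e∈T (suc zero)) ne))
      ...   | inj₁ s = ⊥-elim (¬common (e zero , e∈T zero , h))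
        where
        h : ∀ u → u Subset.∈ T → start (A (e zero)) ∈ ⟦ A u ⟧
        h u u∈T with index u∈T
        ... | zero     , refl = start∈ (A u)
        ... | suc zero , refl = s
      ...   | inj₂ s = ⊥-elim (¬common (e (suc zero) , e∈T (suc zero) , h))
        where
        h : ∀ u → u Subset.∈ T → start (A (e (suc zero))) ∈ ⟦ A u ⟧
        h u u∈T with index u∈T
        ... | zero     , refl = s
        ... | suc zero , refl = start∈ (A u)
      3≤ (suc (suc (suc k))) _ _ _ = s≤s (s≤s (s≤s z≤n))

  result : Helly A ⊎ Frame G M
  result with Subsetₚ.anySubset? bad?
  ... | yes (S , bad) with minimal S bad (<-wellFounded ∣ S ∣)
  ...   | T , (ne , cl , ¬common) , min = inj₂ (frame T ne cl ¬common min)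
  result | no none = inj₁ helly
    where
    helly : Helly A
    helly S nonempty meets with startCommon? S
    ... | yes (w , _ , h) = start (A w) , λ {u} u∈S → h u u∈S
    ... | no ¬common = ⊥-elim (none (S , nonempty
            , (λ u u∈S v v∈S u≢v → meets⇒adj u≢v (meets u∈S v∈S)) , ¬common))

-- Prolonging the arcs of two consecutive vertices of a frame

Covers : ∀ {n} {G : Graph n} → CircularArcModel G → Rel (Fin n) 0ℓ
Covers M x y = ∀ q → q ∈ ⟦ arc M x ⟧ ⊎ q ∈ ⟦ arc M y ⟧

record Improved {n} {G : Graph n} (M : CircularArcModel G) : Set₁ where
  field
    model   : CircularArcModel G
    mono    : ∀ {x y} → Covers M x y → Covers model x y
    x y     : Fin n
    old     : ¬ Covers M x y
    new     : Covers model x y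

module FrameProperties {n} {G : Graph n} {M : CircularArcModel G} (F : Frame G M) where
  open Frame F public

  A : Fin n → Arc
  A = arc M

  Q : Pred (Fin n) 0ℓ
  Q x = ∃[ i ] v i ≡ x

  2≤k : 2 ℕ.≤ k
  2≤k = ℕₚ.<⇒≤ 3≤k

  meets⇒adj : ∀ {u v} → u ≢ v → ⟦ A u ⟧ ≬ ⟦ A v ⟧ → Adj G u v
  meets⇒adj u≢v = Equivalence.from (adj⇔meets M u≢v)

  p-cyc : ∀ {i j} → j ≢ i → j ≢ next i → Cyc (pos (p i)) (pos (p (next i))) (pos (p j))
  p-cyc {i} {j} j≢i j≢i′ with nextView i | ℕₚ.<-cmp (toℕ j) (toℕ i)
  ... | _ | tri≈ _ eq _ = ⊥-elim (j≢i (Finₚ.toℕ-injective eq))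
  ... | step s | tri< j<i _ _ =
    inj₂ (inj₂ (p-mono j<i , p-mono (subst (toℕ i ℕ.<_) (sym s) (ℕₚ.n<1+n _))))
  ... | step s | tri> _ _ i<j =
    inj₁ (p-mono (subst (toℕ i ℕ.<_) (sym s) (ℕₚ.n<1+n _))
         , p-mono (ℕₚ.≤∧≢⇒< (subst (ℕ._≤ toℕ j) (sym s) i<j) (λ eq → j≢i′ (Finₚ.toℕ-injective (sym eq)))))
  ... | wrap l z | tri< j<i _ _ =
    inj₂ (inj₁ (p-mono (ℕₚ.≤∧≢⇒< (subst (ℕ._≤ toℕ j) (sym z) z≤n) (λ eq → j≢i′ (Finₚ.toℕ-injective (sym eq)))) , p-mono j<i))
  ... | wrap l z | tri> _ _ i<j = ⊥-elim (ℕₚ.<⇒≱ (Finₚ.toℕ<n j) (subst (ℕ._≤ toℕ j) l i<j))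

  -- The arc of `v j` contains both ends of the closed stretch from `p i` to `p (next i)` and omits
  -- `p j`, which lies on the other side; so it contains the stretch.
  between : ∀ i q → ¬ Cyc (pos (p i)) (pos (p (next i))) (pos q) →
    ∀ {j} → j ≢ i → j ≢ next i → q ∈ ⟦ A (v j) ⟧
  between i q ¬cyc {j} j≢i j≢i′ = convex (A (v j)) {p i} {p (next i)} {p j} {q}
    (p-cyc j≢i j≢i′) ¬cyc (p∉ j) (p∈ j≢i) (p∈ j≢i′)

  -- `m` is the last index whose `p` does not exceed `q`, or the last index of all if there is none.
  segment : ∀ q → ∃[ m ] (∀ {j} → j ≢ m → j ≢ next m → q ∈ ⟦ A (v j) ⟧)
  segment q with last-true (λ i → pos (p i) ℚₚ.≤? pos q)
  ... | inj₁ none = prev 0′ , between (prev 0′) q ¬cyc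
    where
    0′ : Fin k
    0′ = Fin.fromℕ< (ℕₚ.≤-trans (s≤s z≤n) 3≤k)
    n<l : pos (p (next (prev 0′))) < pos (p (prev 0′))
    n<l = subst (λ i → pos (p i) < pos (p (prev 0′))) (sym (next-prev 0′))
      (p-mono (ℕₚ.≤∧≢⇒< (subst (ℕ._≤ toℕ (prev 0′)) (sym (Finₚ.toℕ-fromℕ< _)) z≤n)
        (λ eq → next≢ 2≤k (prev 0′) (trans (next-prev 0′) (Finₚ.toℕ-injective eq)))))
    ¬cyc : ¬ Cyc (pos (p (prev 0′))) (pos (p (next (prev 0′)))) (pos q)
    ¬cyc (inj₁ (a , _))        = ℚₚ.<-asym a n<l
    ¬cyc (inj₂ (inj₁ (a , _))) = none (next (prev 0′)) (ℚₚ.<⇒≤ a)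
    ¬cyc (inj₂ (inj₂ (_ , a))) = ℚₚ.<-asym a n<l
  ... | inj₂ (m , m≤q , later) = m , between m q ¬cyc
    where
    ¬cyc : ¬ Cyc (pos (p m)) (pos (p (next m))) (pos q)
    ¬cyc c with nextView m
    ... | step s = go c
      where
      q<n : pos q < pos (p (next m))
      q<n = ℚₚ.≰⇒> (later (next m) (subst (toℕ m ℕ.<_) (sym s) (ℕₚ.n<1+n _)))
      go : ¬ Cyc (pos (p m)) (pos (p (next m))) (pos q)
      go (inj₁ (_ , a))        = ℚₚ.<-asym a q<n
      go (inj₂ (inj₁ (a , _))) = ℚₚ.<-asym a q<n
      go (inj₂ (inj₂ (a , _))) = <⇒≱ a m≤q
    ... | wrap l z = go c
      where
      n<m : pos (p (next m)) < pos (p m)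
      n<m = p-mono (ℕₚ.≤∧≢⇒< (subst (ℕ._≤ toℕ m) (sym z) z≤n)
        (λ eq → next≢ 2≤k m (Finₚ.toℕ-injective eq)))
      go : ¬ Cyc (pos (p m)) (pos (p (next m))) (pos q)
      go (inj₁ (a , _))        = ℚₚ.<-asym a n<m
      go (inj₂ (inj₁ (_ , a))) = <⇒≱ a m≤q
      go (inj₂ (inj₂ (a , _))) = <⇒≱ a m≤q

  -- The cut at `c` lies on the arcs of both `x` and `y`, so both complements become open intervals.
  -- The one of `x` ends at `s`, the one of `y` begins at `a`, and they overlap between `a` and `s`.
  -- Prolonging means moving `s` back and `a` forward to a common point of that overlap.
  module Step (i : Fin k) where
    i′ : Fin k
    i′ = next i
    i″ : Fin k
    i″ = next i′

    i′≢i : i′ ≢ i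
    i′≢i = next≢ 2≤k i
    i″≢i : i″ ≢ i
    i″≢i = next²≢ 3≤k i
    i″≢i′ : i″ ≢ i′
    i″≢i′ = next≢ 2≤k i′

    x y : Fin n
    x = v i
    y = v i′

    x≢y : x ≢ y
    x≢y eq = i′≢i (sym (v-inj eq))

    c : Point
    c = p i″

    f : Point → ℚ
    f = key c

    f-min : ∀ q → f c ≤ f q
    f-min = key-min c

    in⇒ : ∀ a {q} → q ∈ ⟦ a ⟧ → InArc f a q
    in⇒ = ∈⇒inArc c
    in⇐ : ∀ a {q} → InArc f a q → q ∈ ⟦ a ⟧
    in⇐ = inArc⇒∈ c

    pᵢ<pᵢ′ : f (p i) < f (p i′)
    pᵢ<pᵢ′ with cyc-key c (p i) (p i′) c (p-cyc i″≢i i″≢i′)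
    ... | inj₁ (_ , lt)        = ⊥-elim (<⇒≱ lt (f-min (p i′)))
    ... | inj₂ (inj₁ (lt , _)) = ⊥-elim (<⇒≱ lt (f-min (p i′)))
    ... | inj₂ (inj₂ (_ , lt)) = lt

    others : ∀ {q} → f (p i) ≤ f q → f q ≤ f (p i′) → ∀ {j} → j ≢ i → j ≢ i′ → q ∈ ⟦ A (v j) ⟧
    others {q} p≤q q≤p′ = between i q ¬cyc
      where
      ¬cyc : ¬ Cyc (pos (p i)) (pos (p i′)) (pos q)
      ¬cyc cyc with cyc-key c (p i) (p i′) q cyc
      ... | inj₁ (_ , a)        = <⇒≱ a q≤p′
      ... | inj₂ (inj₁ (a , _)) = <⇒≱ a q≤p′
      ... | inj₂ (inj₂ (a , _)) = <⇒≱ a p≤q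

    s t a : Point
    s = start (A x)
    t = end (A x)
    a = end (A y)

    -- The arc of `x` contains `c` and `p i′` but omits `p i` between them.
    x-wraps : f t < f s × f t < f (p i) × f (p i) < f s × f s ≤ f (p i′)
    x-wraps with in⇒ (A x) {c} (p∈ (λ eq → i″≢i (sym eq))) | in⇒ (A x) {p i′} (p∈ (λ eq → i′≢i (sym eq)))
    ... | inj₁ (s≤t , s≤c , _) | inj₁ (_ , _ , p′≤t) =
      ⊥-elim (p∉ i (in⇐ (A x) (inj₁ (s≤t , ℚₚ.≤-trans s≤c (f-min (p i))
                                         , ℚₚ.≤-trans (ℚₚ.<⇒≤ pᵢ<pᵢ′) p′≤t))))
    ... | inj₁ (s≤t , _) | inj₂ (t<s , _) = ⊥-elim (<⇒≱ t<s s≤t)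
    ... | inj₂ (t<s , _) | inj₁ (s≤t , _) = ⊥-elim (<⇒≱ t<s s≤t)
    ... | inj₂ (t<s , _) | inj₂ (_ , inj₂ p′≤t) =
      ⊥-elim (p∉ i (in⇐ (A x) (inj₂ (t<s , inj₂ (ℚₚ.≤-trans (ℚₚ.<⇒≤ pᵢ<pᵢ′) p′≤t)))))
    ... | inj₂ (t<s , _) | inj₂ (_ , inj₁ s≤p′) =
        t<s
      , ℚₚ.≰⇒> (λ p≤t → p∉ i (in⇐ (A x) (inj₂ (t<s , inj₂ p≤t))))
      , ℚₚ.≰⇒> (λ s≤p → p∉ i (in⇐ (A x) (inj₂ (t<s , inj₁ s≤p))))
      , s≤p′

    t<s : f t < f s
    t<s = proj₁ x-wraps
    t<p : f t < f (p i)
    t<p = proj₁ (proj₂ x-wraps)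
    p<s : f (p i) < f s
    p<s = proj₁ (proj₂ (proj₂ x-wraps))
    s≤p′ : f s ≤ f (p i′)
    s≤p′ = proj₂ (proj₂ (proj₂ x-wraps))

    ∈x⇒ : ∀ {q} → q ∈ ⟦ A x ⟧ → f s ≤ f q ⊎ f q ≤ f t
    ∈x⇒ q∈x with in⇒ (A x) q∈x
    ... | inj₁ (s≤t , _) = ⊥-elim (<⇒≱ t<s s≤t)
    ... | inj₂ (_ , r)   = r
    s≤⇒∈x : ∀ {q} → f s ≤ f q → q ∈ ⟦ A x ⟧
    s≤⇒∈x s≤q = in⇐ (A x) (inj₂ (t<s , inj₁ s≤q))

    -- The arc of `y` either starts at the cut without wrapping, or wraps with its start beyond
    -- `p i′`. The record hides this distinction.
    record YView : Set where
      field
        p≤a     : f (p i) ≤ f a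
        a<p′    : f a < f (p i′)
        ≤a⇒∈y   : ∀ {q} → f q ≤ f a → q ∈ ⟦ A y ⟧
        ∈y⇒     : ∀ {q} → q ∈ ⟦ A y ⟧ → f q ≤ f a ⊎ (f (p i′) < f (start (A y)) × f (start (A y)) ≤ f q)
        extend  : ∀ r (ne : pos (start (A y)) ≢ pos r) → f a < f r → f r < f (p i′) →
                  let Y = record { start = start (A y) ; end = r ; start≢end = ne } in
                  (∀ {q} → f q ≤ f r → q ∈ ⟦ Y ⟧) × (∀ {q} → q ∈ ⟦ Y ⟧ → f q ≤ f r ⊎ q ∈ ⟦ A y ⟧)
                  × (∀ {q} → q ∈ ⟦ A y ⟧ → q ∈ ⟦ Y ⟧)

    y-view : YView
    y-view with in⇒ (A y) {c} (p∈ (λ eq → i″≢i′ (sym eq))) | in⇒ (A y) {p i} (p∈ i′≢i)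
    ... | inj₁ (s≤t , _) | inj₂ (t<s , _) = ⊥-elim (<⇒≱ t<s s≤t)
    ... | inj₂ (t<s , _) | inj₁ (s≤t , _) = ⊥-elim (<⇒≱ t<s s≤t)
    ... | inj₁ (s≤t , s≤c , _) | inj₁ (_ , _ , p≤t) = record
      { p≤a = p≤t
      ; a<p′ = ℚₚ.≰⇒> (λ p′≤t → p∉ i′ (in⇐ (A y) (inj₁ (s≤t , s≤ (p i′) , p′≤t))))
      ; ≤a⇒∈y = λ {q} q≤a → in⇐ (A y) (inj₁ (s≤t , s≤ q , q≤a))
      ; ∈y⇒ = ∈y⇒
      ; extend = λ r ne a<r r<p′ → let Y = record { start = start (A y) ; end = r ; start≢end = ne } in
            (λ {q} q≤r → in⇐ Y (inj₁ (s≤ r , s≤ q , q≤r)))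
          , ∈Y⇒ r ne
          , (λ {q} q∈ → in⇐ Y (inj₁ (s≤ r , s≤ q , ℚₚ.≤-trans ([ (λ z → z) , (λ (p′<s , _) → ⊥-elim (<⇒≱ p′<s (s≤ (p i′)))) ]′ (∈y⇒ q∈)) (ℚₚ.<⇒≤ a<r))))
      }
      where
      s≤ : ∀ q → f (start (A y)) ≤ f q
      s≤ q = ℚₚ.≤-trans s≤c (f-min q)
      ∈y⇒ : ∀ {q} → q ∈ ⟦ A y ⟧ → f q ≤ f a ⊎ (f (p i′) < f (start (A y)) × f (start (A y)) ≤ f q)
      ∈y⇒ q∈ with in⇒ (A y) q∈
      ... | inj₁ (_ , _ , q≤t) = inj₁ q≤t
      ... | inj₂ (t<s , _)     = ⊥-elim (<⇒≱ t<s s≤t)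
      ∈Y⇒ : ∀ r ne {q} → q ∈ ⟦ record { start = start (A y) ; end = r ; start≢end = ne } ⟧ → f q ≤ f r ⊎ q ∈ ⟦ A y ⟧
      ∈Y⇒ r ne q∈ with in⇒ (record { start = start (A y) ; end = r ; start≢end = ne }) q∈
      ... | inj₁ (_ , _ , q≤r) = inj₁ q≤r
      ... | inj₂ (r<s , _)     = ⊥-elim (<⇒≱ r<s (s≤ r))
    ... | inj₂ (t<s , _) | inj₂ (_ , inj₁ s≤p) =
      ⊥-elim (p∉ i′ (in⇐ (A y) (inj₂ (t<s , inj₁ (ℚₚ.≤-trans s≤p (ℚₚ.<⇒≤ pᵢ<pᵢ′))))))
    ... | inj₂ (t<s , _) | inj₂ (_ , inj₂ p≤t) = record
      { p≤a = p≤t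
      ; a<p′ = ℚₚ.≰⇒> (λ p′≤t → p∉ i′ (in⇐ (A y) (inj₂ (t<s , inj₂ p′≤t))))
      ; ≤a⇒∈y = λ q≤a → in⇐ (A y) (inj₂ (t<s , inj₂ q≤a))
      ; ∈y⇒ = ∈y⇒
      ; extend = λ r ne a<r r<p′ →
          let Y = record { start = start (A y) ; end = r ; start≢end = ne }
              r<s = ℚₚ.<-trans r<p′ p′<s in
            (λ q≤r → in⇐ Y (inj₂ (r<s , inj₂ q≤r)))
          , ∈Y⇒ r ne r<s
          , (λ {q} q∈ → in⇐ Y (inj₂ (r<s , [ (λ q≤a → inj₂ (ℚₚ.≤-trans q≤a (ℚₚ.<⇒≤ a<r))) , (λ (_ , s≤q) → inj₁ s≤q) ]′ (∈y⇒ {q} q∈))))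
      }
      where
      p′<s : f (p i′) < f (start (A y))
      p′<s = ℚₚ.≰⇒> (λ s≤p′ → p∉ i′ (in⇐ (A y) (inj₂ (t<s , inj₁ s≤p′))))
      ∈y⇒ : ∀ {q} → q ∈ ⟦ A y ⟧ → f q ≤ f a ⊎ (f (p i′) < f (start (A y)) × f (start (A y)) ≤ f q)
      ∈y⇒ q∈ with in⇒ (A y) q∈
      ... | inj₁ (s≤t , _)        = ⊥-elim (<⇒≱ t<s s≤t)
      ... | inj₂ (_ , inj₁ s≤q)   = inj₂ (p′<s , s≤q)
      ... | inj₂ (_ , inj₂ q≤t)   = inj₁ q≤t
      ∈Y⇒ : ∀ r ne → f r < f (start (A y)) → ∀ {q} →
        q ∈ ⟦ record { start = start (A y) ; end = r ; start≢end = ne } ⟧ → f q ≤ f r ⊎ q ∈ ⟦ A y ⟧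
      ∈Y⇒ r ne r<s q∈ with in⇒ (record { start = start (A y) ; end = r ; start≢end = ne }) q∈
      ... | inj₁ (s≤r , _)      = ⊥-elim (<⇒≱ r<s s≤r)
      ... | inj₂ (_ , inj₁ s≤q) = inj₂ (in⇐ (A y) (inj₂ (t<s , inj₁ s≤q)))
      ... | inj₂ (_ , inj₂ q≤r) = inj₁ q≤r

    open YView y-view

    s∈ : f s ≤ f a → ∀ j → s ∈ ⟦ A (v j) ⟧
    s∈ s≤a j with j Finₚ.≟ i | j Finₚ.≟ i′
    ... | yes refl | _        = start∈ (A x)
    ... | no _     | yes refl = ≤a⇒∈y s≤a
    ... | no j≢i   | no j≢i′  = others (ℚₚ.<⇒≤ p<s) s≤p′ j≢i j≢i′

    -- Otherwise the start of the arc of `x` would lie on every arc of the clique. This is where the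
    -- absence of a common point enters.
    a<s : f a < f s
    a<s = ℚₚ.≰⇒> λ s≤a → start∉ i (s∈ s≤a)

    t<a : f t < f a
    t<a = ℚₚ.<-≤-trans t<p p≤a

    -- The vertices that obstruct a prolongation. Their arcs avoid `c`, so they are intervals: those
    -- of `L` end before `s` and those of `U` begin after `a`. The new common end must lie beyond
    -- all of the former and before all of the latter.
    L U : Pred (Fin n) 0ℓ
    L u = u ≢ x × ¬ Adj G u x
    U z = z ≢ y × ¬ Adj G z y

    L? : Decidable L
    L? u = ¬? (u Finₚ.≟ x) ×-dec ¬? (adj? G u x)
    U? : Decidable U
    U? z = ¬? (z Finₚ.≟ y) ×-dec ¬? (adj? G z y)

    L-disjoint : ∀ {u q} → L u → q ∈ ⟦ A u ⟧ → q ∉ ⟦ A x ⟧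
    L-disjoint {u} {q} (u≢x , ¬adj) q∈u q∈x = ¬adj (meets⇒adj u≢x (q , q∈u , q∈x))
    U-disjoint : ∀ {z q} → U z → q ∈ ⟦ A z ⟧ → q ∉ ⟦ A y ⟧
    U-disjoint {z} {q} (z≢y , ¬adj) q∈z q∈y = ¬adj (meets⇒adj z≢y (q , q∈z , q∈y))

    L∌c : ∀ {u} → L u → c ∉ ⟦ A u ⟧
    L∌c {u} Lu c∈u = L-disjoint {u} {c} Lu c∈u (p∈ (λ eq → i″≢i (sym eq)))
    U∌c : ∀ {z} → U z → c ∉ ⟦ A z ⟧
    U∌c {z} Uz c∈z = U-disjoint {z} {c} Uz c∈z (p∈ (λ eq → i″≢i′ (sym eq)))

    flat : ∀ u → c ∉ ⟦ A u ⟧ → ∀ q → q ∈ ⟦ A u ⟧ → f (start (A u)) ≤ f q × f q ≤ f (end (A u))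
    flat u c∉u q q∈u with in⇒ (A u) {q} q∈u
    ... | inj₁ (_ , r)   = r
    ... | inj₂ (t<s , _) = ⊥-elim (ℚₚ.<-asym t<s (∌⇒start<end c (A u) c∉u))

    flat⇐ : ∀ u → c ∉ ⟦ A u ⟧ → ∀ q → f (start (A u)) ≤ f q → f q ≤ f (end (A u)) → q ∈ ⟦ A u ⟧
    flat⇐ u c∉u q s≤q q≤t = in⇐ (A u) (inj₁ (ℚₚ.<⇒≤ (∌⇒start<end c (A u) c∉u) , s≤q , q≤t))

    L-end : ∀ {u} → L u → f (end (A u)) < f s
    L-end {u} Lu = ℚₚ.≰⇒> λ s≤e → L-disjoint {u} {end (A u)} Lu (end∈ (A u)) (s≤⇒∈x {end (A u)} s≤e)
    U-start : ∀ {z} → U z → f a < f (start (A z))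
    U-start {z} Uz = ℚₚ.≰⇒> λ s≤a → U-disjoint {z} {start (A z)} Uz (start∈ (A z)) (≤a⇒∈y {start (A z)} s≤a)

    module _ (w : Fin n) where
      nn-pair : L w → U w → (q : Point) → q ∈ ⟦ A w ⟧ → f (p i) ≤ f q → f q ≤ f (p i′) →
        NonNeighbours G w ∩ Q ≐ ｛ x ｝ ∪ ｛ y ｝
      nn-pair (w≢x , ¬wx) (w≢y , ¬wy) q q∈w p≤q q≤p′ = ⇒ , ⇐
        where
        ⇒ : NonNeighbours G w ∩ Q ⊆ ｛ x ｝ ∪ ｛ y ｝
        ⇒ ((ne , ¬adj) , j , refl) with j Finₚ.≟ i | j Finₚ.≟ i′
        ... | yes refl | _        = inj₁ refl
        ... | no _     | yes refl = inj₂ refl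
        ... | no j≢i   | no j≢i′  =
          ⊥-elim (¬adj (meets⇒adj (λ eq → ne (sym eq)) (q , q∈w , others p≤q q≤p′ j≢i j≢i′)))
        ⇐ : ｛ x ｝ ∪ ｛ y ｝ ⊆ NonNeighbours G w ∩ Q
        ⇐ (inj₁ refl) = ((λ eq → w≢x (sym eq)) , ¬wx) , i , refl
        ⇐ (inj₂ refl) = ((λ eq → w≢y (sym eq)) , ¬wy) , i′ , refl

      nn-x : L w → ¬ U w → (q : Point) → q ∈ ⟦ A w ⟧ → f (p i) ≤ f q → f q ≤ f (p i′) →
        NonNeighbours G w ∩ Q ≐ ｛ x ｝
      nn-x (w≢x , ¬wx) ¬Uw q q∈w p≤q q≤p′ = ⇒ , λ { refl → ((λ eq → w≢x (sym eq)) , ¬wx) , i , refl }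
        where
        ⇒ : NonNeighbours G w ∩ Q ⊆ ｛ x ｝
        ⇒ ((ne , ¬adj) , j , refl) with j Finₚ.≟ i | j Finₚ.≟ i′
        ... | yes refl | _        = refl
        ... | no _     | yes refl = ⊥-elim (¬Uw ((λ eq → ne (sym eq)) , ¬adj))
        ... | no j≢i   | no j≢i′  =
          ⊥-elim (¬adj (meets⇒adj (λ eq → ne (sym eq)) (q , q∈w , others p≤q q≤p′ j≢i j≢i′)))

      nn-y : U w → ¬ L w → (q : Point) → q ∈ ⟦ A w ⟧ → f (p i) ≤ f q → f q ≤ f (p i′) →
        NonNeighbours G w ∩ Q ≐ ｛ y ｝
      nn-y (w≢y , ¬wy) ¬Lw q q∈w p≤q q≤p′ = ⇒ , λ { refl → ((λ eq → w≢y (sym eq)) , ¬wy) , i′ , refl }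
        where
        ⇒ : NonNeighbours G w ∩ Q ⊆ ｛ y ｝
        ⇒ ((ne , ¬adj) , j , refl) with j Finₚ.≟ i | j Finₚ.≟ i′
        ... | yes refl | _        = ⊥-elim (¬Lw ((λ eq → ne (sym eq)) , ¬adj))
        ... | no _     | yes refl = refl
        ... | no j≢i   | no j≢i′  =
          ⊥-elim (¬adj (meets⇒adj (λ eq → ne (sym eq)) (q , q∈w , others p≤q q≤p′ j≢i j≢i′)))

    -- The start of `z` and the end of `u` lie between `p i` and `p i′`, hence on all other arcs of
    -- the clique. A vertex of both `L` and `U` among the two is a witness of type `𝒪₁`. Otherwise
    -- `u` is adjacent to `y`, so its arc reaches back to `a` or before and contains the start of
    -- `z`; this is the edge of `𝒪₂`.
    found : ∀ {u z} → L u → U z → f (start (A z)) ≤ f (end (A u)) → Witnesses G Q x y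
    found {u} {z} Lu Uz sz≤tu with L? z | U? u
    ... | yes Lz | _      = 𝒪₁ z (nn-pair z Lz Uz (start (A z)) (start∈ (A z))
            (ℚₚ.<⇒≤ (ℚₚ.≤-<-trans p≤a (U-start {z} Uz)))
            (ℚₚ.≤-trans sz≤tu (ℚₚ.≤-trans (ℚₚ.<⇒≤ (L-end {u} Lu)) s≤p′)))
    ... | no _   | yes Uu = 𝒪₁ u (nn-pair u Lu Uu (end (A u)) (end∈ (A u))
            (ℚₚ.≤-trans p≤a (ℚₚ.≤-trans (ℚₚ.<⇒≤ (U-start {z} Uz)) sz≤tu))
            (ℚₚ.≤-trans (ℚₚ.<⇒≤ (L-end {u} Lu)) s≤p′))
    ... | no ¬Lz | no ¬Uu = 𝒪₂ u z
            (nn-x u Lu ¬Uu (end (A u)) (end∈ (A u))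
              (ℚₚ.≤-trans p≤a (ℚₚ.≤-trans (ℚₚ.<⇒≤ (U-start {z} Uz)) sz≤tu))
              (ℚₚ.≤-trans (ℚₚ.<⇒≤ (L-end {u} Lu)) s≤p′))
            (nn-y z Uz ¬Lz (start (A z)) (start∈ (A z))
              (ℚₚ.<⇒≤ (ℚₚ.≤-<-trans p≤a (U-start {z} Uz)))
              (ℚₚ.≤-trans sz≤tu (ℚₚ.≤-trans (ℚₚ.<⇒≤ (L-end {u} Lu)) s≤p′)))
            (meets⇒adj (λ { refl → ¬Uu Uz }) (start (A z) , sz∈u , start∈ (A z)))
      where
      u-meets-y : ⟦ A u ⟧ ≬ ⟦ A y ⟧
      u-meets-y = Equivalence.to (adj⇔meets M u≢y) adj
        where
        u≢y : u ≢ y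
        u≢y refl = proj₂ Lu (v-adj i′≢i)
        adj : Adj G u y
        adj = decidable-stable (adj? G u y) λ ¬adj → ¬Uu (u≢y , ¬adj)
      sz∈u : start (A z) ∈ ⟦ A u ⟧
      sz∈u with u-meets-y
      ... | q , q∈u , q∈y with flat u (L∌c {u} Lu) q q∈u | ∈y⇒ {q} q∈y
      ...   | su≤q , _ | inj₁ q≤a = flat⇐ u (L∌c {u} Lu) (start (A z))
                (ℚₚ.≤-trans su≤q (ℚₚ.≤-trans q≤a (ℚₚ.<⇒≤ (U-start {z} Uz)))) sz≤tu
      ...   | _ , q≤tu | inj₂ (p′<sy , sy≤q) = ⊥-elim (<⇒≱
                (ℚₚ.<-trans (ℚₚ.<-≤-trans (L-end {u} Lu) s≤p′) p′<sy)
                (ℚₚ.≤-trans sy≤q q≤tu))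

    module Extend (r : ℚ) (a<r : f a < r) (r<s : r < f s)
                  (L<r : ∀ {u} → L u → f (end (A u)) < r)
                  (r<U : ∀ {z} → U z → r < f (start (A z))) where

      o : Point
      o = proj₁ (pointAt c {a} {s} a<r r<s)
      fo≡r : f o ≡ r
      fo≡r = proj₂ (pointAt c {a} {s} a<r r<s)

      a<o : f a < f o
      a<o = subst (f a <_) (sym fo≡r) a<r
      o<s : f o < f s
      o<s = subst (_< f s) (sym fo≡r) r<s
      L<o : ∀ {u} → L u → f (end (A u)) < f o
      L<o {u} Lu = subst (f (end (A u)) <_) (sym fo≡r) (L<r {u} Lu)
      o<U : ∀ {z} → U z → f o < f (start (A z))
      o<U {z} Uz = subst (_< f (start (A z))) (sym fo≡r) (r<U {z} Uz)

      t<o : f t < f o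
      t<o = ℚₚ.<-trans t<a a<o
      o<p′ : f o < f (p i′)
      o<p′ = ℚₚ.<-≤-trans o<s s≤p′

      X : Arc
      X = record { start = o ; end = t
                 ; start≢end = λ eq → ℚₚ.<-irrefl (key-cong c {t} {o} (sym eq)) t<o }

      sy≢o : pos (start (A y)) ≢ pos o
      sy≢o eq with ∈y⇒ {start (A y)} (start∈ (A y)) | key-cong c {start (A y)} {o} eq
      ... | inj₁ sy≤a        | e = <⇒≱ a<o (subst (_≤ f a) e sy≤a)
      ... | inj₂ (p′<sy , _) | e = ℚₚ.<-asym o<p′ (subst (f (p i′) <_) e p′<sy)

      Y : Arc
      Y = record { start = start (A y) ; end = o ; start≢end = sy≢o }

      o≤⇒∈X : ∀ {q} → f o ≤ f q → q ∈ ⟦ X ⟧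
      o≤⇒∈X o≤q = in⇐ X (inj₂ (t<o , inj₁ o≤q))

      ∈X⇒ : ∀ {q} → q ∈ ⟦ X ⟧ → f o ≤ f q ⊎ f q ≤ f t
      ∈X⇒ q∈ with in⇒ X q∈
      ... | inj₁ (o≤t , _) = ⊥-elim (<⇒≱ t<o o≤t)
      ... | inj₂ (_ , r)   = r

      x⊆X : ∀ q → q ∈ ⟦ A x ⟧ → q ∈ ⟦ X ⟧
      x⊆X q q∈x = in⇐ X (inj₂ (t<o , [ (λ s≤q → inj₁ (ℚₚ.≤-trans (ℚₚ.<⇒≤ o<s) s≤q)) , inj₂ ]′ (∈x⇒ {q} q∈x)))

      X⇒ : ∀ q → q ∈ ⟦ X ⟧ → f o ≤ f q ⊎ q ∈ ⟦ A x ⟧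
      X⇒ q q∈X = map₂ (λ q≤t → in⇐ (A x) {q} (inj₂ (t<s , inj₂ q≤t))) (∈X⇒ {q} q∈X)

      ≤o⇒∈Y : ∀ q → f q ≤ f o → q ∈ ⟦ Y ⟧
      ≤o⇒∈Y q = proj₁ (extend o sy≢o a<o o<p′) {q}
      Y⇒ : ∀ q → q ∈ ⟦ Y ⟧ → f q ≤ f o ⊎ q ∈ ⟦ A y ⟧
      Y⇒ q = proj₁ (proj₂ (extend o sy≢o a<o o<p′)) {q}
      y⊆Y : ∀ q → q ∈ ⟦ A y ⟧ → q ∈ ⟦ Y ⟧
      y⊆Y q = proj₂ (proj₂ (extend o sy≢o a<o o<p′)) {q}

      A′ : Fin n → Arc
      A′ z with z Finₚ.≟ x | z Finₚ.≟ y
      ... | yes _ | _     = X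
      ... | no _  | yes _ = Y
      ... | no _  | no _  = A z

      grows : ∀ z q → q ∈ ⟦ A z ⟧ → q ∈ ⟦ A′ z ⟧
      grows z q q∈ with z Finₚ.≟ x | z Finₚ.≟ y
      ... | yes refl | _        = x⊆X q q∈
      ... | no _     | yes refl = y⊆Y q q∈
      ... | no _     | no _     = q∈

      shrink : ∀ z q → q ∈ ⟦ A′ z ⟧ → q ∈ ⟦ A z ⟧ ⊎ (z ≡ x × f o ≤ f q) ⊎ (z ≡ y × f q ≤ f o)
      shrink z q q∈ with z Finₚ.≟ x | z Finₚ.≟ y
      ... | yes refl | _        = [ (λ o≤q → inj₂ (inj₁ (refl , o≤q))) , inj₁ ]′ (X⇒ q q∈)
      ... | no _     | yes refl = [ (λ q≤o → inj₂ (inj₂ (refl , q≤o))) , inj₁ ]′ (Y⇒ q q∈)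
      ... | no _     | no _     = inj₁ q∈

      adj-x : ∀ z q → z ≢ x → q ∈ ⟦ A z ⟧ → f o ≤ f q → Adj G z x
      adj-x z q z≢x q∈z o≤q = decidable-stable (adj? G z x) λ ¬adj →
        let Lz = z≢x , ¬adj in
        <⇒≱ (L<o {z} Lz) (ℚₚ.≤-trans o≤q (proj₂ (flat z (L∌c {z} Lz) q q∈z)))

      adj-y : ∀ z q → z ≢ y → q ∈ ⟦ A z ⟧ → f q ≤ f o → Adj G z y
      adj-y z q z≢y q∈z q≤o = decidable-stable (adj? G z y) λ ¬adj →
        let Uz = z≢y , ¬adj in
        <⇒≱ (o<U {z} Uz) (ℚₚ.≤-trans (proj₁ (flat z (U∌c {z} Uz) q q∈z)) q≤o)

      meets⇒adj′ : ∀ {u z} → u ≢ z → ⟦ A′ u ⟧ ≬ ⟦ A′ z ⟧ → Adj G u z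
      meets⇒adj′ {u} {z} u≢z (q , q∈u , q∈z) with shrink u q q∈u | shrink z q q∈z
      ... | inj₁ q∈u′ | inj₁ q∈z′ = meets⇒adj u≢z (q , q∈u′ , q∈z′)
      ... | inj₁ q∈u′ | inj₂ (inj₁ (refl , o≤q)) = adj-x u q u≢z q∈u′ o≤q
      ... | inj₁ q∈u′ | inj₂ (inj₂ (refl , q≤o)) = adj-y u q u≢z q∈u′ q≤o
      ... | inj₂ (inj₁ (refl , o≤q)) | inj₁ q∈z′ = symm G (adj-x z q (λ eq → u≢z (sym eq)) q∈z′ o≤q)
      ... | inj₂ (inj₂ (refl , q≤o)) | inj₁ q∈z′ = symm G (adj-y z q (λ eq → u≢z (sym eq)) q∈z′ q≤o)
      ... | inj₂ (inj₁ (refl , _)) | inj₂ (inj₁ (refl , _)) = ⊥-elim (u≢z refl)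
      ... | inj₂ (inj₁ (refl , _)) | inj₂ (inj₂ (refl , _)) = v-adj (λ eq → i′≢i (sym eq))
      ... | inj₂ (inj₂ (refl , _)) | inj₂ (inj₁ (refl , _)) = v-adj i′≢i
      ... | inj₂ (inj₂ (refl , _)) | inj₂ (inj₂ (refl , _)) = ⊥-elim (u≢z refl)

      A′x : A′ x ≡ X
      A′x with x Finₚ.≟ x | x Finₚ.≟ y
      ... | yes _  | _ = refl
      ... | no x≢x | _ = ⊥-elim (x≢x refl)

      A′y : A′ y ≡ Y
      A′y with y Finₚ.≟ x | y Finₚ.≟ y
      ... | yes y≡x | _      = ⊥-elim (x≢y (sym y≡x))
      ... | no _    | yes _  = refl
      ... | no _    | no y≢y = ⊥-elim (y≢y refl)

      improved : Improved M
      improved = record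
        { model = record
          { arc = A′
          ; adj⇔meets = λ {u} {z} u≢z → mk⇔
              (λ adj → let q , q∈u , q∈z = Equivalence.to (adj⇔meets M u≢z) adj in q , grows u q q∈u , grows z q q∈z)
              (meets⇒adj′ u≢z) }
        ; mono = λ {u} {z} cover q → [ (λ m → inj₁ (grows u q m)) , (λ m → inj₂ (grows z q m)) ]′ (cover q)
        ; x = x
        ; y = y
        ; old = λ cover → [ o∉x , o∉y ]′ (cover o)
        ; new = cover′
        }
        where
        o∉x : o ∉ ⟦ A x ⟧
        o∉x o∈x = [ <⇒≱ o<s , <⇒≱ t<o ]′ (∈x⇒ {o} o∈x)
        o∉y : o ∉ ⟦ A y ⟧
        o∉y o∈y = [ <⇒≱ a<o , (λ (p′<sy , sy≤o) → <⇒≱ (ℚₚ.<-trans o<p′ p′<sy) sy≤o) ]′ (∈y⇒ {o} o∈y)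
        cover′ : ∀ q → q ∈ ⟦ A′ x ⟧ ⊎ q ∈ ⟦ A′ y ⟧
        cover′ q with ℚₚ.≤-total (f o) (f q)
        ... | inj₁ o≤q = inj₁ (subst (λ B → q ∈ ⟦ B ⟧) (sym A′x) (o≤⇒∈X {q} o≤q))
        ... | inj₂ q≤o = inj₂ (subst (λ B → q ∈ ⟦ B ⟧) (sym A′y) (≤o⇒∈Y q q≤o))

    step-result : Witnesses G Q x y ⊎ Improved M
    step-result with separate L? U? (λ u → f (end (A u))) (λ z → f (start (A z))) a<s
                       (λ {u} → L-end {u}) (λ {z} → U-start {z})
    ... | inj₁ (r , a<r , r<s , L<r , r<U) =
            inj₂ (Extend.improved r a<r r<s (λ {u} → L<r {u}) (λ {z} → r<U {z}))
    ... | inj₂ (u , z , Lu , Uz , le) = inj₁ (found Lu Uz le)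

-- The part of the geometry that is still needed once the obstacle is found: a vertex whose arc
-- passes through `q` can miss only `v m` and `v (next m)`.
Segmented : ∀ {n} {G : Graph n} → ObstacleEnumerationIn G → CircularArcModel G → Set
Segmented 𝒬 M = ∀ q → ∃[ m ] (∀ {j} → j ≢ m → j ≢ next m → q ∈ ⟦ arc M (ObstacleEnumerationIn.v 𝒬 j) ⟧)

module _ {n} (G : Graph n) where

  frame⇒obstacle : (M : CircularArcModel G) → Frame G M →
    (Σ (ObstacleEnumerationIn G) λ 𝒬 → Segmented 𝒬 M) ⊎ Improved M
  frame⇒obstacle M F with all-or (λ i → FrameProperties.Step.step-result F i)
  ... | inj₂ improved = inj₂ improved
  ... | inj₁ W = inj₁ (record
        { k = k
        ; 3≤k = 3≤k
        ; enum = mk↣ v-inj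
        ; clique = λ { (i , refl) (j , refl) ne → v-adj (λ { refl → ne refl }) }
        ; W = W
        } , segment)
    where open FrameProperties F

  -- Each improvement makes a new pair of arcs cover the circle, so the set T of
  -- pairs known to do so grows.
  helly-or-obstacle : CircularArcModel G → HellyCircularArc G ⊎
    (Σ (ObstacleEnumerationIn G) λ 𝒬 → Σ (CircularArcModel G) (Segmented 𝒬))
  helly-or-obstacle M = go M (Subset.⊥ {n ℕ.* n}) (λ x y p → ⊥-elim (Subsetₚ.∉⊥ p)) (<-wellFounded _)
    where
    go : (M : CircularArcModel G) (T : Subset (n ℕ.* n)) →
      (∀ x y → Fin.combine x y Subset.∈ T → Covers M x y) → Acc ℕ._<_ ∣ ∁ T ∣ →
      HellyCircularArc G ⊎ (Σ (ObstacleEnumerationIn G) λ 𝒬 → Σ (CircularArcModel G) (Segmented 𝒬))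
    go M T cert (acc rs) with helly-or-frame G M
    ... | inj₁ helly = inj₁ (M , helly)
    ... | inj₂ F with frame⇒obstacle M F
    ...   | inj₁ (𝒬 , seg) = inj₂ (𝒬 , M , seg)
    ...   | inj₂ I = go model T′ cert′ (rs (Subsetₚ.p⊂q⇒∣p∣<∣q∣ (Subsetₚ.p⊂q⇒∁p⊃∁q T⊂T′)))
      where
      open Improved I
      T′ : Subset (n ℕ.* n)
      T′ = T ∪ˢ ⁅ Fin.combine x y ⁆
      T⊂T′ : T Subset.⊂ T′
      T⊂T′ = Subsetₚ.p⊆p∪q _ , Fin.combine x y
           , Subsetₚ.q⊆p∪q T _ (Subsetₚ.x∈⁅x⁆ _) , λ xy∈T → old (cert x y xy∈T)
      cert′ : ∀ x′ y′ → Fin.combine x′ y′ Subset.∈ T′ → Covers model x′ y′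
      cert′ x′ y′ p with Subsetₚ.x∈p∪q⁻ T _ p
      ... | inj₁ p∈T = mono (cert x′ y′ p∈T)
      ... | inj₂ p∈  with Finₚ.combine-injective x′ y′ x y (Subsetₚ.x∈⁅y⁆⇒x≡y _ p∈)
      ...   | refl , refl = new

-- Minimal forbidden graphs are essential obstacles

minimal⇒covering : ∀ {n} (G : Graph n) → MinimalForbiddenInducedSubgraph HellyCircularArc G →
  (𝒬 : ObstacleEnumerationIn G) → ObstacleEnumerationIn.Covering 𝒬
minimal⇒covering {suc n} G (_ , min) 𝒬 x with Finₚ.any? (λ i → v i Finₚ.≟ x) | Finₚ.any? (λ i → at? i x)
  where open Obstacle 𝒬
... | yes x∈Q | _            = inj₁ x∈Q
... | no _    | yes (i , at) = inj₂ (i , Obstacle.at⇒members 𝒬 at)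
-- Deleting `x` leaves the whole obstacle in a proper induced subgraph, which minimality makes
-- Helly.
... | no x∉Q  | no ¬at       = ⊥-elim (not-helly f covers (min f (x , λ u → Finₚ.punchInᵢ≢i x u)))
  where
  open Obstacle 𝒬
  f : Fin n ↣ Fin (suc n)
  f = mk↣ (λ {a} {b} → Finₚ.punchIn-injective x a b)
  covers : ∀ y → y ∈ Q ⊎ y ∈ Witness → ∃[ u ] Fin.punchIn x u ≡ y
  covers y y∈ = Fin.punchOut x≢y , Finₚ.punchIn-punchOut x≢y
    where
    x≢y : x ≢ y
    x≢y refl = [ x∉Q , (λ (i , x∈) → ¬at (i , members⇒at x∈)) ]′ y∈

module _ {n} {G : Graph n} (𝒬 : ObstacleEnumerationIn G) where
  open Obstacle 𝒬

  -- The edge `y₁y₂` qualifies as an enumeration of type `𝒪₂` at `m` and takes the place of `W m`.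
  module Replace (m : Fin k) {y₁ y₂ : Fin n}
                 (only₁ : Only y₁ m) (only₂ : Only y₂ (next m)) (y₁y₂ : Adj G y₁ y₂) where

    only⇒≐ : ∀ {y i} → Only y i → NonNeighbours G y ∩ Q ≐ ｛ v i ｝
    only⇒≐ (only , miss) = (λ { (nn , j , refl) → cong v (sym (only nn)) }) , λ { refl → miss , _ , refl }

    W′ : ∀ i → Witnesses G Q (v i) (v (next i))
    W′ i with i Finₚ.≟ m
    ... | yes refl = 𝒪₂ y₁ y₂ (only⇒≐ only₁) (only⇒≐ only₂) y₁y₂
    ... | no _     = W i

    𝒬′ : ObstacleEnumerationIn G
    𝒬′ = record { k = k ; 3≤k = 3≤k ; enum = enum ; clique = clique ; W = W′ }

    members′ : ∀ {i x} → x ∈ members (W′ i) → (x ≡ y₁ ⊎ x ≡ y₂) ⊎ (i ≢ m × At i x)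
    members′ {i} x∈ with i Finₚ.≟ m
    ... | yes refl = inj₁ ([ (λ e → inj₁ (sym e)) , (λ e → inj₂ (sym e)) ]′ x∈)
    ... | no i≢m   = inj₂ (i≢m , members⇒at x∈)

    module _ (covering′ : ObstacleEnumerationIn.Covering 𝒬′) where

      kept : ∀ {i x} → At i x → (x ≡ y₁ ⊎ x ≡ y₂) ⊎ (∃[ j ] (j ≢ m × At j x))
      kept {x = x} at with covering′ x
      ... | inj₁ x∈Q      = ⊥-elim (at⇒∉Q at x∈Q)
      ... | inj₂ (j , x∈) = map₂ (λ r → j , r) (members′ {j} x∈)

      m′≢m : next m ≢ m
      m′≢m = next≢ 2≤k m

      -- The old vertices at `m` must survive in the covering `𝒬′`, as `y₁`, as `y₂` or at another
      -- index. A witness of type `𝒪₁` cannot, as its missed pair determines its index. If `W m` is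
      -- `u, z` and `u` survives as second vertex at the predecessor of `m`, then `u` fills both
      -- places open to a witness missing just `v m`, and `y₁`, an old witness, occupies one of
      -- them. The same holds for `z` and `y₂`.
      kind-m : y₁ ∈ Witness → y₂ ∈ Witness → kind m ≡ inj₂ (y₁ , y₂)
      kind-m (i₁ , y₁∈) (i₂ , y₂∈) = go (kind m) refl
        where
        go : ∀ s → kind m ≡ s → kind m ≡ inj₂ (y₁ , y₂)
        go (inj₁ w) eq with kept (isW eq)
        ... | inj₁ (inj₁ refl) = ⊥-elim (only-not-pair only₁ (kind₁ eq))
        ... | inj₁ (inj₂ refl) = ⊥-elim (only-not-pair only₂ (kind₁ eq))
        ... | inj₂ (j , j≢m , isW e) = ⊥-elim (j≢m (pair-unique (kind₁ e) (kind₁ eq)))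
        ... | inj₂ (j , j≢m , isU e) = ⊥-elim (only-not-pair (proj₁ (kind₂ e)) (kind₁ eq))
        ... | inj₂ (j , j≢m , isZ e) = ⊥-elim (only-not-pair (proj₁ (proj₂ (kind₂ e))) (kind₁ eq))
        go (inj₂ (u , z)) eq = trans eq (cong₂ (λ a b → inj₂ (a , b)) u≡y₁ z≡y₂)
          where
          only-u : Only u m
          only-u = proj₁ (kind₂ eq)
          only-z : Only z (next m)
          only-z = proj₁ (proj₂ (kind₂ eq))
          u≡y₁ : u ≡ y₁
          u≡y₁ with kept (isU eq) | members⇒at {i₁} y₁∈
          ... | inj₁ (inj₁ e)    | _ = e
          ... | inj₁ (inj₂ refl) | _ = ⊥-elim (m′≢m (only-unique only₂ only-u))
          ... | inj₂ (j , j≢m , isW e) | _ = ⊥-elim (only-not-pair only-u (kind₁ e))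
          ... | inj₂ (j , j≢m , isU e) | _ = ⊥-elim (j≢m (only-unique (proj₁ (kind₂ e)) only-u))
          ... | inj₂ (j , j≢m , isZ e) | isW e₁ = ⊥-elim (only-not-pair only₁ (kind₁ e₁))
          ... | inj₂ (j , j≢m , isZ e) | isU e₁ with refl ← only-unique only₁ (proj₁ (kind₂ e₁)) with refl ← trans (sym eq) e₁ = refl
          ... | inj₂ (j , j≢m , isZ e) | isZ e₁
            with refl ← next-injective (trans (only-unique (proj₁ (proj₂ (kind₂ e₁))) only₁)
                                              (only-unique only-u (proj₁ (proj₂ (kind₂ e)))))
            with refl ← trans (sym e) e₁ = refl
          z≡y₂ : z ≡ y₂
          z≡y₂ with kept (isZ eq) | members⇒at {i₂} y₂∈
          ... | inj₁ (inj₂ e)    | _ = e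
          ... | inj₁ (inj₁ refl) | _ = ⊥-elim (m′≢m (only-unique only-z only₁))
          ... | inj₂ (j , j≢m , isW e) | _ = ⊥-elim (only-not-pair only-z (kind₁ e))
          ... | inj₂ (j , j≢m , isZ e) | _ = ⊥-elim (j≢m (next-injective (only-unique (proj₁ (proj₂ (kind₂ e))) only-z)))
          ... | inj₂ (j , j≢m , isU e) | isW e₁ = ⊥-elim (only-not-pair only₂ (kind₁ e₁))
          ... | inj₂ (j , j≢m , isU e) | isZ e₁ with refl ← next-injective (only-unique only₂ (proj₁ (proj₂ (kind₂ e₁)))) with refl ← trans (sym eq) e₁ = refl
          ... | inj₂ (j , j≢m , isU e) | isU e₁
            with refl ← trans (only-unique (proj₁ (kind₂ e₁)) only₂) (only-unique only-z (proj₁ (kind₂ e)))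
            with refl ← trans (sym e) e₁ = refl

  module _ (M : CircularArcModel G) (segmented : Segmented 𝒬 M)
           (min : MinimalForbiddenInducedSubgraph HellyCircularArc G) where

    -- Two nonempty subsets of one consecutive pair are nested unless they are its two different
    -- singletons. In that case the edge could replace `W m`, and `kind-m` shows that it already is
    -- `W m`.
    segmented⇒essential : Essential
    segmented⇒essential {y₁} {y₂} y₁∈@(i₁ , p₁) y₂∈@(i₂ , p₂) y₁y₂ = result
      where
      meet : ⟦ arc M y₁ ⟧ ≬ ⟦ arc M y₂ ⟧
      meet = Equivalence.to (adj⇔meets M (λ eq → irrefl G eq y₁y₂)) y₁y₂
      q : Point
      q = proj₁ meet
      m m′ : Fin k
      m = proj₁ (segmented q)
      m′ = next m
      in-segment : ∀ {y j} → q ∈ ⟦ arc M y ⟧ → Miss y j → j ≡ m ⊎ j ≡ m′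
      in-segment {y} {j} q∈y (ne , ¬adj) with j Finₚ.≟ m | j Finₚ.≟ m′
      ... | yes e | _     = inj₁ e
      ... | no _  | yes e = inj₂ e
      ... | no a  | no b  = ⊥-elim (¬adj (Equivalence.from (adj⇔meets M (λ eq → ne (sym eq)))
                              (q , q∈y , proj₂ (segmented q) a b)))
      in₁ : ∀ {j} → Miss y₁ j → j ≡ m ⊎ j ≡ m′
      in₁ = in-segment (proj₁ (proj₂ meet))
      in₂ : ∀ {j} → Miss y₂ j → j ≡ m ⊎ j ≡ m′
      in₂ = in-segment (proj₂ (proj₂ meet))
      subset-of : ∀ {y y′} → (∀ {j} → Miss y j → Miss y′ j) → NonNeighbours G y ∩ Q ⊆ NonNeighbours G y′ ∩ Q
      subset-of sub (nn , j , refl) = sub nn , j , refl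
      only : ∀ {y a b} → (∀ {j} → Miss y j → j ≡ a ⊎ j ≡ b) → Miss y a → ¬ Miss y b → Only y a
      only sub miss ¬miss = (λ p → [ (λ e → e) , (λ { refl → ⊥-elim (¬miss p) }) ]′ (sub p)) , miss
      swap⊎ : ∀ {A B : Set} → A ⊎ B → B ⊎ A
      swap⊎ = [ inj₂ , inj₁ ]′
      same : ∀ {y y′ a} → Only y a → Only y′ a → ∀ {j} → Miss y j → Miss y′ j
      same (sub , _) (_ , miss) p with refl ← sub p = miss
      together : ∀ {a b} → kind m ≡ inj₂ (a , b) → a ∈ members (W m) × b ∈ members (W m)
      together eq = at⇒members (isU eq) , at⇒members (isZ eq)
      result : Valid y₁ y₂
      result with miss? y₁ m | miss? y₁ m′ | miss? y₂ m | miss? y₂ m′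
      ... | yes a | yes b | _ | _ = inj₂ (inj₁ (subset-of λ p → [ (λ { refl → a }) , (λ { refl → b }) ]′ (in₂ p)))
      ... | _ | _ | yes a | yes b = inj₁ (subset-of λ p → [ (λ { refl → a }) , (λ { refl → b }) ]′ (in₁ p))
      ... | yes a | no b | yes c | no d = inj₁ (subset-of (same (only in₁ a b) (only in₂ c d)))
      ... | no a | yes b | no c | yes d = inj₁ (subset-of (same (only (λ p → swap⊎ (in₁ p)) b a) (only (λ p → swap⊎ (in₂ p)) d c)))
      ... | yes a | no b | no c | yes d = inj₂ (inj₂ (m , together
              (kind-m (minimal⇒covering G min 𝒬′) y₁∈ y₂∈)))
        where open Replace m (only in₁ a b) (only (λ p → swap⊎ (in₂ p)) d c) y₁y₂
      ... | no a | yes b | yes c | no d = inj₂ (inj₂ (m , Data.Product.swap (together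
              (kind-m (minimal⇒covering G min 𝒬′) y₂∈ y₁∈))))
        where open Replace m (only in₂ c d) (only (λ p → swap⊎ (in₁ p)) b a) (symm G y₁y₂)
      ... | no a | no b | _ | _ = ⊥-elim (let _ , _ , p = at-misses (members⇒at {i₁} p₁) in
              [ (λ e → a (subst (Miss y₁) e p)) , (λ e → b (subst (Miss y₁) e p)) ]′ (in₁ p))
      ... | _ | _ | no c | no d = ⊥-elim (let _ , _ , p = at-misses (members⇒at {i₂} p₂) in
              [ (λ e → c (subst (Miss y₂) e p)) , (λ e → d (subst (Miss y₂) e p)) ]′ (in₂ p))

minimal⇒essential : ∀ {n} (G : Graph n) → CircularArc G →
  MinimalForbiddenInducedSubgraph HellyCircularArc G → EssentialObstacle G
minimal⇒essential G M min with helly-or-obstacle G M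
... | inj₁ helly = ⊥-elim (proj₁ min helly)
... | inj₂ (𝒬 , M′ , segmented) = (𝒬 , minimal⇒covering G min 𝒬) , segmented⇒essential 𝒬 M′ segmented min

-- A circular-arc model of an essential obstacle

n-coprime-1+n : ∀ m → Coprime m (suc m)
n-coprime-1+n m {d} (d∣m , d∣1+m) =
  ℕ.∣1⇒≡1 (ℕ.∣m+n∣m⇒∣n (subst (d ℕ.∣_) (ℕₚ.+-comm 1 m) d∣1+m) d∣m)

-- The embedding m ↦ m / (m + 1) of ℕ into [0,1).
grid : ℕ → Point
grid m = record
  { pos   = ℚ.mkℚ (ℤ.+ m) m (n-coprime-1+n m)
  ; 0≤pos = ℚ.*≤* (subst (ℤ._≤ ℤ.+ m ℤ.* ℤ.+ 1) (sym (ℤₚ.*-zeroˡ (ℤ.+ suc m)))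
              (subst (ℤ.+ 0 ℤ.≤_) (sym (ℤₚ.*-identityʳ (ℤ.+ m))) (ℤ.+≤+ z≤n)))
  ; pos<1 = ℚ.*<* (subst₂ ℤ._<_ (sym (ℤₚ.*-identityʳ (ℤ.+ m))) (sym (ℤₚ.*-identityˡ (ℤ.+ suc m)))
              (ℤ.+<+ (ℕₚ.n<1+n m)))
  }

grid-mono : ∀ {a b} → a ℕ.< b → pos (grid a) < pos (grid b)
grid-mono {a} {b} a<b = ℚ.*<* (subst₂ ℤ._<_ (ℤₚ.pos-* a (suc b)) (ℤₚ.pos-* b (suc a)) (ℤ.+<+ lt))
  where
  lt : a ℕ.* suc b ℕ.< b ℕ.* suc a
  lt = subst₂ ℕ._<_ (sym (ℕₚ.*-suc a b)) (trans (cong (b ℕ.+_) (ℕₚ.*-comm a b)) (sym (ℕₚ.*-suc b a)))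
         (ℕₚ.+-monoˡ-< (a ℕ.* b) a<b)

grid-cyc : ∀ {a b c} → a ℕ.< b → b ℕ.< c → Cyc (pos (grid a)) (pos (grid b)) (pos (grid c))
grid-cyc a<b b<c = inj₁ (grid-mono a<b , grid-mono b<c)

-- The circle is divided into k blocks of six positions; an offset below 12
-- relative to i addresses block i followed by block next i.
module Blocks {k} (3≤k : 3 ℕ.≤ k) where

  2≤k : 2 ℕ.≤ k
  2≤k = ℕₚ.<⇒≤ 3≤k

  code : Fin k → ℕ → ℕ
  code j r = toℕ j ℕ.* 6 ℕ.+ r

  place : Fin k → ℕ → Point
  place j r = grid (code j r)

  code-< : ∀ {i j r s} → toℕ i ℕ.< toℕ j → r ℕ.< 6 → code i r ℕ.< code j s
  code-< {i} {j} {r} {s} i<j r<6 = ℕₚ.<-≤-trans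
    (ℕₚ.+-monoʳ-< (toℕ i ℕ.* 6) r<6)
    (ℕₚ.≤-trans (subst (ℕ._≤ toℕ j ℕ.* 6) (ℕₚ.+-comm 6 (toℕ i ℕ.* 6)) (ℕₚ.*-monoˡ-≤ 6 i<j))
                (ℕₚ.m≤m+n (toℕ j ℕ.* 6) s))

  offset : Fin k → ℕ → Point
  offset i (suc (suc (suc (suc (suc (suc r)))))) = place (next i) r
  offset i r = place i r

  data Split : ℕ → Set where
    low  : ∀ {r} → r ℕ.< 6 → Split r
    high : ∀ r → Split (6 ℕ.+ r)

  split : ∀ r → Split r
  split 0 = low (s≤s z≤n)
  split 1 = low (s≤s (s≤s z≤n))
  split 2 = low (s≤s (s≤s (s≤s z≤n)))
  split 3 = low (s≤s (s≤s (s≤s (s≤s z≤n))))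
  split 4 = low (s≤s (s≤s (s≤s (s≤s (s≤s z≤n)))))
  split 5 = low (s≤s (s≤s (s≤s (s≤s (s≤s (s≤s z≤n))))))
  split (suc (suc (suc (suc (suc (suc r)))))) = high r

  offset-low : ∀ i {r} → r ℕ.< 6 → offset i r ≡ place i r
  offset-low i {0} _ = refl
  offset-low i {1} _ = refl
  offset-low i {2} _ = refl
  offset-low i {3} _ = refl
  offset-low i {4} _ = refl
  offset-low i {5} _ = refl
  offset-low i {suc (suc (suc (suc (suc (suc r)))))} (s≤s (s≤s (s≤s (s≤s (s≤s (s≤s ()))))))

  private
    <⁶ : ∀ {r} → 6 ℕ.+ r ℕ.< 12 → r ℕ.< 6
    <⁶ = ℕₚ.+-cancelˡ-< 6 _ _

    high≮low : ∀ {r s} → s ℕ.< 6 → ¬ (6 ℕ.+ r ℕ.< s)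
    high≮low s<6 lt = ℕₚ.<⇒≱ s<6 (ℕₚ.≤-trans (ℕₚ.m≤m+n 6 _) (ℕₚ.<⇒≤ lt))

    step-< : ∀ {i r s} → toℕ (next i) ≡ suc (toℕ i) → r ℕ.< 6 → code i r ℕ.< code (next i) s
    step-< {i} e r<6 = code-< {i} {next i} (subst (toℕ i ℕ.<_) (sym e) (ℕₚ.n<1+n (toℕ i))) r<6

    wrap-< : ∀ {i r s} → toℕ (next i) ≡ 0 → r ℕ.< 6 → code (next i) r ℕ.< code i s
    wrap-< {i} e r<6 = code-< {next i} {i} (ℕₚ.≤∧≢⇒< (subst (ℕ._≤ toℕ i) (sym e) z≤n)
      (λ eq → next≢ 2≤k i (Finₚ.toℕ-injective eq))) r<6

  offset-cyc : ∀ i {a b c} → a ℕ.< b → b ℕ.< c → c ℕ.< 12 →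
    Cyc (pos (offset i a)) (pos (offset i b)) (pos (offset i c))
  offset-cyc i {a} {b} {c} a<b b<c c<12 with split a | split b | split c
  ... | low p | low q | low r
    rewrite offset-low i p | offset-low i q | offset-low i r =
    grid-cyc (ℕₚ.+-monoʳ-< _ a<b) (ℕₚ.+-monoʳ-< _ b<c)
  ... | low p | low q | high c′ rewrite offset-low i p | offset-low i q with nextView i
  ...   | step e   = grid-cyc (ℕₚ.+-monoʳ-< _ a<b) (step-< e q)
  ...   | wrap _ e = rotate (grid-cyc (wrap-< e (<⁶ c<12)) (ℕₚ.+-monoʳ-< _ a<b))
  offset-cyc i a<b b<c c<12 | low p | high b′ | high c′ rewrite offset-low i p with nextView i
  ...   | step e   = grid-cyc (step-< e p) (ℕₚ.+-monoʳ-< _ (ℕₚ.+-cancelˡ-< 6 _ _ b<c))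
  ...   | wrap _ e = rotate (rotate (grid-cyc (ℕₚ.+-monoʳ-< _ (ℕₚ.+-cancelˡ-< 6 _ _ b<c)) (wrap-< e (<⁶ c<12))))
  offset-cyc i a<b b<c c<12 | high a′ | high b′ | high c′ =
    grid-cyc (ℕₚ.+-monoʳ-< _ (ℕₚ.+-cancelˡ-< 6 _ _ a<b)) (ℕₚ.+-monoʳ-< _ (ℕₚ.+-cancelˡ-< 6 _ _ b<c))
  offset-cyc i a<b b<c c<12 | high _ | low q | _ = ⊥-elim (high≮low q a<b)
  offset-cyc i a<b b<c c<12 | _ | high _ | low r = ⊥-elim (high≮low r b<c)

  outside-cyc : ∀ i {a b j r} → a ℕ.< b → b ℕ.< 12 → j ≢ i → j ≢ next i → r ℕ.< 6 →
    Cyc (pos (offset i a)) (pos (offset i b)) (pos (place j r))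
  outside-cyc i {a} {b} {j} {r} a<b b<12 j≢i j≢i′ r<6 with ℕₚ.<-cmp (toℕ j) (toℕ i) | split a | split b | nextView i
  ... | tri≈ _ e _ | _ | _ | _ = ⊥-elim (j≢i (Finₚ.toℕ-injective e))
  ... | _ | high _ | low q | _ = ⊥-elim (high≮low q a<b)
  ... | tri< j<i _ _ | low p | low q | _ rewrite offset-low i p | offset-low i q =
    rotate (grid-cyc (code-< j<i r<6) (ℕₚ.+-monoʳ-< _ a<b))
  ... | tri> _ _ i<j | low p | low q | _ rewrite offset-low i p | offset-low i q =
    grid-cyc (ℕₚ.+-monoʳ-< _ a<b) (code-< i<j q)
  ... | tri< j<i _ _ | low p | high b′ | step e rewrite offset-low i p =
    rotate (grid-cyc (code-< j<i r<6) (step-< e p))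
  ... | tri< j<i _ _ | low p | high b′ | wrap _ e rewrite offset-low i p =
    rotate (rotate (grid-cyc (code-< {next i} (0<j e) (<⁶ b<12)) (code-< j<i r<6)))
    where
    0<j : toℕ (next i) ≡ 0 → toℕ (next i) ℕ.< toℕ j
    0<j e = ℕₚ.≤∧≢⇒< (subst (ℕ._≤ toℕ j) (sym e) z≤n) (λ eq → j≢i′ (Finₚ.toℕ-injective (sym eq)))
  ... | tri> _ _ i<j | low p | high b′ | step e rewrite offset-low i p =
    grid-cyc (step-< e p) (code-< {next i} (ℕₚ.≤∧≢⇒< (subst (ℕ._≤ toℕ j) (sym e) i<j)
      (λ eq → j≢i′ (Finₚ.toℕ-injective (sym eq)))) (<⁶ b<12))
  ... | tri> _ _ i<j | low p | high b′ | wrap l _ =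
    ⊥-elim (ℕₚ.<⇒≱ (Finₚ.toℕ<n j) (subst (ℕ._≤ toℕ j) l i<j))
  ... | tri< j<i _ _ | high a′ | high b′ | step e =
    rotate (grid-cyc (code-< {j} {next i} (subst (toℕ j ℕ.<_) (sym e) (ℕₚ.m<n⇒m<1+n j<i)) r<6) (ℕₚ.+-monoʳ-< _ (ℕₚ.+-cancelˡ-< 6 _ _ a<b)))
  ... | tri< j<i _ _ | high a′ | high b′ | wrap _ e =
    grid-cyc (ℕₚ.+-monoʳ-< _ (ℕₚ.+-cancelˡ-< 6 _ _ a<b)) (code-< {next i} (ℕₚ.≤∧≢⇒< (subst (ℕ._≤ toℕ j) (sym e) z≤n) (λ eq → j≢i′ (Finₚ.toℕ-injective (sym eq)))) (<⁶ b<12))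
  ... | tri> _ _ i<j | high a′ | high b′ | step e =
    grid-cyc (ℕₚ.+-monoʳ-< _ (ℕₚ.+-cancelˡ-< 6 _ _ a<b))
      (code-< {next i} (ℕₚ.≤∧≢⇒< (subst (ℕ._≤ toℕ j) (sym e) i<j) (λ eq → j≢i′ (Finₚ.toℕ-injective (sym eq)))) (<⁶ b<12))
  ... | tri> _ _ i<j | high a′ | high b′ | wrap l _ =
    ⊥-elim (ℕₚ.<⇒≱ (Finₚ.toℕ<n j) (subst (ℕ._≤ toℕ j) l i<j))

  data Relative (i : Fin k) (j : Fin k) (r : ℕ) : Set where
    here    : ∀ c → c ℕ.< 12 → offset i c ≡ place j r → (j ≡ i × c ≡ r) ⊎ (j ≡ next i × c ≡ 6 ℕ.+ r) → Relative i j r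
    outside : j ≢ i → j ≢ next i → Relative i j r

  relative : ∀ i j {r} → r ℕ.< 6 → Relative i j r
  relative i j {r} r<6 with j Finₚ.≟ i | j Finₚ.≟ next i
  ... | yes refl | _        = here r (ℕₚ.<-trans r<6 (s≤s (s≤s (s≤s (s≤s (s≤s (s≤s (s≤s z≤n)))))))) (offset-low i r<6) (inj₁ (refl , refl))
  ... | no _     | yes refl = here (6 ℕ.+ r) (ℕₚ.+-monoʳ-< 6 r<6) refl (inj₂ (refl , refl))
  ... | no a     | no b     = outside a b

  module _ (i : Fin k) {a b : ℕ} (a<b : a ℕ.< b) (b<12 : b ℕ.< 12) where

    offset-≢ : pos (offset i a) ≢ pos (offset i b)
    offset-≢ = cyc-irrefl₁₂ (outside-cyc i {j = next (next i)} {r = 0} a<b b<12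
      (next²≢ 3≤k i) (next≢ 2≤k (next i)) (s≤s z≤n))

    short long : Arc
    short = record { start = offset i a ; end = offset i b ; start≢end = offset-≢ }
    long  = record { start = offset i b ; end = offset i a ; start≢end = λ e → offset-≢ (sym e) }

    Inside Strictly : Fin k → ℕ → Set
    Inside j r   = (j ≡ i × a ℕ.≤ r × r ℕ.≤ b) ⊎ (j ≡ next i × a ℕ.≤ 6 ℕ.+ r × 6 ℕ.+ r ℕ.≤ b)
    Strictly j r = (j ≡ i × a ℕ.< r × r ℕ.< b) ⊎ (j ≡ next i × a ℕ.< 6 ℕ.+ r × 6 ℕ.+ r ℕ.< b)

    private
      mid-cyc : ∀ {c} → a ℕ.< c → c ℕ.< b → Cyc (pos (offset i a)) (pos (offset i c)) (pos (offset i b))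
      mid-cyc a<c c<b = offset-cyc i a<c c<b b<12

      before-cyc : ∀ {c} → c ℕ.< a → Cyc (pos (offset i b)) (pos (offset i c)) (pos (offset i a))
      before-cyc c<a = rotate (rotate (offset-cyc i c<a a<b b<12))

      after-cyc : ∀ {c} → b ℕ.< c → c ℕ.< 12 → Cyc (pos (offset i b)) (pos (offset i c)) (pos (offset i a))
      after-cyc b<c c<12 = rotate (offset-cyc i a<b b<c c<12)

    ∈short⇒ : ∀ {j r} → r ℕ.< 6 → place j r ∈ ⟦ short ⟧ → Inside j r
    ∈short⇒ {j} {r} r<6 p∈ with relative i j r<6
    ... | outside p q = ⊥-elim (cyc⇒∉ pos short (place j r) (rotate (outside-cyc i a<b b<12 p q r<6)) p∈)
    ... | here c c<12 eq w with a ℕₚ.≤? c | c ℕₚ.≤? b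
    ...   | no a≰c | _ = ⊥-elim (cyc⇒∉ pos short (place j r)
              (subst (λ x → Cyc _ (pos x) _) eq (before-cyc (ℕₚ.≰⇒> a≰c))) p∈)
    ...   | _ | no c≰b = ⊥-elim (cyc⇒∉ pos short (place j r)
              (subst (λ x → Cyc _ (pos x) _) eq (after-cyc (ℕₚ.≰⇒> c≰b) c<12)) p∈)
    ...   | yes a≤c | yes c≤b with w
    ...     | inj₁ (refl , refl) = inj₁ (refl , a≤c , c≤b)
    ...     | inj₂ (refl , refl) = inj₂ (refl , a≤c , c≤b)

    private
      offset∈short : ∀ c → a ℕ.≤ c → c ℕ.≤ b → offset i c ∈ ⟦ short ⟧
      offset∈short c a≤c c≤b with offset i c ∈? short
      ... | yes p = p
      ... | no ¬p with ∉⇒cyc pos short (start≢end short) (offset i c) ¬p | a ℕₚ.≟ c | c ℕₚ.≟ b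
      ...   | cyc | yes refl | _        = ⊥-elim (cyc-irrefl₁₂ (rotate cyc) refl)
      ...   | cyc | no _     | yes refl = ⊥-elim (cyc-irrefl₁₂ cyc refl)
      ...   | cyc | no a≢c   | no c≢b   = ⊥-elim (cyc-asym cyc
                (rotate (rotate (mid-cyc (ℕₚ.≤∧≢⇒< a≤c a≢c) (ℕₚ.≤∧≢⇒< c≤b c≢b)))))

      offset∉long : ∀ c → a ℕ.< c → c ℕ.< b → offset i c ∉ ⟦ long ⟧
      offset∉long c a<c c<b = cyc⇒∉ pos long (offset i c) (mid-cyc a<c c<b)

    ∈short⇐ : ∀ {j r} → r ℕ.< 6 → Inside j r → place j r ∈ ⟦ short ⟧
    ∈short⇐ {j} {r} r<6 (inj₁ (refl , p , q)) = subst (_∈ ⟦ short ⟧) (offset-low i r<6) (offset∈short r p q)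
    ∈short⇐ {j} {r} r<6 (inj₂ (refl , p , q)) = offset∈short (6 ℕ.+ r) p q

    ∈long⇒ : ∀ {j r} → r ℕ.< 6 → place j r ∈ ⟦ long ⟧ → ¬ Strictly j r
    ∈long⇒ {j} {r} r<6 p∈ (inj₁ (refl , p , q)) =
      offset∉long r p q (subst (_∈ ⟦ long ⟧) (sym (offset-low i r<6)) p∈)
    ∈long⇒ {j} {r} r<6 p∈ (inj₂ (refl , p , q)) = offset∉long (6 ℕ.+ r) p q p∈

    ∈long⇐ : ∀ {j r} → r ℕ.< 6 → ¬ Strictly j r → place j r ∈ ⟦ long ⟧
    ∈long⇐ {j} {r} r<6 ¬strict with place j r ∈? long
    ... | yes p = p
    ... | no ¬p with ∉⇒cyc pos long (start≢end long) (place j r) ¬p | relative i j r<6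
    ...   | cyc | outside p q = ⊥-elim (cyc-asym cyc (outside-cyc i a<b b<12 p q r<6))
    ...   | cyc | here c c<12 eq w with ℕₚ.<-cmp a c | ℕₚ.<-cmp c b
    ...     | tri≈ _ refl _ | _ = ⊥-elim (cyc-irrefl₁₂ cyc (cong pos eq))
    ...     | _ | tri≈ _ refl _ = ⊥-elim (cyc-irrefl₁₂ (rotate cyc) (cong pos (sym eq)))
    ...     | tri> _ _ c<a | _ = ⊥-elim (cyc-asym cyc
                (rotate (rotate (subst (λ x → Cyc _ (pos x) _) eq (before-cyc c<a)))))
    ...     | _ | tri> _ _ b<c = ⊥-elim (cyc-asym cyc
                (rotate (rotate (subst (λ x → Cyc _ (pos x) _) eq (after-cyc b<c c<12)))))
    ...     | tri< a<c _ _ | tri< c<b _ _ with w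
    ...       | inj₁ (refl , refl) = ⊥-elim (¬strict (inj₁ (refl , a<c , c<b)))
    ...       | inj₂ (refl , refl) = ⊥-elim (¬strict (inj₂ (refl , a<c , c<b)))

-- For literals the implicit argument computes to the unit type and is filled in, so concrete
-- inequalities are settled by evaluation.
≤! : ∀ {a b} {_ : T (a ℕ.≤ᵇ b)} → a ℕ.≤ b
≤! {a} {b} {p} = ℕₚ.≤ᵇ⇒≤ a b p

≰! : ∀ {A : Set} {a b} → a ℕ.≤ b → {_ : T (b ℕ.<ᵇ a)} → A
≰! {a = a} {b} p {q} = ⊥-elim (ℕₚ.<⇒≱ (ℕₚ.<ᵇ⇒< b a q) p)

-- Adjacencies between the witnesses of an essential obstacle

module Structure {n} {G : Graph n} (𝒬 : ObstacleEnumerationIn G)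
                 (essential : ObstacleEnumerationIn.Essential 𝒬) where
  open Obstacle 𝒬

  -- Witnesses of type `𝒪₂` are sorted by the vertex `v i` that they miss rather than by
  -- enumeration: such a witness is the first vertex at `i`, the second at the predecessor of `i`,
  -- or both.
  data B (x : Fin n) (i : Fin k) : Set where
    asU : ∀ {z} → kind i ≡ inj₂ (x , z) → B x i
    asZ : ∀ {p u} → kind p ≡ inj₂ (u , x) → next p ≡ i → B x i

  data Wit (x : Fin n) : Set where
    isD : ∀ i → kind i ≡ inj₁ x → Wit x
    isB : ∀ i → B x i → Wit x

  at⇒wit : ∀ {i x} → At i x → Wit x
  at⇒wit {i} (isW eq) = isD i eq
  at⇒wit {i} (isU eq) = isB i (asU eq)
  at⇒wit {i} (isZ eq) = isB (next i) (asZ eq refl)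

  wit⇒witness : ∀ {x} → Wit x → x ∈ Witness
  wit⇒witness (isD i eq)            = i , at⇒members (isW eq)
  wit⇒witness (isB i (asU eq))      = i , at⇒members (isU eq)
  wit⇒witness (isB _ (asZ {p} eq _)) = p , at⇒members (isZ eq)

  wit⇒∉Q : ∀ {x} → Wit x → x ∉ Q
  wit⇒∉Q w = let _ , x∈ = wit⇒witness w in at⇒∉Q (members⇒at x∈)

  B-only : ∀ {x i} → B x i → Only x i
  B-only (asU eq)      = proj₁ (kind₂ eq)
  B-only (asZ eq refl) = proj₁ (proj₂ (kind₂ eq))

  -- The only places for an edge, up to its direction: nested missed sets give `left`, `right` and
  -- `inner`, a common enumeration gives `outer`.
  data Edge (x y : Fin n) : Set where
    left  : ∀ {i} → kind i ≡ inj₁ x → B y i → Edge x y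
    right : ∀ {i} → kind i ≡ inj₁ x → B y (next i) → Edge x y
    inner : ∀ {i u z} → kind i ≡ inj₂ (u , x) → kind (next i) ≡ inj₂ (y , z) → Edge x y
    outer : ∀ {i} → kind i ≡ inj₂ (x , y) → Edge x y

  inner-edge : ∀ {x y i} → x ≢ y → B x i → B y i → Edge x y ⊎ Edge y x
  inner-edge x≢y (asU e) (asU e′)         = ⊥-elim (x≢y (sameᵘ e e′))
  inner-edge x≢y (asU e) (asZ e′ refl)    = inj₂ (inner e′ e)
  inner-edge x≢y (asZ e refl) (asU e′)    = inj₁ (inner e e′)
  inner-edge x≢y (asZ e refl) (asZ e′ f) with refl ← next-injective f = ⊥-elim (x≢y (sameᶻ e e′))

  D-B-edge : ∀ {x y i j} → kind i ≡ inj₁ x → B y j → (j ≡ i ⊎ j ≡ next i) → Edge x y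
  D-B-edge eq b (inj₁ refl) = left eq b
  D-B-edge eq b (inj₂ refl) = right eq b

  sub-miss : ∀ {x y} → NonNeighbours G x ∩ Q ⊆ NonNeighbours G y ∩ Q → ∀ {j} → Miss x j → Miss y j
  sub-miss sub miss = proj₁ (sub (miss , _ , refl))

  -- Two witnesses of type `𝒪₁` with nested missed pairs have the same index by `pair-⊆` and hence
  -- coincide, so no edge joins two of them. For the other combinations the nesting pins down the
  -- indices.
  edge : ∀ {x y} → Wit x → Wit y → Adj G x y → Edge x y ⊎ Edge y x
  edge {x} {y} wx wy xy = go wx wy (essential (wit⇒witness wx) (wit⇒witness wy) xy)
    where
    x≢y : x ≢ y
    x≢y eq = irrefl G eq xy
    D-B : ∀ {x y i j} → kind i ≡ inj₁ x → B y j → Valid x y → Edge x y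
    D-B eq b (inj₁ sub) with kind₁ eq
    ... | _ , p , q = ⊥-elim (only-not-pair (B-only b)
            ((λ m → inj₁ (trans (proj₁ (B-only b) m) (sym (proj₁ (B-only b) (sub-miss sub p))))) , sub-miss sub p , sub-miss sub q))
    D-B eq b (inj₂ (inj₁ sub)) = D-B-edge eq b (proj₁ (kind₁ eq) (sub-miss sub (proj₂ (B-only b))))
    D-B eq b (inj₂ (inj₂ (l , x∈ , y∈))) with members⇒at {l} x∈ | members⇒at {l} y∈
    ... | isU e | _     = ⊥-elim (only-not-pair (proj₁ (kind₂ e)) (kind₁ eq))
    ... | isZ e | _     = ⊥-elim (only-not-pair (proj₁ (proj₂ (kind₂ e))) (kind₁ eq))
    ... | isW e | isU f = ⊥-elim (inj₁≢inj₂ e f)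
    ... | isW e | isZ f = ⊥-elim (inj₁≢inj₂ e f)
    ... | isW e | isW f = ⊥-elim (only-not-pair (B-only b) (kind₁ f))
    flip-valid : Valid x y → Valid y x
    flip-valid (inj₁ a)                    = inj₂ (inj₁ a)
    flip-valid (inj₂ (inj₁ a))             = inj₁ a
    flip-valid (inj₂ (inj₂ (l , p , q)))   = inj₂ (inj₂ (l , q , p))
    go : Wit x → Wit y → Valid x y → Edge x y ⊎ Edge y x
    go (isD i e) (isB j b) val = inj₁ (D-B e b val)
    go (isB i b) (isD j e) val = inj₂ (D-B e b (flip-valid val))
    go (isD i e) (isD j f) (inj₁ sub) = ⊥-elim (x≢y (same₁ e (subst (λ l → kind l ≡ inj₁ y)
      (sym (pair-⊆ (proj₁ (kind₁ f) (sub-miss sub (proj₁ (proj₂ (kind₁ e)))))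
                   (proj₁ (kind₁ f) (sub-miss sub (proj₂ (proj₂ (kind₁ e))))))) f)))
    go (isD i e) (isD j f) (inj₂ (inj₁ sub)) = ⊥-elim (x≢y (same₁ e (subst (λ l → kind l ≡ inj₁ y)
      (pair-⊆ (proj₁ (kind₁ e) (sub-miss sub (proj₁ (proj₂ (kind₁ f)))))
              (proj₁ (kind₁ e) (sub-miss sub (proj₂ (proj₂ (kind₁ f)))))) f)))
    go (isD i e) (isD j f) (inj₂ (inj₂ (l , x∈ , y∈))) with members⇒at {l} x∈ | members⇒at {l} y∈
    ... | isW p | isW q = ⊥-elim (x≢y (same₁ p q))
    ... | isU p | _     = ⊥-elim (only-not-pair (proj₁ (kind₂ p)) (kind₁ e))
    ... | isZ p | _     = ⊥-elim (only-not-pair (proj₁ (proj₂ (kind₂ p))) (kind₁ e))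
    ... | _     | isU p = ⊥-elim (only-not-pair (proj₁ (kind₂ p)) (kind₁ f))
    ... | _     | isZ p = ⊥-elim (only-not-pair (proj₁ (proj₂ (kind₂ p))) (kind₁ f))
    go (isB i b) (isB j c) (inj₁ sub) with refl ← proj₁ (B-only c) (sub-miss sub (proj₂ (B-only b))) = inner-edge x≢y b c
    go (isB i b) (isB j c) (inj₂ (inj₁ sub)) with refl ← proj₁ (B-only b) (sub-miss sub (proj₂ (B-only c))) = inner-edge x≢y b c
    go (isB i b) (isB j c) (inj₂ (inj₂ (l , x∈ , y∈))) with members⇒at {l} x∈ | members⇒at {l} y∈
    ... | isW p | _     = ⊥-elim (only-not-pair (B-only b) (kind₁ p))
    ... | _     | isW p = ⊥-elim (only-not-pair (B-only c) (kind₁ p))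
    ... | isU p | isU q = ⊥-elim (x≢y (sameᵘ p q))
    ... | isZ p | isZ q = ⊥-elim (x≢y (sameᶻ p q))
    ... | isU p | isZ q with refl ← trans (sym p) q = inj₁ (outer p)
    ... | isZ p | isU q with refl ← trans (sym p) q = inj₂ (outer q)

  -- Offsets, relative to block prev i, of the ends of the arc of a vertex x
  -- whose only non-neighbour in Q is vᵢ. Around offset 3 of block j the arc of
  -- a witness w of type 𝒪₁ fills the offsets 2 to 4, whereas witnesses u, z of
  -- type 𝒪₂ meet at offset 3. The at most two vertices missing just vᵢ meet or
  -- avoid each other around offset 6, according to their adjacency.
  σ′ τ′ : Fin n → Fin n ⊎ (Fin n × Fin n) → ℕ
  σ′ x (inj₁ w) with adj? G x w
  ... | yes _ = 4
  ... | no  _ = 6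
  σ′ x (inj₂ (u , z)) with x Finₚ.≟ z | adj? G x z
  ... | yes _ | _     = 3
  ... | no  _ | yes _ = 6
  ... | no  _ | no  _ = 7
  τ′ x (inj₁ w) with adj? G x w
  ... | yes _ = 8
  ... | no  _ = 6
  τ′ x (inj₂ (u , z)) with x Finₚ.≟ u
  ... | yes _ = 9
  ... | no  _ = 6

  3≤σ′ : ∀ x s → 3 ℕ.≤ σ′ x s
  3≤σ′ x (inj₁ w) with adj? G x w
  ... | yes _ = ≤!
  ... | no  _ = ≤!
  3≤σ′ x (inj₂ (u , z)) with x Finₚ.≟ z | adj? G x z
  ... | yes _ | _     = ≤!
  ... | no  _ | yes _ = ≤!
  ... | no  _ | no  _ = ≤!

  σ′≤7 : ∀ x s → σ′ x s ℕ.≤ 7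
  σ′≤7 x (inj₁ w) with adj? G x w
  ... | yes _ = ≤!
  ... | no  _ = ≤!
  σ′≤7 x (inj₂ (u , z)) with x Finₚ.≟ z | adj? G x z
  ... | yes _ | _     = ≤!
  ... | no  _ | yes _ = ≤!
  ... | no  _ | no  _ = ≤!

  6≤τ′ : ∀ x s → 6 ℕ.≤ τ′ x s
  6≤τ′ x (inj₁ w) with adj? G x w
  ... | yes _ = ≤!
  ... | no  _ = ≤!
  6≤τ′ x (inj₂ (u , z)) with x Finₚ.≟ u
  ... | yes _ = ≤!
  ... | no  _ = ≤!

  τ′≤9 : ∀ x s → τ′ x s ℕ.≤ 9
  τ′≤9 x (inj₁ w) with adj? G x w
  ... | yes _ = ≤!
  ... | no  _ = ≤!
  τ′≤9 x (inj₂ (u , z)) with x Finₚ.≟ u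
  ... | yes _ = ≤!
  ... | no  _ = ≤!

  σ′-W : ∀ x w → (Adj G x w → σ′ x (inj₁ w) ≡ 4) × 4 ℕ.≤ σ′ x (inj₁ w) × (σ′ x (inj₁ w) ℕ.≤ 5 → Adj G x w)
  σ′-W x w with adj? G x w
  ... | yes a = (λ _ → refl) , ≤! , λ _ → a
  ... | no ¬a = (λ a → ⊥-elim (¬a a)) , ≤! , λ p → ≰! p

  σ′-Z : ∀ x u → σ′ x (inj₂ (u , x)) ≡ 3
  σ′-Z x u with x Finₚ.≟ x | adj? G x x
  ... | yes _ | _  = refl
  ... | no ne | _  = ⊥-elim (ne refl)

  σ′-U : ∀ x u z → x ≢ z → 6 ℕ.≤ σ′ x (inj₂ (u , z)) ×
    (σ′ x (inj₂ (u , z)) ℕ.≤ 6 → Adj G x z) × (Adj G x z → σ′ x (inj₂ (u , z)) ≡ 6)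
  σ′-U x u z x≢z with x Finₚ.≟ z | adj? G x z
  ... | yes e | _     = ⊥-elim (x≢z e)
  ... | no  _ | yes a = ≤! , (λ _ → a) , λ _ → refl
  ... | no  _ | no ¬a = ≤! , (λ p → ≰! p) , λ a → ⊥-elim (¬a a)

  σ′-3 : ∀ x s → σ′ x s ℕ.≤ 3 → ∃[ u ] s ≡ inj₂ (u , x)
  σ′-3 x (inj₁ w) p with adj? G x w
  ... | yes _ = ≰! p
  ... | no  _ = ≰! p
  σ′-3 x (inj₂ (u , z)) p with x Finₚ.≟ z | adj? G x z
  ... | yes refl | _     = u , refl
  ... | no  _    | yes _ = ≰! p
  ... | no  _    | no  _ = ≰! p

  τ′-W : ∀ x w → (Adj G x w → τ′ x (inj₁ w) ≡ 8) × τ′ x (inj₁ w) ℕ.≤ 8 × (7 ℕ.≤ τ′ x (inj₁ w) → Adj G x w)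
  τ′-W x w with adj? G x w
  ... | yes a = (λ _ → refl) , ≤! , λ _ → a
  ... | no ¬a = (λ a → ⊥-elim (¬a a)) , ≤! , λ p → ≰! p

  τ′-U : ∀ x z → τ′ x (inj₂ (x , z)) ≡ 9
  τ′-U x z with x Finₚ.≟ x
  ... | yes _ = refl
  ... | no ne = ⊥-elim (ne refl)

  τ′-Z : ∀ x u z → x ≢ u → τ′ x (inj₂ (u , z)) ≡ 6
  τ′-Z x u z x≢u with x Finₚ.≟ u
  ... | yes e = ⊥-elim (x≢u e)
  ... | no  _ = refl

  τ′-9 : ∀ x s → 9 ℕ.≤ τ′ x s → ∃[ z ] s ≡ inj₂ (x , z)
  τ′-9 x (inj₁ w) p with adj? G x w
  ... | yes _ = ≰! p
  ... | no  _ = ≰! p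
  τ′-9 x (inj₂ (u , z)) p with x Finₚ.≟ u
  ... | yes refl = z , refl
  ... | no  _    = ≰! p

  σ τ : Fin n → Fin k → ℕ
  σ x i = σ′ x (kind (prev i))
  τ x i = τ′ x (kind i)

  σ-eq : ∀ x {p s} → kind p ≡ s → σ x (next p) ≡ σ′ x s
  σ-eq x {p} eq = cong (σ′ x) (trans (cong kind (prev-next p)) eq)

  τ-eq : ∀ x {i s} → kind i ≡ s → τ x i ≡ τ′ x s
  τ-eq x eq = cong (τ′ x) eq

  -- A first vertex at `i` ends at 9 and a second vertex at the predecessor starts at 3; both values
  -- are clear of the range of the other end.
  σ<τ : ∀ {x i} → B x i → σ x i ℕ.< τ x i
  σ<τ {x} {i} (asU {z} eq) = subst (σ x i ℕ.<_) (sym (trans (τ-eq x eq) (τ′-U x z)))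
    (ℕₚ.≤-trans (s≤s (σ′≤7 x (kind (prev i)))) ≤!)
  σ<τ {x} {i} (asZ {p} {u} eq refl) = subst (ℕ._< τ x i) (sym (trans (σ-eq x eq) (σ′-Z x u)))
    (ℕₚ.≤-trans ≤! (6≤τ′ x (kind (next p))))

-- The explicit model and a criterion for its Helly property

module Construction {n} {G : Graph n} (𝒬 : ObstacleEnumerationIn G)
              (essential : ObstacleEnumerationIn.Essential 𝒬)
              (covering : ObstacleEnumerationIn.Covering 𝒬) where
  open Obstacle 𝒬 hiding (2≤k)
  open Structure 𝒬 essential
  open Blocks 3≤k

  data Role (x : Fin n) : Set where
    inQ : ∀ i → v i ≡ x → Role x
    wit : Wit x → Role x

  role : ∀ x → Role x
  role x with covering x
  ... | inj₁ (i , eq) = inQ i eq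
  ... | inj₂ (i , x∈) = wit (at⇒wit (members⇒at {i} x∈))

  -- The arc of vᵢ is the complement of the open stretch between the offsets
  -- α i and β i relative to block prev i, which must contain the arcs of the
  -- witnesses nonadjacent to vᵢ.
  record Params (Alive : Fin n → Set) : Set where
    field
      α β  : Fin k → ℕ
      -- With `1 ≤ α` the offsets 0 and 1 of a block lie on all arcs of `Q` but possibly the one
      -- with the index of the block (`early`).
      1≤α  : ∀ i → 1 ℕ.≤ α i
      α≤4  : ∀ i → α i ℕ.≤ 4
      8≤β  : ∀ i → 8 ℕ.≤ β i
      β≤11 : ∀ i → β i ℕ.≤ 11
      α<σ  : ∀ {x i} → Alive x → B x i → α i ℕ.< σ x i
      τ<β  : ∀ {x i} → Alive x → B x i → τ x i ℕ.< β i
      -- The arc of an `𝒪₁` witness at `i` fills the offsets 2 to 4 of block `i`. These are 8 to 10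
      -- relative to `prev i`, the reference block of `v i`, and 2 to 4 relative to `i`, the
      -- reference block of `v (next i)`.
      10<β : ∀ {x i} → Alive x → kind i ≡ inj₁ x → 10 ℕ.< β i
      α<2  : ∀ {x i} → Alive x → kind i ≡ inj₁ x → α (next i) ℕ.< 2

  -- `OnD`, `OnB` and later `OnQ` restate membership of position `r` of block `j` as inequalities of
  -- natural numbers, in which all adjacencies are then checked.
  OnD : Fin k → Fin k → ℕ → Set
  OnD i j r = j ≡ i × 2 ℕ.≤ r × r ℕ.≤ 4

  -- In the first alternative `j` is `prev i`; a position of that block is below 6 and so
  -- automatically below `τ`.
  OnB : Fin n → Fin k → Fin k → ℕ → Set
  OnB x i j r = (next j ≡ i × σ x i ℕ.≤ r) ⊎ (j ≡ i × σ x i ℕ.≤ 6 ℕ.+ r × 6 ℕ.+ r ℕ.≤ τ x i)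

  OnWit : ∀ {x} → Wit x → Fin k → ℕ → Set
  OnWit (isD i _)     = OnD i
  OnWit {x} (isB i _) = OnB x i

  witArc : ∀ {x} → Wit x → Arc
  witArc (isD i _)     = short i {2} {4} ≤! ≤!
  witArc {x} (isB i b) = short (prev i) (σ<τ b) (ℕₚ.≤-trans (s≤s (τ′≤9 x (kind i))) ≤!)

  next≡⇒≡prev : ∀ {i j : Fin k} → next j ≡ i → j ≡ prev i
  next≡⇒≡prev {j = j} refl = sym (prev-next j)

  wit-on⇒∈ : ∀ {x} (w : Wit x) {j r} → r ℕ.< 6 → OnWit w j r → place j r ∈ ⟦ witArc w ⟧
  wit-on⇒∈ (isD i eq) r<6 on = ∈short⇐ i {2} {4} ≤! ≤! r<6 (inj₁ on)
  wit-on⇒∈ {x} (isB i b) {j} {r} r<6 on = ∈short⇐ (prev i) (σ<τ b) (ℕₚ.≤-trans (s≤s (τ′≤9 x (kind i))) ≤!) r<6 (inside on)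
    where
    inside : OnB x i j r → Inside (prev i) (σ<τ b) (ℕₚ.≤-trans (s≤s (τ′≤9 x (kind i))) ≤!) j r
    inside (inj₁ (e , p))     = inj₁ (next≡⇒≡prev e , p , ℕₚ.≤-trans (ℕₚ.<⇒≤ r<6) (6≤τ′ x (kind i)))
    inside (inj₂ (e , p , q)) = inj₂ (trans e (sym (next-prev i)) , p , q)

  wit-∈⇒on : ∀ {x} (w : Wit x) {j r} → r ℕ.< 6 → place j r ∈ ⟦ witArc w ⟧ → OnWit w j r
  wit-∈⇒on (isD i eq) r<6 p∈ with ∈short⇒ i {2} {4} ≤! ≤! r<6 p∈
  ... | inj₁ on            = on
  ... | inj₂ (_ , _ , 6+r≤4) = ≰! (ℕₚ.≤-trans (ℕₚ.m≤m+n 6 _) 6+r≤4)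
  wit-∈⇒on {x} (isB i b) r<6 p∈ with ∈short⇒ (prev i) (σ<τ b) (ℕₚ.≤-trans (s≤s (τ′≤9 x (kind i))) ≤!) r<6 p∈
  ... | inj₁ (e , p , _) = inj₁ (trans (cong next e) (next-prev i) , p)
  ... | inj₂ (e , p , q) = inj₂ (trans e (next-prev i) , p , q)

  B-on : ∀ {x i j r} (w : Wit x) → B x i → OnB x i j r → OnWit w j r
  B-on (isD l eq) b on = ⊥-elim (only-not-pair (B-only b) (kind₁ eq))
  B-on (isB l c)  b on with refl ← only-unique (B-only c) (B-only b) = on

  D-on : ∀ {x i j r} (w : Wit x) → kind i ≡ inj₁ x → OnD i j r → OnWit w j r
  D-on (isD l eq) e on with refl ← pair-unique (kind₁ eq) (kind₁ e) = on
  D-on (isB l b)  e on = ⊥-elim (only-not-pair (B-only b) (kind₁ e))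

  module Model {Alive : Fin n → Set} (params : Params Alive) where
    open Params params

    OnQ : Fin k → Fin k → ℕ → Set
    OnQ i j r = ¬ ((next j ≡ i × α i ℕ.< r) ⊎ (j ≡ i × 6 ℕ.+ r ℕ.< β i))

    On : ∀ {x} → Role x → Fin k → ℕ → Set
    On (inQ i _) = OnQ i
    On (wit w)   = OnWit w

    α<β : ∀ i → α i ℕ.< β i
    α<β i = ℕₚ.<-≤-trans (s≤s (α≤4 i)) (ℕₚ.≤-trans ≤! (8≤β i))

    roleArc : ∀ {x} → Role x → Arc
    roleArc (inQ i _) = long (prev i) (α<β i) (s≤s (β≤11 i))
    roleArc (wit w)   = witArc w

    on⇒∈ : ∀ {x} (ρ : Role x) {j r} → r ℕ.< 6 → On ρ j r → place j r ∈ ⟦ roleArc ρ ⟧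
    on⇒∈ (wit w) r<6 on = wit-on⇒∈ w r<6 on
    on⇒∈ (inQ i _) {j} {r} r<6 on = ∈long⇐ (prev i) (α<β i) (s≤s (β≤11 i)) r<6
      λ { (inj₁ (e , p , _)) → on (inj₁ (trans (cong next e) (next-prev i) , p))
        ; (inj₂ (e , _ , q)) → on (inj₂ (trans e (next-prev i) , q)) }

    ∈⇒on : ∀ {x} (ρ : Role x) {j r} → r ℕ.< 6 → place j r ∈ ⟦ roleArc ρ ⟧ → On ρ j r
    ∈⇒on (wit w) r<6 p∈ = wit-∈⇒on w r<6 p∈
    ∈⇒on (inQ i _) {j} {r} r<6 p∈ bad = ∈long⇒ (prev i) (α<β i) (s≤s (β≤11 i)) r<6 p∈ (strict bad)
      where
      strict : (next j ≡ i × α i ℕ.< r) ⊎ (j ≡ i × 6 ℕ.+ r ℕ.< β i) →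
        Strictly (prev i) (α<β i) (s≤s (β≤11 i)) j r
      strict (inj₁ (e , p)) = inj₁ (next≡⇒≡prev e , p , ℕₚ.<-≤-trans r<6 (ℕₚ.≤-trans ≤! (8≤β i)))
      strict (inj₂ (e , q)) = inj₂ (trans e (sym (next-prev i)) , ℕₚ.≤-<-trans (α≤4 i) (ℕₚ.≤-trans ≤! (ℕₚ.m≤m+n 6 r)) , q)

    arcOf : Fin n → Arc
    arcOf x = roleArc (role x)

    offset-place : ∀ i {c} → c ℕ.< 12 → ∃[ j ] ∃[ r ] (r ℕ.< 6 × offset i c ≡ place j r)
    offset-place i {c} c<12 with split c
    ... | low c<6 = i , c , c<6 , offset-low i c<6
    ... | high r  = next i , r , ℕₚ.+-cancelˡ-< 6 _ _ c<12 , refl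

    start-place : ∀ {x} (ρ : Role x) → ∃[ j ] ∃[ r ] (r ℕ.< 6 × start (roleArc ρ) ≡ place j r)
    start-place (inQ i _)             = offset-place (prev i) (s≤s (β≤11 i))
    start-place (wit (isD i _))       = offset-place i {2} ≤!
    start-place {x} (wit (isB i _))   = offset-place (prev i) (ℕₚ.≤-trans (s≤s (σ′≤7 x (kind (prev i)))) ≤!)

    -- All starts are grid positions, and `meets⇒start` moves a common point to one of them.
    meets⇒place : ∀ x y → ⟦ arcOf x ⟧ ≬ ⟦ arcOf y ⟧ →
      ∃[ j ] ∃[ r ] (r ℕ.< 6 × On (role x) j r × On (role y) j r)
    meets⇒place x y meets with meets⇒start (arcOf x) (arcOf y) meets
    ... | inj₁ s∈ with start-place (role x)
    ...   | j , r , r<6 , eq = j , r , r<6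
            , ∈⇒on (role x) r<6 (subst (_∈ ⟦ arcOf x ⟧) eq (start∈ (arcOf x)))
            , ∈⇒on (role y) r<6 (subst (_∈ ⟦ arcOf y ⟧) eq s∈)
    meets⇒place x y meets | inj₂ s∈ with start-place (role y)
    ...   | j , r , r<6 , eq = j , r , r<6
            , ∈⇒on (role x) r<6 (subst (_∈ ⟦ arcOf x ⟧) eq s∈)
            , ∈⇒on (role y) r<6 (subst (_∈ ⟦ arcOf y ⟧) eq (start∈ (arcOf y)))

    Q-wit-adj : ∀ {x} i (w : Wit x) → Alive x → ∀ {j r} → OnQ i j r → OnWit w j r → Adj G x (v i)
    Q-wit-adj i (isD l eq) ax on (refl , 2≤r , r≤4) = at-adj (isW eq)
      (λ { refl → on (inj₂ (refl , ℕₚ.≤-<-trans (ℕₚ.+-monoʳ-≤ 6 r≤4) (10<β ax eq))) })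
      (λ { refl → on (inj₁ (refl , ℕₚ.<-≤-trans (α<2 ax eq) 2≤r)) })
    Q-wit-adj {x} i (isB l b) ax on onb = ¬miss⇒adj (λ e → wit⇒∉Q (isB l b) (i , e)) λ miss → i≢l (proj₁ (B-only b) miss)
      where
      missed : ∀ {j r} → OnB x l j r → ¬ OnQ l j r
      missed (inj₁ (e , σ≤r))     on = on (inj₁ (e , ℕₚ.<-≤-trans (α<σ ax b) σ≤r))
      missed (inj₂ (e , _ , r≤τ)) on = on (inj₂ (e , ℕₚ.≤-<-trans r≤τ (τ<β ax b)))
      i≢l : i ≢ l
      i≢l refl = missed onb on

    D-B-adj : ∀ {x y i l j r} → kind i ≡ inj₁ x → B y l → OnD i j r → OnB y l j r → Adj G y x
    D-B-adj {x} {y} {i} eq b (refl , 2≤r , r≤4) (inj₁ (refl , σ≤r)) =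
      proj₂ (proj₂ (σ′-W y x)) (ℕₚ.≤-trans (subst (ℕ._≤ _) (σ-eq y eq) σ≤r) (ℕₚ.≤-trans r≤4 ≤!))
    D-B-adj {x} {y} {i} eq b (refl , 2≤r , r≤4) (inj₂ (refl , _ , r≤τ)) =
      proj₂ (proj₂ (τ′-W y x)) (ℕₚ.≤-trans ≤! (ℕₚ.≤-trans (ℕₚ.+-monoʳ-≤ 6 2≤r) (subst (_ ℕ.≤_) (τ-eq y eq) r≤τ)))

    -- Since `x` and `y` differ, the arc of `x` ends at offset 6 and that of `y` starts at 6 or 7. A
    -- common position forces 6, the value chosen for adjacent vertices.
    inner-adj : ∀ {x y p u z j r} → x ≢ y → r ℕ.< 6 → kind p ≡ inj₂ (u , x) → kind (next p) ≡ inj₂ (y , z) →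
      OnB x (next p) j r → OnB y (next p) j r → Adj G y x
    inner-adj {x} {y} {p} {u} {z} x≢y r<6 ex ey _ (inj₁ (_ , σ≤r)) =
      ⊥-elim (ℕₚ.<⇒≱ r<6 (ℕₚ.≤-trans (proj₁ (σ′-U y u x (λ e → x≢y (sym e)))) (subst (ℕ._≤ _) (σ-eq y ex) σ≤r)))
    inner-adj {x} {y} {p} {u} {z} x≢y r<6 ex ey (inj₁ (e , _)) (inj₂ (e′ , _)) = ⊥-elim (next≢ 2≤k _ (trans e (sym e′)))
    inner-adj {x} {y} {p} {u} {z} x≢y r<6 ex ey (inj₂ (_ , _ , r≤τ)) (inj₂ (_ , σ≤r , _)) =
      proj₁ (proj₂ (σ′-U y u x (λ e → x≢y (sym e))))
        (ℕₚ.≤-trans (subst (ℕ._≤ _) (σ-eq y ex) σ≤r) (subst (_ ℕ.≤_) (trans (τ-eq x ey) (τ′-Z x y z x≢y)) r≤τ))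

    -- In block `i` the first arc reaches at most offset 3 and the second begins there at the
    -- earliest. Only the first vertex at `i` has `τ` equal to 9 and only the second has `σ` equal
    -- to 3.
    outer-adj : ∀ {x y i r} → OnB x i i r → OnB y (next i) i r → Adj G x y
    outer-adj (inj₁ (e , _)) _ = ⊥-elim (next≢ 2≤k _ e)
    outer-adj _ (inj₂ (e , _)) = ⊥-elim (next≢ 2≤k _ (sym e))
    outer-adj {x} {y} {i} {r} (inj₂ (_ , _ , r≤τ)) (inj₁ (_ , σ≤r))
      with τ′-9 x (kind i) (ℕₚ.≤-trans (ℕₚ.+-monoʳ-≤ 6 (ℕₚ.≤-trans (3≤σ′ y (kind (prev (next i)))) σ≤r)) r≤τ)
         | σ′-3 y (kind i) (subst (λ l → σ′ y (kind l) ℕ.≤ 3) (prev-next i)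
             (ℕₚ.≤-trans σ≤r (ℕₚ.+-cancelˡ-≤ 6 _ _ (ℕₚ.≤-trans r≤τ (τ′≤9 x (kind i))))))
    ... | z , e | u , e′ with refl ← trans (sym e) e′ = proj₂ (proj₂ (kind₂ e))

    wit-adj : ∀ {x y} → x ≢ y → (w : Wit x) (w′ : Wit y) → ∀ {j r} → r ℕ.< 6 →
      OnWit w j r → OnWit w′ j r → Adj G x y
    wit-adj x≢y (isD i e) (isD l e′) r<6 (refl , _) (refl , _) = ⊥-elim (x≢y (same₁ e e′))
    wit-adj x≢y (isD i e) (isB l b) r<6 on on′ = symm G (D-B-adj e b on on′)
    wit-adj x≢y (isB l b) (isD i e) r<6 on on′ = D-B-adj e b on′ on
    wit-adj {x} {y} x≢y (isB i b) (isB l c) {j} {r} r<6 on on′ with i Finₚ.≟ l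
    ... | yes refl = inner′ b c
      where
      inner′ : B x i → B y i → Adj G x y
      inner′ (asU e) (asU e′)         = ⊥-elim (x≢y (sameᵘ e e′))
      inner′ (asU e) (asZ e′ refl)    = inner-adj (λ q → x≢y (sym q)) r<6 e′ e on′ on
      inner′ (asZ e refl) (asU e′)    = symm G (inner-adj x≢y r<6 e e′ on on′)
      inner′ (asZ e refl) (asZ e′ f) with refl ← next-injective f = ⊥-elim (x≢y (sameᶻ e e′))
    wit-adj {x} {y} x≢y (isB i b) (isB l c) {j} {r} r<6 on on′ | no i≢l = go on on′
      where
      go : OnB x i j r → OnB y l j r → Adj G x y
      go (inj₁ (refl , _))     (inj₁ (e , _))    = ⊥-elim (i≢l e)
      go (inj₂ (refl , _))     (inj₂ (e , _))    = ⊥-elim (i≢l e)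
      go o@(inj₂ (refl , _))   o′@(inj₁ (refl , _)) = outer-adj o o′
      go o@(inj₁ (refl , _))   o′@(inj₂ (refl , _)) = symm G (outer-adj o′ o)

    place⇒adj : ∀ {x y} → x ≢ y → (ρ : Role x) (ρ′ : Role y) → Alive x → Alive y → ∀ {j r} → r ℕ.< 6 →
      On ρ j r → On ρ′ j r → Adj G x y
    place⇒adj x≢y (inQ i e) (inQ l e′) _ _ _ _ _ = clique (i , e) (l , e′) x≢y
    place⇒adj x≢y (inQ i refl) (wit w) _ ay _ on on′ = symm G (Q-wit-adj i w ay on on′)
    place⇒adj x≢y (wit w) (inQ i refl) ax _ _ on on′ = Q-wit-adj i w ax on′ on
    place⇒adj x≢y (wit w) (wit w′) _ _ r<6 on on′ = wit-adj x≢y w w′ r<6 on on′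

    -- The last component makes the position common to a whole clique, whose members in `Q` are
    -- adjacent to both witnesses. Taking `w` twice serves cliques with one witness.
    Spot : ∀ {x y} → Wit x → Wit y → Set
    Spot {x} {y} w w′ = ∃[ j ] ∃[ r ] (r ℕ.< 6 × OnWit w j r × OnWit w′ j r ×
      (∀ {i} → ¬ Miss x i → ¬ Miss y i → OnQ i j r))

    swap-spot : ∀ {x y} {w : Wit x} {w′ : Wit y} → Spot w w′ → Spot w′ w
    swap-spot (j , r , r<6 , a , b , c) = j , r , r<6 , b , a , λ p q → c q p

    middle : ∀ {i j r} → i ≢ j → i ≢ next j → OnQ i j r
    middle i≢j i≢j′ (inj₁ (e , _)) = i≢j′ (sym e)
    middle i≢j i≢j′ (inj₂ (e , _)) = i≢j (sym e)

    early : ∀ {i j r} → i ≢ j → r ℕ.≤ 1 → OnQ i j r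
    early {i} i≢j r≤1 (inj₁ (_ , α<r)) = ℕₚ.<⇒≱ α<r (ℕₚ.≤-trans r≤1 (1≤α i))
    early i≢j r≤1 (inj₂ (e , _))   = i≢j (sym e)

    -- The offsets are the meeting points built into `σ′` and `τ′`: 2 and 4 are the ends of an `𝒪₁`
    -- arc, 3 is where an `𝒪₂` pair meets, and offset 0 of block `next i` is offset 6 relative to
    -- `i`.
    edge-spot : ∀ {x y} → Edge x y → Adj G x y → (w : Wit x) (w′ : Wit y) → Spot w w′
    edge-spot {x} {y} (left {i} eq b) xy w w′ = i , 2 , ≤! , D-on w eq (refl , ≤! , ≤!)
      , B-on w′ b (inj₂ (refl , ℕₚ.≤-trans (σ′≤7 y (kind (prev i))) ≤!
          , subst (8 ℕ.≤_) (sym (trans (τ-eq y eq) (proj₁ (τ′-W y x) (symm G xy)))) ≤!))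
      , λ {l} ¬p _ → middle (λ { refl → ¬p (proj₁ (proj₂ (kind₁ eq))) }) (λ { refl → ¬p (proj₂ (proj₂ (kind₁ eq))) })
    edge-spot {x} {y} (right {i} eq b) xy w w′ = i , 4 , ≤! , D-on w eq (refl , ≤! , ≤!)
      , B-on w′ b (inj₁ (refl , subst (ℕ._≤ 4) (sym (trans (σ-eq y eq) (proj₁ (σ′-W y x) (symm G xy)))) ≤!))
      , λ {l} ¬p _ → middle (λ { refl → ¬p (proj₁ (proj₂ (kind₁ eq))) }) (λ { refl → ¬p (proj₂ (proj₂ (kind₁ eq))) })
    edge-spot {x} {y} (inner {i} {u} {z} ex ey) xy w w′ = next i , 0 , ≤!
      , B-on w (asZ ex refl) (inj₂ (refl , subst (ℕ._≤ 6) (sym (trans (σ-eq x ex) (σ′-Z x u))) ≤! , 6≤τ′ x (kind (next i))))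
      , B-on w′ (asU ey) (inj₂ (refl , subst (ℕ._≤ 6) (sym (trans (σ-eq y ex)
            (proj₂ (proj₂ (σ′-U y u x (λ e → irrefl G (sym e) xy))) (symm G xy)))) ≤! , 6≤τ′ y (kind (next i))))
      , λ {l} ¬p _ → early (λ { refl → ¬p (proj₂ (proj₁ (proj₂ (kind₂ ex)))) }) ≤!
    edge-spot {x} {y} (outer {i} eq) xy w w′ = i , 3 , ≤!
      , B-on w (asU eq) (inj₂ (refl , ℕₚ.≤-trans (σ′≤7 x (kind (prev i))) ≤! , subst (9 ℕ.≤_) (sym (trans (τ-eq x eq) (τ′-U x y))) ≤!))
      , B-on w′ (asZ eq refl) (inj₁ (refl , subst (ℕ._≤ 3) (sym (trans (σ-eq y eq) (σ′-Z y x))) ≤!))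
      , λ {l} ¬p ¬q → middle (λ { refl → ¬p (proj₂ (proj₁ (kind₂ eq))) }) (λ { refl → ¬q (proj₂ (proj₁ (proj₂ (kind₂ eq)))) })

    pair-spot : ∀ {x y} → Adj G x y → (w : Wit x) (w′ : Wit y) → Spot w w′
    pair-spot xy w w′ with edge w w′ xy
    ... | inj₁ e = edge-spot e xy w w′
    ... | inj₂ e = swap-spot {w = w′} {w} (edge-spot e (symm G xy) w′ w)

    single-spot : ∀ {x} (w : Wit x) → Spot w w
    single-spot (isD i eq) = i , 3 , ≤! , (refl , ≤! , ≤!) , (refl , ≤! , ≤!)
      , λ {l} ¬p _ → middle (λ { refl → ¬p (proj₁ (proj₂ (kind₁ eq))) }) (λ { refl → ¬p (proj₂ (proj₂ (kind₁ eq))) })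
    single-spot {x} (isB i b) with σ x i ℕₚ.≤? 6
    ... | yes σ≤6 = i , 0 , ≤! , on , on , λ {l} ¬p _ → early (λ { refl → ¬p (proj₂ (B-only b)) }) ≤!
      where
      on : OnB x i i 0
      on = inj₂ (refl , σ≤6 , 6≤τ′ x (kind i))
    -- Here `σ x i` is 7, so the arc begins at offset 1 of block `i`.
    ... | no σ≰6 = i , 1 , ≤! , on , on , λ {l} ¬p _ → early (λ { refl → ¬p (proj₂ (B-only b)) }) ≤!
      where
      on : OnB x i i 1
      on = inj₂ (refl , σ′≤7 x (kind (prev i)) , ℕₚ.≤-trans (ℕₚ.≰⇒> σ≰6) (ℕₚ.<⇒≤ (σ<τ b)))

    third : ∀ i l → ∃[ j ] (i ≢ j × l ≢ j)
    third i l with l Finₚ.≟ next i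
    ... | yes refl = next (next i) , (λ e → next²≢ 3≤k i (sym e)) , (λ e → next≢ 2≤k (next i) (sym e))
    ... | no l≢i′  = next i , (λ e → next≢ 2≤k i (sym e)) , l≢i′

    adj⇒miss : ∀ {x i} → Adj G x (v i) → ¬ Miss x i
    adj⇒miss a (_ , ¬a) = ¬a a

    adj⇒place : ∀ {x y} → Adj G x y → (ρ : Role x) (ρ′ : Role y) → ∃[ j ] ∃[ r ] (r ℕ.< 6 × On ρ j r × On ρ′ j r)
    adj⇒place xy (inQ i _) (inQ l _) = let j , i≢j , l≢j = third i l in j , 0 , ≤! , early i≢j ≤! , early l≢j ≤!
    adj⇒place xy (inQ i refl) (wit w) with single-spot w
    ... | j , r , r<6 , on , _ , h = j , r , r<6 , h (adj⇒miss (symm G xy)) (adj⇒miss (symm G xy)) , on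
    adj⇒place xy (wit w) (inQ i refl) with single-spot w
    ... | j , r , r<6 , on , _ , h = j , r , r<6 , on , h (adj⇒miss xy) (adj⇒miss xy)
    adj⇒place xy (wit w) (wit w′) with pair-spot xy w w′
    ... | j , r , r<6 , on , on′ , _ = j , r , r<6 , on , on′

    adj⇔meets-alive : ∀ {x y} → Alive x → Alive y → x ≢ y → Adj G x y ⇔ (⟦ arcOf x ⟧ ≬ ⟦ arcOf y ⟧)
    adj⇔meets-alive {x} {y} ax ay x≢y = mk⇔
      (λ xy → let j , r , r<6 , on , on′ = adj⇒place xy (role x) (role y) in
              place j r , on⇒∈ (role x) r<6 on , on⇒∈ (role y) r<6 on′)
      (λ meets → let j , r , r<6 , on , on′ = meets⇒place x y meets in
                 place⇒adj x≢y (role x) (role y) ax ay r<6 on on′)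

    module _ {m} (f : Fin m ↣ Fin n) (alive : ∀ u → Alive (Injection.to f u)) where
      open Injection f using (to; injective)

      model : CircularArcModel (induced G f)
      model = record
        { arc       = λ u → arcOf (to u)
        ; adj⇔meets = λ {u} {u′} u≢u′ → adj⇔meets-alive (alive u) (alive u′) (λ e → u≢u′ (injective e))
        }

      -- A clique inside `Q` is served by the first hypothesis and one with one or two witnesses by
      -- a `Spot`; the second hypothesis excludes three witnesses.
      model-helly :
        (∃[ j ] ∃[ r ] (r ℕ.< 6 × (∀ {i} → Alive (v i) → OnQ i j r))) →
        (∀ {x y z} → Wit x → Wit y → Wit z → Alive x → Alive y → Alive z →
          Adj G x y → Adj G y z → Adj G x z → ⊥) →
        Helly (λ u → arcOf (to u))
      model-helly (j₀ , r₀ , r₀<6 , Q-place) no-triangle S nonempty meets = result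
        where
        InQ? : ∀ u → Dec (to u ∈ Q)
        InQ? u = Finₚ.any? λ i → v i Finₚ.≟ to u

        adj : ∀ {u u′} → u Subset.∈ S → u′ Subset.∈ S → u ≢ u′ → Adj G (to u) (to u′)
        adj {u} {u′} u∈ u′∈ u≢u′ = Equivalence.from
          (adj⇔meets-alive (alive u) (alive u′) (λ e → u≢u′ (injective e))) (meets u∈ u′∈)

        witness : ∀ u → to u ∉ Q → Wit (to u)
        witness u ∉Q with role (to u)
        ... | inQ i e = ⊥-elim (∉Q (i , e))
        ... | wit w   = w

        role≡ : ∀ u (∉Q : to u ∉ Q) → role (to u) ≡ wit (witness u ∉Q)
        role≡ u ∉Q with role (to u)
        ... | inQ i e = ⊥-elim (∉Q (i , e))
        ... | wit w   = refl

        Common : Set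
        Common = ∃[ q ] (∀ {u} → u Subset.∈ S → q ∈ ⟦ arcOf (to u) ⟧)

        at-spot : ∀ {y y′} (y∈ : y Subset.∈ S) (y′∈ : y′ Subset.∈ S) (∉y : to y ∉ Q) (∉y′ : to y′ ∉ Q) →
          Spot (witness y ∉y) (witness y′ ∉y′) →
          (∀ {u} → u Subset.∈ S → to u ∉ Q → u ≡ y ⊎ u ≡ y′) → Common
        at-spot {y} {y′} y∈ y′∈ ∉y ∉y′ (j , r , r<6 , on , on′ , h) only =
          place j r , λ {u} u∈ → on⇒∈ (role (to u)) r<6 (here′ u u∈ (role (to u)) refl)
          where
          here′ : ∀ u → u Subset.∈ S → (ρ : Role (to u)) → role (to u) ≡ ρ → On ρ j r
          here′ u u∈ (inQ i e) _ = h (no-miss y y∈ ∉y) (no-miss y′ y′∈ ∉y′)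
            where
            no-miss : ∀ y → y Subset.∈ S → to y ∉ Q → ¬ Miss (to y) i
            no-miss y y∈ ∉y (_ , ¬a) = ¬a (subst (Adj G (to y)) (sym e)
              (adj y∈ u∈ (λ { refl → ∉y (i , e) })))
          here′ u u∈ (wit w) eq with only u∈ (wit⇒∉Q w)
          ... | inj₁ refl = subst (λ ρ → On ρ j r) (trans (sym (role≡ y ∉y)) eq) on
          ... | inj₂ refl = subst (λ ρ → On ρ j r) (trans (sym (role≡ y′ ∉y′)) eq) on′

        result : Common
        result with Finₚ.any? (λ u → u Subsetₚ.∈? S ×-dec ¬? (InQ? u))
        ... | no none = place j₀ r₀ , λ {u} u∈ → on⇒∈ (role (to u)) r₀<6 (all-Q u u∈ (role (to u)))
          where
          all-Q : ∀ u → u Subset.∈ S → (ρ : Role (to u)) → On ρ j₀ r₀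
          all-Q u u∈ (inQ i e) = Q-place (subst Alive (sym e) (alive u))
          all-Q u u∈ (wit w)   = ⊥-elim (none (u , u∈ , wit⇒∉Q w))
        ... | yes (y , y∈ , ∉y) with Finₚ.any? (λ u → u Subsetₚ.∈? S ×-dec (¬? (InQ? u) ×-dec ¬? (u Finₚ.≟ y)))
        ...   | no none = at-spot y∈ y∈ ∉y ∉y (single-spot (witness y ∉y)) only
          where
          only : ∀ {u} → u Subset.∈ S → to u ∉ Q → u ≡ y ⊎ u ≡ y
          only {u} u∈ ∉u with u Finₚ.≟ y
          ... | yes e = inj₁ e
          ... | no ne = ⊥-elim (none (u , u∈ , ∉u , ne))
        ...   | yes (y′ , y′∈ , ∉y′ , y′≢y) = at-spot y∈ y′∈ ∉y ∉y′
                (pair-spot (adj y∈ y′∈ (λ e → y′≢y (sym e))) (witness y ∉y) (witness y′ ∉y′)) only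
          where
          only : ∀ {u} → u Subset.∈ S → to u ∉ Q → u ≡ y ⊎ u ≡ y′
          only {u} u∈ ∉u with u Finₚ.≟ y | u Finₚ.≟ y′
          ... | yes e | _     = inj₁ e
          ... | no _  | yes e = inj₂ e
          ... | no a  | no b  = ⊥-elim (no-triangle (witness y ∉y) (witness y′ ∉y′) (witness u ∉u)
                  (alive y) (alive y′) (alive u)
                  (adj y∈ y′∈ (λ e → y′≢y (sym e))) (adj y′∈ u∈ (λ e → b (sym e))) (adj y∈ u∈ (λ e → a (sym e))))

-- Triangles of witnesses and the octahedron

module Triangle {n} {G : Graph n} (𝒬 : ObstacleEnumerationIn G)
                (essential : ObstacleEnumerationIn.Essential 𝒬) where
  open Obstacle 𝒬
  open Structure 𝒬 essential

  -- Three pairwise adjacent witnesses force k = 3 and make G the octahedron.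
  record Octahedron (x y z : Fin n) : Set where
    field
      i    : Fin k
      loop : next (next (next i)) ≡ i
      xy   : kind i ≡ inj₂ (x , y)
      yz   : kind (next i) ≡ inj₂ (y , z)
      zx   : kind (next (next i)) ≡ inj₂ (z , x)

    indices : ∀ j → j ≡ i ⊎ j ≡ next i ⊎ j ≡ next (next i)
    indices = next-induction _ i (inj₁ refl)
      λ { _ (inj₁ refl)        → inj₂ (inj₁ refl)
        ; _ (inj₂ (inj₁ refl)) → inj₂ (inj₂ refl)
        ; _ (inj₂ (inj₂ refl)) → inj₁ loop }

    at-vertex : ∀ {j a} → At j a → a ≡ x ⊎ a ≡ y ⊎ a ≡ z
    at-vertex {j} at with indices j
    at-vertex (isW e) | inj₁ refl        = ⊥-elim (inj₁≢inj₂ e xy)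
    at-vertex (isU e) | inj₁ refl        = inj₁ (sameᵘ e xy)
    at-vertex (isZ e) | inj₁ refl        = inj₂ (inj₁ (sameᶻ e xy))
    at-vertex (isW e) | inj₂ (inj₁ refl) = ⊥-elim (inj₁≢inj₂ e yz)
    at-vertex (isU e) | inj₂ (inj₁ refl) = inj₂ (inj₁ (sameᵘ e yz))
    at-vertex (isZ e) | inj₂ (inj₁ refl) = inj₂ (inj₂ (sameᶻ e yz))
    at-vertex (isW e) | inj₂ (inj₂ refl) = ⊥-elim (inj₁≢inj₂ e zx)
    at-vertex (isU e) | inj₂ (inj₂ refl) = inj₂ (inj₂ (sameᵘ e zx))
    at-vertex (isZ e) | inj₂ (inj₂ refl) = inj₁ (sameᶻ e zx)

  D-not-B : ∀ {A : Set} {x i j} → kind i ≡ inj₁ x → B x j → A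
  D-not-B eq b = ⊥-elim (only-not-pair (B-only b) (kind₁ eq))

  D-neighbour : ∀ {x y i} → kind i ≡ inj₁ x → Edge x y ⊎ Edge y x → B y i ⊎ B y (next i)
  D-neighbour eq (inj₁ (left e b))   with refl ← pair-unique (kind₁ e) (kind₁ eq) = inj₁ b
  D-neighbour eq (inj₁ (right e b))  with refl ← pair-unique (kind₁ e) (kind₁ eq) = inj₂ b
  D-neighbour eq (inj₁ (inner e _))  = D-not-B eq (asZ e refl)
  D-neighbour eq (inj₁ (outer e))    = D-not-B eq (asU e)
  D-neighbour eq (inj₂ (left _ b))   = D-not-B eq b
  D-neighbour eq (inj₂ (right _ b))  = D-not-B eq b
  D-neighbour eq (inj₂ (inner _ e))  = D-not-B eq (asU e)
  D-neighbour eq (inj₂ (outer e))    = D-not-B eq (asZ e refl)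

  -- The indices missed by two adjacent `𝒪₂` witnesses agree or are consecutive, and in the latter
  -- case the edge is itself an enumeration.
  data Steps (x y : Fin n) (i j : Fin k) : Set where
    stay : i ≡ j → Steps x y i j
    up   : j ≡ next i → kind i ≡ inj₂ (x , y) → Steps x y i j
    down : i ≡ next j → kind j ≡ inj₂ (y , x) → Steps x y i j

  private
    index : ∀ {x i j} → B x i → B x j → i ≡ j
    index b c = only-unique (B-only b) (B-only c)

  steps : ∀ {x y i j} → B x i → B y j → Edge x y ⊎ Edge y x → Steps x y i j
  steps b c (inj₁ (left e _))   = D-not-B e b
  steps b c (inj₁ (right e _))  = D-not-B e b
  steps b c (inj₁ (inner e f))  = stay (trans (index b (asZ e refl)) (index (asU f) c))
  steps b c (inj₁ (outer e))    with refl ← index (asU e) b = up (index c (asZ e refl)) e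
  steps b c (inj₂ (left e _))   = D-not-B e c
  steps b c (inj₂ (right e _))  = D-not-B e c
  steps b c (inj₂ (inner e f))  = stay (trans (index b (asU f)) (index (asZ e refl) c))
  steps b c (inj₂ (outer e))    with refl ← index (asU e) c = down (index b (asZ e refl)) e

  -- A vertex missing just `v i` has one of two roles, and two of three vertices would share one.
  class-pair : ∀ {x y z i} → x ≢ y → x ≢ z → y ≢ z → B x i → B y i → ¬ B z i
  class-pair x≢y x≢z y≢z (asU e) (asU f) _ = x≢y (sameᵘ e f)
  class-pair x≢y x≢z y≢z (asU e) _ (asU f) = x≢z (sameᵘ e f)
  class-pair x≢y x≢z y≢z _ (asU e) (asU f) = y≢z (sameᵘ e f)
  class-pair x≢y x≢z y≢z (asZ e refl) (asZ f p) _ with refl ← next-injective p = x≢y (sameᶻ e f)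
  class-pair x≢y x≢z y≢z (asZ e refl) _ (asZ f p) with refl ← next-injective p = x≢z (sameᶻ e f)
  class-pair x≢y x≢z y≢z _ (asZ e refl) (asZ f p) with refl ← next-injective p = y≢z (sameᶻ e f)

  -- A step up leaves only from the first vertex at `i`, a step down only from the second vertex at
  -- the predecessor, and one index cannot be both above and below `i` when there are at least
  -- three.
  class-triangle : ∀ {x y z i l} → x ≢ y → x ≢ z → y ≢ z → B x i → B y i → B z l →
    Steps x z i l → Steps y z i l → ⊥
  class-triangle p q r bx by bz (stay refl) _           = class-pair p q r bx by bz
  class-triangle p q r bx by bz _ (stay refl)           = class-pair p q r bx by bz
  class-triangle p q r bx by bz (up _ e) (up _ f)       = p (sameᵘ e f)
  class-triangle p q r bx by bz (down _ e) (down _ f)   = p (sameᶻ e f)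
  class-triangle p q r bx by bz (up e _) (down f _)     = next²≢ 3≤k _ (trans (cong next (sym e)) (sym f))
  class-triangle p q r bx by bz (down f _) (up e _)     = next²≢ 3≤k _ (trans (cong next (sym e)) (sym f))

  flip-steps : ∀ {x y i j} → Steps x y i j → Steps y x j i
  flip-steps (stay e)   = stay (sym e)
  flip-steps (up e f)   = down e f
  flip-steps (down e f) = up e f

  -- As `W i` is of type `𝒪₁`, only one role is left for a vertex missing just `v i`, and one for a
  -- vertex missing just `v (next i)`. An edge between two such vertices would have to be an `𝒪₂`
  -- enumeration at `i`.
  D-triangle : ∀ {x y z i} → kind i ≡ inj₁ x → y ≢ z →
    Edge x y ⊎ Edge y x → Edge x z ⊎ Edge z x → Edge y z ⊎ Edge z y → ⊥
  D-triangle {i = i} eq y≢z xy xz yz with D-neighbour eq xy | D-neighbour eq xz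
  ... | inj₁ (asU e) | _ = inj₁≢inj₂ eq e
  ... | _ | inj₁ (asU e) = inj₁≢inj₂ eq e
  ... | inj₁ (asZ e refl) | inj₁ (asZ f p) with refl ← next-injective p = y≢z (sameᶻ e f)
  D-triangle eq y≢z xy xz yz | inj₂ (asZ e p) | _ with refl ← next-injective p = inj₁≢inj₂ eq e
  D-triangle eq y≢z xy xz yz | _ | inj₂ (asZ e p) with refl ← next-injective p = inj₁≢inj₂ eq e
  D-triangle eq y≢z xy xz yz | inj₂ (asU e) | inj₂ (asU f) = y≢z (sameᵘ e f)
  D-triangle eq y≢z xy xz yz | inj₁ b | inj₂ c with steps b c yz
  ... | stay e   = next≢ 2≤k _ (sym e)
  ... | up _ e   = inj₁≢inj₂ eq e
  ... | down e _ = next²≢ 3≤k _ (sym e)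
  D-triangle eq y≢z xy xz yz | inj₂ c | inj₁ b with steps b c (Data.Sum.swap yz)
  ... | stay e   = next≢ 2≤k _ (sym e)
  ... | up _ e   = inj₁≢inj₂ eq e
  ... | down e _ = next²≢ 3≤k _ (sym e)

  octahedron : ∀ {x y z i j l} → j ≡ next i → kind i ≡ inj₂ (x , y) →
    l ≡ next j → kind j ≡ inj₂ (y , z) → i ≡ next l → kind l ≡ inj₂ (z , x) → Octahedron x y z
  octahedron {i = i} refl xy refl yz loop zx = record { i = i ; loop = sym loop ; xy = xy ; yz = yz ; zx = zx }

  -- What remains are three `𝒪₂` witnesses with different missed vertices, joined by steps. Two
  -- upward steps from one index would give its enumeration two second vertices, so the steps form a
  -- directed cycle of length three.
  triangle⇒octahedron : ∀ {x y z} → Wit x → Wit y → Wit z →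
    Adj G x y → Adj G y z → Adj G x z → Octahedron x y z ⊎ Octahedron x z y
  triangle⇒octahedron {x} {y} {z} wx wy wz xy yz xz = go wx wy wz
    where
    adj⇒≢ : ∀ {a b} → Adj G a b → a ≢ b
    adj⇒≢ ab eq = irrefl G eq ab
    exy : Edge x y ⊎ Edge y x
    exy = edge wx wy xy
    eyz : Edge y z ⊎ Edge z y
    eyz = edge wy wz yz
    exz : Edge x z ⊎ Edge z x
    exz = edge wx wz xz
    x≢y : x ≢ y
    x≢y = adj⇒≢ xy
    y≢z : y ≢ z
    y≢z = adj⇒≢ yz
    x≢z : x ≢ z
    x≢z = adj⇒≢ xz
    go : Wit x → Wit y → Wit z → Octahedron x y z ⊎ Octahedron x z y
    go (isD i e) _ _ = ⊥-elim (D-triangle e y≢z exy exz eyz)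
    go _ (isD i e) _ = ⊥-elim (D-triangle e x≢z (Data.Sum.swap exy) eyz exz)
    go _ _ (isD i e) = ⊥-elim (D-triangle e x≢y (Data.Sum.swap exz) (Data.Sum.swap eyz) exy)
    go (isB i bx) (isB j by) (isB l bz) with steps bx by exy | steps by bz eyz | steps bx bz exz
    ... | stay refl | q | r = ⊥-elim (class-triangle x≢y x≢z y≢z bx by bz r q)
    ... | p | stay refl | r = ⊥-elim (class-triangle y≢z (λ e → x≢y (sym e)) (λ e → x≢z (sym e)) by bz bx (flip-steps p) (flip-steps r))
    ... | p | q | stay refl = ⊥-elim (class-triangle x≢z x≢y (λ e → y≢z (sym e)) bx bz by p (flip-steps q))
    ... | up a b   | up c d   | down e f = inj₁ (octahedron a b c d e f)
    ... | down a b | down c d | up e f   = inj₂ (octahedron e f c d a b)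
    ... | up _ b   | _        | up _ f   = ⊥-elim (y≢z (sameᶻ b f))
    ... | down _ b | up _ d   | _        = ⊥-elim (x≢z (sameᶻ b d))
    ... | _        | down _ d | down _ f = ⊥-elim (x≢y (sym (sameᶻ d f)))

  -- Each witness `b l` and `v l` are nonadjacent partners, and all other pairs are adjacent. So the
  -- witnesses form a clique for which `v l` and `v (next l)` are an `𝒪₂` enumeration.
  module Exchange {x y z} (O : Octahedron x y z)
                  (covering : ObstacleEnumerationIn.Covering 𝒬) where
    open Octahedron O

    head : Fin n ⊎ (Fin n × Fin n) → Fin n
    -- A default: `kind-b` shows that all enumerations are of type `𝒪₂` here.
    head (inj₁ w)       = w
    head (inj₂ (u , _)) = u

    b : Fin k → Fin n
    b l = head (kind l)

    kind-b : ∀ l → kind l ≡ inj₂ (b l , b (next l))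
    kind-b l with indices l
    ... | inj₁ refl        = trans xy (sym (cong₂ (λ p q → inj₂ (p , q)) (cong head xy) (cong head yz)))
    ... | inj₂ (inj₁ refl) = trans yz (sym (cong₂ (λ p q → inj₂ (p , q)) (cong head yz) (cong head zx)))
    ... | inj₂ (inj₂ refl) = trans zx (sym (cong₂ (λ p q → inj₂ (p , q)) (cong head zx)
                               (trans (cong b loop) (cong head xy))))

    b-only : ∀ l → Only (b l) l
    b-only l = proj₁ (kind₂ (kind-b l))

    b-injective : ∀ {l m} → b l ≡ b m → l ≡ m
    b-injective {l} {m} eq = only-unique (b-only l) (subst (λ a → Only a m) (sym eq) (b-only m))

    consecutive : ∀ l m → l ≢ m → m ≡ next l ⊎ l ≡ next m
    consecutive l m l≢m with indices l | indices m
    ... | inj₁ refl        | inj₁ refl        = ⊥-elim (l≢m refl)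
    ... | inj₁ refl        | inj₂ (inj₁ refl) = inj₁ refl
    ... | inj₁ refl        | inj₂ (inj₂ refl) = inj₂ (sym loop)
    ... | inj₂ (inj₁ refl) | inj₁ refl        = inj₂ refl
    ... | inj₂ (inj₁ refl) | inj₂ (inj₁ refl) = ⊥-elim (l≢m refl)
    ... | inj₂ (inj₁ refl) | inj₂ (inj₂ refl) = inj₁ refl
    ... | inj₂ (inj₂ refl) | inj₁ refl        = inj₁ (sym loop)
    ... | inj₂ (inj₂ refl) | inj₂ (inj₁ refl) = inj₂ refl
    ... | inj₂ (inj₂ refl) | inj₂ (inj₂ refl) = ⊥-elim (l≢m refl)

    b-step : ∀ l → Adj G (b l) (b (next l))
    b-step l = proj₂ (proj₂ (kind₂ (kind-b l)))

    b-adj : ∀ {l m} → l ≢ m → Adj G (b l) (b m)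
    b-adj {l} {m} l≢m with consecutive l m l≢m
    ... | inj₁ refl = b-step l
    ... | inj₂ refl = symm G (b-step m)

    Q′ : Pred (Fin n) 0ℓ
    Q′ a = ∃[ l ] b l ≡ a

    misses : ∀ l → NonNeighbours G (v l) ∩ Q′ ≐ ｛ b l ｝
    misses l = ⇒ , ⇐
      where
      ⇒ : NonNeighbours G (v l) ∩ Q′ ⊆ ｛ b l ｝
      ⇒ ((b≢v , ¬adj) , m , refl) = cong b (proj₁ (b-only m)
        ((λ e → b≢v (sym e)) , λ a → ¬adj (symm G a)))
      ⇐ : ｛ b l ｝ ⊆ NonNeighbours G (v l) ∩ Q′
      ⇐ refl with b-only l
      ... | _ , v≢b , ¬adj = ((λ e → v≢b (sym e)) , λ a → ¬adj (symm G a)) , l , refl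

    exchanged : ObstacleEnumerationIn G
    exchanged = record
      { k = k
      ; 3≤k = 3≤k
      ; enum = mk↣ b-injective
      ; clique = λ { (l , refl) (m , refl) ne → b-adj (λ { refl → ne refl }) }
      ; W = λ l → 𝒪₂ (v l) (v (next l)) (misses l) (misses (next l)) (distinct⇒adj (λ e → next≢ 2≤k l (sym e)))
      }

    module E = ObstacleEnumerationIn exchanged

    v-witness : ∀ l → v l ∈ E.Witness
    v-witness l = l , inj₁ refl

    exchanged-covering : E.Covering
    exchanged-covering a with covering a
    ... | inj₁ (l , refl) = inj₂ (v-witness l)
    ... | inj₂ (l , a∈) with members⇒at {l} a∈
    ...   | isW e = ⊥-elim (inj₁≢inj₂ e (kind-b l))
    ...   | isU e = inj₁ (l , sameᵘ (kind-b l) e)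
    ...   | isZ e = inj₁ (next l , sameᶻ (kind-b l) e)

    witness-v : ∀ {a} → a ∈ E.Witness → ∃[ l ] v l ≡ a
    witness-v (l , inj₁ refl) = l , refl
    witness-v (l , inj₂ refl) = next l , refl

    exchanged-essential : E.Essential
    exchanged-essential p q adj with witness-v p | witness-v q
    ... | l , refl | m , refl with consecutive l m (λ { refl → irrefl G refl adj })
    ...   | inj₁ refl = inj₂ (inj₂ (l , inj₁ refl , inj₂ refl))
    ...   | inj₂ refl = inj₂ (inj₂ (m , inj₂ refl , inj₁ refl))

-- Helly models after the deletion of a vertex

module Delete {n} {G : Graph n} (𝒬 : ObstacleEnumerationIn G)
              (essential : ObstacleEnumerationIn.Essential 𝒬)
              (covering : ObstacleEnumerationIn.Covering 𝒬) where
  open Obstacle 𝒬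
  open Structure 𝒬 essential
  open Construction 𝒬 essential covering
  open Triangle 𝒬 essential

  -- The shortest arcs for `Q` that the bounds allow. Every `B` arc lies within the offsets 3 to 9
  -- and every `𝒪₁` arc is 8 to 10 or 2 to 4, according to the reference block, so all of them fit
  -- strictly between 1 and 11.
  default : ∀ Alive → Params Alive
  default Alive = record
    { α = λ _ → 1
    ; β = λ _ → 11
    ; 1≤α = λ _ → ≤!
    ; α≤4 = λ _ → ≤!
    ; 8≤β = λ _ → ≤!
    ; β≤11 = λ _ → ≤!
    ; α<σ = λ {x} {i} _ _ → ℕₚ.≤-trans ≤! (3≤σ′ x (kind (prev i)))
    ; τ<β = λ {x} {i} _ _ → ℕₚ.≤-trans (s≤s (τ′≤9 x (kind i))) ≤!
    ; 10<β = λ _ _ → ≤!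
    ; α<2 = λ _ _ → ≤!
    }

  circularArc : CircularArc G
  circularArc = record { arc = arc M ; adj⇔meets = adj⇔meets M }
    where
    id↣ : Fin n ↣ Fin n
    id↣ = mk↣ (λ e → e)
    M : CircularArcModel (induced G id↣)
    M = Model.model (default (λ _ → ⊤)) id↣ (λ _ → tt)

  -- At offset e of block j the arcs of vⱼ and vⱼ₊₁ can be made to meet, once
  -- the witness x at j is gone.
  record Gap (j : Fin k) (x : Fin n) : Set where
    field
      e   : ℕ
      2≤e : 2 ℕ.≤ e
      e≤4 : e ℕ.≤ 4
      e<σ : ∀ {y} → y ≢ x → B y (next j) → e ℕ.< σ y (next j)
      τ<e : ∀ {y} → y ≢ x → B y j → τ y j ℕ.< 6 ℕ.+ e
      noD : ∀ {y} → y ≢ x → kind j ≢ inj₁ y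

  -- Without an `𝒪₁` witness, the middle 3 of its arc is free, as its neighbours stop at 2 or begin
  -- at 4. Without `u` offset 2 is free, as `z` begins at 3; without `z` offset 4 is free, as `u`
  -- stops at 3.
  gap : ∀ {j x} → At j x → Gap j x
  gap {j} {x} (isW eq) = record
    { e = 3 ; 2≤e = ≤! ; e≤4 = ≤!
    ; e<σ = λ {y} _ _ → subst (3 ℕ.<_) (sym (σ-eq y eq)) (proj₁ (proj₂ (σ′-W y x)))
    ; τ<e = λ {y} _ _ → subst (ℕ._< 9) (sym (τ-eq y eq)) (s≤s (proj₁ (proj₂ (τ′-W y x))))
    ; noD = λ y≢x eq′ → y≢x (same₁ eq′ eq)
    }
  gap {j} {x} (isU {z} eq) = record
    { e = 2 ; 2≤e = ≤! ; e≤4 = ≤!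
    ; e<σ = λ {y} _ _ → 3≤σ′ y (kind (prev (next j)))
    ; τ<e = λ {y} y≢x _ → subst (ℕ._< 8) (sym (trans (τ-eq y eq) (τ′-Z y x z y≢x))) ≤!
    ; noD = λ _ eq′ → inj₁≢inj₂ eq′ eq
    }
  gap {j} {x} (isZ {u} eq) = record
    { e = 4 ; 2≤e = ≤! ; e≤4 = ≤!
    ; e<σ = λ {y} y≢x _ → subst (4 ℕ.<_) (sym (σ-eq y eq)) (ℕₚ.≤-trans ≤! (proj₁ (σ′-U y u x y≢x)))
    ; τ<e = λ {y} _ _ → s≤s (τ′≤9 y (kind j))
    ; noD = λ _ eq′ → inj₁≢inj₂ eq′ eq
    }

  module DeleteWitness {j x} (at : At j x) where
    open Gap (gap at)

    α β : Fin k → ℕ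
    α i with i Finₚ.≟ next j
    ... | yes _ = e
    ... | no  _ = 1
    β i with i Finₚ.≟ j
    ... | yes _ = 6 ℕ.+ e
    ... | no  _ = 11

    α-j : α (next j) ≡ e
    α-j with next j Finₚ.≟ next j
    ... | yes _ = refl
    ... | no ne = ⊥-elim (ne refl)

    β-j : β j ≡ 6 ℕ.+ e
    β-j with j Finₚ.≟ j
    ... | yes _ = refl
    ... | no ne = ⊥-elim (ne refl)

    1≤α : ∀ i → 1 ℕ.≤ α i
    1≤α i with i Finₚ.≟ next j
    ... | yes _ = ℕₚ.≤-trans ≤! 2≤e
    ... | no  _ = ≤!
    α≤4 : ∀ i → α i ℕ.≤ 4
    α≤4 i with i Finₚ.≟ next j
    ... | yes _ = e≤4
    ... | no  _ = ≤!
    8≤β : ∀ i → 8 ℕ.≤ β i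
    8≤β i with i Finₚ.≟ j
    ... | yes _ = ℕₚ.+-monoʳ-≤ 6 2≤e
    ... | no  _ = ≤!
    β≤11 : ∀ i → β i ℕ.≤ 11
    β≤11 i with i Finₚ.≟ j
    ... | yes _ = ℕₚ.≤-trans (ℕₚ.+-monoʳ-≤ 6 e≤4) ≤!
    ... | no  _ = ≤!
    α<σ : ∀ {y i} → y ≢ x → B y i → α i ℕ.< σ y i
    α<σ {y} {i} y≢x b with i Finₚ.≟ next j
    ... | yes refl = e<σ y≢x b
    ... | no  _    = ℕₚ.≤-trans ≤! (3≤σ′ y (kind (prev i)))
    τ<β : ∀ {y i} → y ≢ x → B y i → τ y i ℕ.< β i
    τ<β {y} {i} y≢x b with i Finₚ.≟ j
    ... | yes refl = τ<e y≢x b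
    ... | no  _    = ℕₚ.≤-trans (s≤s (τ′≤9 y (kind i))) ≤!
    10<β : ∀ {y i} → y ≢ x → kind i ≡ inj₁ y → 10 ℕ.< β i
    10<β {y} {i} y≢x eq with i Finₚ.≟ j
    ... | yes refl = ⊥-elim (noD y≢x eq)
    ... | no  _    = ≤!
    α<2 : ∀ {y i} → y ≢ x → kind i ≡ inj₁ y → α (next i) ℕ.< 2
    α<2 {y} {i} y≢x eq with next i Finₚ.≟ next j
    ... | no  _ = ≤!
    ... | yes p with refl ← next-injective p = ⊥-elim (noD y≢x eq)

    params : Params (_≢ x)
    params = record { α = α ; β = β ; 1≤α = 1≤α ; α≤4 = α≤4 ; 8≤β = 8≤β ; β≤11 = β≤11
                    ; α<σ = α<σ ; τ<β = τ<β ; 10<β = 10<β ; α<2 = α<2 }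

    open Model params

    e<6 : e ℕ.< 6
    e<6 = ℕₚ.≤-trans (s≤s e≤4) ≤!

    -- The complements of the arcs of `v j` and `v (next j)` now stop at `e` from either side, and
    -- no other complement reaches block `j`.
    Q-place : ∀ i → OnQ i j e
    Q-place i (inj₁ (refl , α<e)) = ℕₚ.<-irrefl α-j α<e
    Q-place i (inj₂ (refl , e<β)) = ℕₚ.<-irrefl (sym β-j) e<β

    -- The triangle of an octahedron uses up all witnesses, so it would contain the deleted `x`.
    no-triangle : ∀ {a b c} → Wit a → Wit b → Wit c → a ≢ x → b ≢ x → c ≢ x →
      Adj G a b → Adj G b c → Adj G a c → ⊥
    no-triangle wa wb wc a≢x b≢x c≢x ab bc ac with triangle⇒octahedron wa wb wc ab bc ac
    ... | inj₁ O = [ (λ p → a≢x (sym p)) , [ (λ p → b≢x (sym p)) , (λ p → c≢x (sym p)) ]′ ]′ (Octahedron.at-vertex O at)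
    ... | inj₂ O = [ (λ p → a≢x (sym p)) , [ (λ p → c≢x (sym p)) , (λ p → b≢x (sym p)) ]′ ]′ (Octahedron.at-vertex O at)

    helly : ∀ {m} (f : Fin m ↣ Fin n) → (∀ u → Injection.to f u ≢ x) → HellyCircularArc (induced G f)
    helly f avoids = model f avoids
      , model-helly f avoids (j , e , e<6 , λ {i} _ → Q-place i) no-triangle

  delete-Q : (∀ {a b c} → Wit a → Wit b → Wit c → Adj G a b → Adj G b c → Adj G a c → ⊥) →
    ∀ j {m} (f : Fin m ↣ Fin n) → (∀ u → Injection.to f u ≢ v j) → HellyCircularArc (induced G f)
  delete-Q no-triangle j f avoids = model f avoids
    -- Offset 0 of block `j` lies on every arc of `Q` except possibly that of the deleted `v j`.
    , model-helly f avoids (j , 0 , ≤! , λ alive → early (λ { refl → alive refl }) ≤!)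
        (λ a b c _ _ _ → no-triangle a b c)
    where open Model (default (_≢ v j))

delete-vertex : ∀ {n} {G : Graph n} (𝒬 : ObstacleEnumerationIn G) →
  ObstacleEnumerationIn.Essential 𝒬 → ObstacleEnumerationIn.Covering 𝒬 →
  ∀ x {m} (f : Fin m ↣ Fin n) → (∀ u → Injection.to f u ≢ x) → HellyCircularArc (induced G f)
delete-vertex {n} {G} 𝒬 essential covering x f avoids with covering x
... | inj₂ (j , x∈) = DeleteWitness.helly (members⇒at {j} x∈) f avoids
  where
  open Obstacle 𝒬
  open Delete 𝒬 essential covering
... | inj₁ (j , refl) with Finₚ.any? (λ a → Finₚ.any? (λ b → Finₚ.any? (λ c →
        witness? a ×-dec witness? b ×-dec witness? c ×-dec adj? G a b ×-dec adj? G b c ×-dec adj? G a c)))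
  where
  open Obstacle 𝒬
  witness? : ∀ a → Dec (∃[ i ] At i a)
  witness? a = Finₚ.any? λ i → at? i a
...   | no none = Delete.delete-Q 𝒬 essential covering
          (λ wa wb wc ab bc ac → none (_ , _ , _ , at wa , at wb , at wc , ab , bc , ac)) j f avoids
  where
  open Obstacle 𝒬
  open Structure 𝒬 essential
  at : ∀ {a} → Wit a → ∃[ i ] At i a
  at w = let i , a∈ = wit⇒witness w in i , members⇒at a∈
-- In the octahedron `v j` is a witness of the exchanged enumeration, so its deletion is the
-- deletion of a witness.
...   | yes (a , b , c , (_ , wa) , (_ , wb) , (_ , wc) , ab , bc , ac) =
  [ exchange , exchange ]′ (triangle⇒octahedron (at⇒wit wa) (at⇒wit wb) (at⇒wit wc) ab bc ac)
  where
  open Structure 𝒬 essential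
  open Triangle 𝒬 essential
  exchange : ∀ {a b c} → Octahedron a b c → HellyCircularArc (induced G f)
  exchange O = Delete.DeleteWitness.helly exchanged exchanged-essential exchanged-covering
      (Obstacle.members⇒at exchanged (proj₂ (v-witness j))) f avoids
    where open Exchange O covering

essential⇒minimal : ∀ {n} (G : Graph n) → EssentialObstacle G →
  CircularArc G × MinimalForbiddenInducedSubgraph HellyCircularArc G
essential⇒minimal {n} G ((𝒬 , covering) , essential) =
    Delete.circularArc 𝒬 essential covering
  , (λ (M , helly) → Obstacle.not-helly 𝒬 id↣ (λ x _ → x , refl)
       (record { arc = arc M ; adj⇔meets = adj⇔meets M } , helly))
  , λ f (x , avoids) → delete-vertex 𝒬 essential covering x f avoids
  where
  id↣ : Fin n ↣ Fin n
  id↣ = mk↣ (λ e → e)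

theorem2 : ∀ {n : ℕ} (G : Graph n) →
    (CircularArc G × MinimalForbiddenInducedSubgraph HellyCircularArc G) ⇔ EssentialObstacle G
theorem2 G = mk⇔ (λ (M , minimal) → minimal⇒essential G M minimal) (essential⇒minimal G)
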